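{- As formal power series in commuting indeterminates $x,y$ with coefficients in $\mathrm{End}_K(\mathbf F)$, \[ U(x)D(y)\prod_{i=0}^{n-1}\frac{1}{1-q^{2i}xy} = D(y)U(x). \]
   Context: Fix an integer $n\ge 1$. Partitions are drawn in English notation; the box in row $r$ and column $c$ lies on diagonal $c-r$. An $n$-ribbon is a connected skew shape with $n$ boxes containing no $2\times 2$ square; its head is its top-right box, and its spin is its number of rows minus $1$. Let $K=\mathbb{C}(q)$ and let $\mathbf F$ be the $K$-vector space with basis the set of all partitions. For $i\in\mathbb{Z}$, $u_i\in\mathrm{End}_K(\mathbf F)$ is defined by $u_i(\lambda)=q^{\mathrm{spin}(\mu/\lambda)}\mu$ if $\mu/\lambda$ is an $n$-ribbon with head on diagonal $i$ for some partition $\mu$, and $u_i(\lambda)=0$ otherwise; $d_i(\lambda)=q^{\mathrm{spin}(\lambda/\nu)}\nu$ if $\lambda/\nu$ is an $n$-ribbon with head on diagonal $i$ for some partition $\nu$, and $d_i(\lambda)=0$ otherwise. Define \[U(x)=\cdots(1+xu_2)(1+xu_1)(1+xu_0)(1+xu_{ -1})\cdots,\qquad D(x)=\cdots(1+xd_{ -2})(1+xd_{ -1})(1+xd_0)(1+xd_1)\cdots,\] i.e. in $U$ factors with larger index stand to the left, and in $D$ factors with smaller index stand to the left. Each coefficient of these products acts on any given partition through finitely many nonzero terms, so they are well-defined power series of operators. -}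

module Defs where

open import Level using (Level)
open import Data.Bool using (Bool; true; false; _∧_; _∨_; not; if_then_else_)
open import Data.Nat as ℕ using (ℕ; zero; suc; _∸_; _≡ᵇ_; _≤ᵇ_)
open import Data.Integer as ℤ using (ℤ; +_; _-_)
open import Data.List
  using (List; []; _∷_; [_]; map; concatMap; upTo; length; filterᵇ; deduplicate; foldr; foldl; applyUpTo)
open import Data.List.Properties using (≡-dec)
open import Data.Bool.ListAction using (all; any)
open import Data.List.Relation.Unary.All using (All)
open import Data.List.Relation.Unary.Linked using (Linked)
open import Data.Maybe using (Maybe; just; nothing)
open import Data.Product using (_×_; _,_; proj₁; proj₂)
open import Relation.Nullary.Decidable using (⌊_⌋)
open import Algebra.Bundles using (CommutativeRing)

-- Partitions: lists of positive parts, weakly decreasing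
-- (λ₁ ≥ λ₂ ≥ … ≥ λ_ℓ ≥ 1).  Rows and columns are 0-indexed; the box
-- in row r, column c lies on diagonal c - r (an index shift of both
-- coordinates does not change diagonals).

Partition : Set
Partition = List ℕ

IsPartition : Partition → Set
IsPartition λ' = All (λ p → 1 ℕ.≤ p) λ' × Linked ℕ._≥_ λ'

size : Partition → ℕ
size = foldr ℕ._+_ 0

part : Partition → ℕ → ℕ
part []       _       = 0
part (p ∷ _)  zero    = p
part (_ ∷ ps) (suc r) = part ps r

-- all partitions of m with all parts ≤ k (fuel f ≥ m)
partsBounded : ℕ → ℕ → ℕ → List Partition
partsBounded _       zero    _ = [ [] ]
partsBounded zero    (suc _) _ = []
partsBounded (suc f) m@(suc _) k =
  concatMap (λ p → map (p ∷_) (partsBounded f (m ∸ p) p))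
            (applyUpTo suc (ℕ._⊓_ k m))

partitions : ℕ → List Partition
partitions m = partsBounded m m m

Cell : Set
Cell = ℕ × ℕ      -- (row , column)

_==ᶜ_ : Cell → Cell → Bool
(r , c) ==ᶜ (r' , c') = (r ≡ᵇ r') ∧ (c ≡ᵇ c')

_∈ᶜ_ : Cell → List Cell → Bool
x ∈ᶜ xs = any (x ==ᶜ_) xs

contained : Partition → Partition → Bool
contained λ' μ = (length λ' ≤ᵇ length μ)
               ∧ all (λ r → part λ' r ≤ᵇ part μ r) (upTo (length λ'))

skewCells : Partition → Partition → List Cell
skewCells λ' μ =
  concatMap (λ r → map (λ c → (r , c))
                       (applyUpTo (part λ' r ℕ.+_) (part μ r ∸ part λ' r)))
            (upTo (length μ))

adjacent : Cell → Cell → Bool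
adjacent (r , c) (r' , c') =
    ((r ≡ᵇ r') ∧ ((c ≡ᵇ suc c') ∨ (c' ≡ᵇ suc c)))
  ∨ ((c ≡ᵇ c') ∧ ((r ≡ᵇ suc r') ∨ (r' ≡ᵇ suc r)))

iterate : {A : Set} → ℕ → (A → A) → A → A
iterate zero    f x = x
iterate (suc k) f x = f (iterate k f x)

grow : List Cell → List Cell → List Cell
grow cells S = filterᵇ (λ b → any (λ s → (b ==ᶜ s) ∨ adjacent b s) S) cells

-- a set of boxes is connected: every box is reachable from the first one
-- (paths of length ≤ number of boxes suffice)
connected : List Cell → Bool
connected []             = true
connected cells@(b ∷ _)  =
  all (λ x → x ∈ᶜ iterate (length cells) (grow cells) [ b ]) cells

has2x2 : List Cell → Bool
has2x2 cells =
  any (λ { (r , c) → ((r , suc c) ∈ᶜ cells) ∧ ((suc r , c) ∈ᶜ cells)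
                     ∧ ((suc r , suc c) ∈ᶜ cells) })
      cells

isRibbon : ℕ → Partition → Partition → Bool
isRibbon n λ' μ =
  let cs = skewCells λ' μ in
  contained λ' μ ∧ (length cs ≡ᵇ n) ∧ connected cs ∧ not (has2x2 cs)

topRight : List Cell → Cell
topRight []       = (0 , 0)
topRight (x ∷ xs) = foldl better x xs
  where
  better : Cell → Cell → Cell
  better (r , c) (r' , c') =
    if (r' ℕ.<ᵇ r) ∨ ((r' ≡ᵇ r) ∧ (c ℕ.<ᵇ c')) then (r' , c') else (r , c)

diagonal : Cell → ℤ
diagonal (r , c) = (+ c) - (+ r)

headDiag : Partition → Partition → ℤ
headDiag λ' μ = diagonal (topRight (skewCells λ' μ))

spin : Partition → Partition → ℕ
spin λ' μ = length (deduplicate ℕ._≟_ (map proj₁ (skewCells λ' μ))) ∸ 1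

_==ℤ_ : ℤ → ℤ → Bool
i ==ℤ j = ⌊ i ℤ.≟ j ⌋

_<ℤ_ : ℤ → ℤ → Bool
i <ℤ j = not (j ℤ.≤ᵇ i)

module Fock {c ℓ : Level} (R : CommutativeRing c ℓ) (q : CommutativeRing.Carrier R) (n : ℕ) where
  open CommutativeRing R

  pow : Carrier → ℕ → Carrier
  pow x zero    = 1#
  pow x (suc k) = x * pow x k

  -- elements of F: finite formal linear combinations of partitions
  Vect : Set c
  Vect = List (Carrier × Partition)

  coeffAt : Partition → Vect → Carrier
  coeffAt μ v = foldr _+_ 0# (map proj₁ (filterᵇ (λ e → ⌊ ≡-dec ℕ._≟_ (proj₂ e) μ ⌋) v))

  scale : Carrier → Vect → Vect
  scale w v = map (λ { (a , ν) → (w * a , ν) }) v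

  -- linear operators, given by their values on basis vectors
  Op : Set c
  Op = Partition → Vect

  apply : Op → Vect → Vect
  apply f v = concatMap (λ { (a , ν) → scale a (f ν) }) v

  addable : Partition → List (ℤ × Partition)
  addable λ' = map (λ μ → (headDiag λ' μ , μ))
                   (filterᵇ (isRibbon n λ') (partitions (size λ' ℕ.+ n)))

  removable : Partition → List (ℤ × Partition)
  removable λ' = map (λ ν → (headDiag ν λ' , ν))
                     (filterᵇ (λ ν → isRibbon n ν λ') (partitions (size λ' ∸ n)))

  u : ℤ → Op
  u i λ' = map (λ μ → (pow q (spin λ' (proj₂ μ)) , proj₂ μ))
               (filterᵇ (λ e → proj₁ e ==ℤ i) (addable λ'))

  d : ℤ → Op
  d i λ' = map (λ ν → (pow q (spin (proj₂ ν) λ') , proj₂ ν))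
               (filterᵇ (λ e → proj₁ e ==ℤ i) (removable λ'))

  above : Maybe ℤ → ℤ → Bool
  above nothing   i = true
  above (just lo) i = lo <ℤ i

  below : Maybe ℤ → ℤ → Bool
  below nothing   j = true
  below (just hi) j = j <ℤ hi

  -- Ucoef a lo = Σ_{i₁ > i₂ > ⋯ > i_a > lo} u_{i₁} u_{i₂} ⋯ u_{i_a}
  -- (lo = nothing : no lower bound).  Only indices i with u_i λ ≠ 0
  -- (heads of addable ribbons) are summed over; the others contribute 0.
  -- With lo = nothing this is the coefficient of x^a in U(x).
  Ucoef : ℕ → Maybe ℤ → Op
  Ucoef zero    lo λ' = [ (1# , λ') ]
  Ucoef (suc a) lo λ' =
    concatMap (λ i → apply (Ucoef a (just i)) (u i λ'))
              (filterᵇ (above lo) (deduplicate ℤ._≟_ (map proj₁ (addable λ'))))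

  -- Dcoef b hi = Σ_{j₁ < j₂ < ⋯ < j_b < hi} d_{j₁} d_{j₂} ⋯ d_{j_b}
  -- With hi = nothing this is the coefficient of y^b in D(y).
  Dcoef : ℕ → Maybe ℤ → Op
  Dcoef zero    hi λ' = [ (1# , λ') ]
  Dcoef (suc b) hi λ' =
    concatMap (λ j → apply (Dcoef b (just j)) (d j λ'))
              (filterᵇ (below hi) (deduplicate ℤ._≟_ (map proj₁ (removable λ'))))

  -- hcoef m k = coefficient of t^k in ∏_{i=0}^{m-1} 1/(1 - q^{2i} t)
  --           = Σ_{j=0}^{k} (q^{2(m-1)})^j · hcoef (m-1) (k-j)
  hcoef : ℕ → ℕ → Carrier
  hcoef zero    zero    = 1#
  hcoef zero    (suc k) = 0#
  hcoef (suc m) k =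
    foldr _+_ 0# (map (λ j → pow (pow q (2 ℕ.* m)) j * hcoef m (k ∸ j)) (upTo (suc k)))

  -- coefficient of x^a y^b in U(x) D(y) ∏_{i=0}^{n-1} 1/(1 - q^{2i} x y)
  -- applied to the basis vector λ
  lhs : ℕ → ℕ → Op
  lhs a b λ' =
    concatMap (λ k → scale (hcoef n k)
                           (apply (Ucoef (a ∸ k) nothing) (Dcoef (b ∸ k) nothing λ')))
              (upTo (suc (ℕ._⊓_ a b)))

  -- coefficient of x^a y^b in D(y) U(x) applied to λ
  rhs : ℕ → ℕ → Op
  rhs a b λ' = apply (Dcoef b nothing) (Ucoef a nothing λ')

-- Describe a partition λ by its rim, sending k to the first row in which the diagonal k
-- lies outside λ.  Adding an n-ribbon with head on diagonal i raises the rim by one on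
-- the diagonals i-n+1, …, i and changes nothing else; it is possible exactly when the
-- rim is flat after i and drops after i-n, and the spin is the difference of its values
-- at i-n+1 and i.  Hence u_i and d_j commute for i ≠ j, the two spins adding up to the
-- same total in either order.  Let X_i multiply λ by ∏_{j<w} 1/(1 - q^{2j} x y), where w
-- is the number of drops of the rim after i-n+1, …, i.  The case i = j is then
--   (1 + y d_i) X_i (1 + x u_i) = (1 + x u_i) X_{i-1} (1 + y d_i).
-- For large i the factor X_i is trivial and for small i it is ∏_{j<n} 1/(1 - q^{2j} x y),
-- so exchanging the factors of D(y) and U(x) one diagonal at a time produces the product.

module Submission where

open import Defs
open import Algebra.Bundles using (CommutativeRing)
import Algebra.Solver.Ring.NaturalCoefficients.Default as SemiringSolver
open import Data.Bool.Base using (Bool; true; false; T; _∧_; _∨_; not; if_then_else_)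
open import Data.Bool.ListAction using (all; any)
open import Data.Bool.Properties using (T-∧; T-∨; T-≡)
open import Data.Empty using (⊥; ⊥-elim)
open import Data.Integer.Base as ℤ using (ℤ; +_; -[1+_]; -_)
import Data.Integer.Properties as ℤ
open import Data.Integer.Tactic.RingSolver using (solve-∀)
open import Data.List.Base hiding (iterate; all; any; find; tail)
open import Data.List.Membership.Propositional using (_∈_; _∉_; lose; find)
open import Data.List.Membership.Propositional.Properties
open import Data.List.Properties
  using (length-map; length-applyUpTo; length-++; length-++-sucʳ; ≡-dec; ∷-injectiveʳ)
open import Data.List.Relation.Binary.Disjoint.Propositional using (Disjoint)
open import Data.List.Relation.Unary.All as All using (All; []; _∷_)
import Data.List.Relation.Unary.All.Properties as All
open import Data.List.Relation.Unary.AllPairs as AllPairs using ([]; _∷_)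
import Data.List.Relation.Unary.AllPairs.Properties as AllPairs
open import Data.List.Relation.Unary.Any as Any using (here; there)
import Data.List.Relation.Unary.Any.Properties as Any
open import Data.List.Relation.Unary.Linked as Linked using (Linked; []; [-]; _∷_)
import Data.List.Relation.Unary.Unique.DecPropositional.Properties as DecUnique
open import Data.List.Relation.Unary.Unique.Propositional using (Unique)
import Data.List.Relation.Unary.Unique.Propositional.Properties as Unique
open import Data.Maybe.Base using (Maybe; just; nothing)
open import Data.Nat.Base as ℕ using (ℕ; zero; suc; z≤n; s≤s; _∸_; _≡ᵇ_; _≤ᵇ_; _<ᵇ_; _≤_)
import Data.Nat.Properties as ℕ
open import Data.Nat.Tactic.RingSolver using () renaming (solve-∀ to ℕ-solve-∀)
open import Data.Product.Base using (∃; ∃₂; _×_; _,_; proj₁; proj₂; uncurry)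
open import Data.Sum.Base using (_⊎_; inj₁; inj₂; [_,_]′)
open import Data.Unit.Base using (tt)
open import Function.Base using (_∘_; id; case_of_)
open import Function.Bundles using (Equivalence)
open import Level using (Level)
open import Relation.Binary.Definitions using (tri<; tri≈; tri>)
open import Relation.Binary.PropositionalEquality hiding ([_])
import Relation.Binary.Reasoning.Setoid as SetoidReasoning
open import Relation.Nullary using (¬_; Dec; yes; no; contradiction)
open import Relation.Nullary.Decidable using (toWitness; fromWitness; does; _×-dec_; ⌊_⌋)
open import Algebra.Properties.CommutativeSemigroup ℕ.+-commutativeSemigroup
  using (interchange; x∙yz≈y∙xz)

-- The case i = j therefore concerns pairs λ, μ differing by one ribbon, of spin w say. With t = q^w
-- the exchange produces f + t² x y h where h is wanted, so h has to be f / (1 - t² x y): passing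
-- from i to i - 1 must give λ one more factor and μ one fewer, namely the factor with j = w.
-- Counting the drops in a window of n steps achieves this, and the count does not change where no
-- ribbon with head i can be added or removed.
--
-- Vectors are lists without a normal form, so operators are compared through their transposes: a
-- functional with values in power series is pulled back along 1 + x u_i and 1 + y d_i. The operator
-- that acts first then stands outermost.
--
-- The infinite products are cut off. Once the partition and the power of x are fixed, all
-- partitions met have bounded size, and only heads in a finite range can act on them. Equalities
-- between whole products therefore carry a size bound.

≤-by-< : ∀ {a b} → (∀ {r} → r ℕ.< a → r ℕ.< b) → a ℕ.≤ b
≤-by-< {a} {b} f with a ℕ.≤? b
... | yes a≤b = a≤b
... | no a≰b = ⊥-elim (ℕ.<-irrefl refl (f (ℕ.≰⇒> a≰b)))

i<1+i : ∀ i → i ℤ.< ℤ.suc i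
i<1+i i = ℤ.suc[i]≤j⇒i<j ℤ.≤-refl

suc-+-suc : ∀ k r → ℤ.suc k ℤ.+ + r ≡ k ℤ.+ + suc r
suc-+-suc k r = trans (cong (ℤ._+ + r) (ℤ.+-comm (+ 1) k)) (ℤ.+-assoc k (+ 1) (+ r))

n≤1+pred[n] : ∀ n → n ℕ.≤ suc (ℕ.pred n)
n≤1+pred[n] zero = z≤n
n≤1+pred[n] (suc n) = ℕ.≤-refl

-- Rims of partitions

part-bound : ∀ {p ps} → Linked ℕ._≥_ (p ∷ ps) → ∀ r → part ps r ℕ.≤ p
part-bound [-] r = z≤n
part-bound (p≥p' ∷ ds) zero = p≥p'
part-bound (p≥p' ∷ ds) (suc r) = ℕ.≤-trans (part-bound ds r) p≥p'

part-antitone : ∀ {λ'} → Linked ℕ._≥_ λ' → ∀ r → part λ' (suc r) ℕ.≤ part λ' r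
part-antitone [] r = z≤n
part-antitone [-] r = z≤n
part-antitone (p≥p' ∷ ds) zero = p≥p'
part-antitone (p≥p' ∷ ds) (suc r) = part-antitone ds r

part-end : ∀ λ' {r} → length λ' ℕ.≤ r → part λ' r ≡ 0
part-end [] _ = refl
part-end (p ∷ ps) (s≤s l≤r) = part-end ps l≤r

-- rim λ k is the row of the first box of the diagonal k lying outside λ, so that
-- consecutive values describe the steps of the boundary path of λ.  Boxes with
-- negative column count as inside.
rim : Partition → ℤ → ℕ
rim [] (+ _) = 0
rim [] -[1+ m ] = suc m
rim (p ∷ ps) k with k ℤ.<? + p
... | yes _ = suc (rim ps (ℤ.suc k))
... | no _ = 0

-- The box in row r of diagonal k has column k + r. Deleting the first row shifts every diagonal by
-- one, which drives the induction here and in `box⇐`; the two make rims and row lengths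
-- interchangeable.
box⇒ : ∀ {λ'} → Linked ℕ._≥_ λ' → ∀ {r k} → r ℕ.< rim λ' k → k ℤ.+ + r ℤ.< + part λ' r
box⇒ {[]} _ {r} { -[1+ m ]} r<m = ℤ.<-≤-trans (ℤ.⊖-monoˡ-< (suc m) r<m) (ℤ.≤-reflexive (ℤ.n⊖n≡0 (suc m)))
box⇒ {p ∷ ps} ds {r} {k} r<rim with k ℤ.<? + p
box⇒ {p ∷ ps} ds {zero} {k} r<rim | yes k<p = subst (ℤ._< + p) (sym (ℤ.+-identityʳ k)) k<p
box⇒ {p ∷ ps} ds {suc r} {k} (s≤s r<rim) | yes k<p =
  subst (ℤ._< + part ps r) (suc-+-suc k r) (box⇒ (Linked.tail ds) r<rim)

box⇐ : ∀ {λ'} → Linked ℕ._≥_ λ' → ∀ {r k} → k ℤ.+ + r ℤ.< + part λ' r → r ℕ.< rim λ' k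
box⇐ {[]} _ {r} { -[1+ m ]} b = ℕ.≰⇒> λ m≤r →
  ℤ.<⇒≱ b (ℤ.≤-trans (ℤ.≤-reflexive (sym (ℤ.n⊖n≡0 (suc m)))) (ℤ.⊖-monoˡ-≤ (suc m) m≤r))
box⇐ {[]} _ {r} {+ m} (ℤ.+<+ ())
box⇐ {p ∷ ps} ds {r} {k} b with k ℤ.<? + p
box⇐ {p ∷ ps} ds {zero} {k} b | yes k<p = s≤s z≤n
box⇐ {p ∷ ps} ds {suc r} {k} b | yes k<p =
  s≤s (box⇐ (Linked.tail ds) (subst (ℤ._< + part ps r) (sym (suc-+-suc k r)) b))
box⇐ {p ∷ ps} ds {r} {k} b | no k≮p = ⊥-elim (k≮p (ℤ.≤-<-trans (ℤ.i≤i+j k (+ r))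
  (ℤ.<-≤-trans b (ℤ.+≤+ (bound r)))))
  where
  bound : ∀ r → part (p ∷ ps) r ℕ.≤ p
  bound zero = ℕ.≤-refl
  bound (suc r) = part-bound ds r

-- What singles out the rims: steps of 0 or -1, and tails that follow the two axes.
record Profile (f : ℤ → ℕ) : Set where
  field
    antitone : ∀ {k l} → k ℤ.≤ l → f l ℕ.≤ f k
    slope : ∀ k → f k ℕ.≤ suc (f (ℤ.suc k))
    left : ∃ λ m → ∀ t → m ℕ.≤ t → f (- (+ t)) ≡ t
    right : ∃ λ N → f (+ N) ≡ 0

module _ {λ' : Partition} (ds : Linked ℕ._≥_ λ') where

  rim-antitone : ∀ {k l} → k ℤ.≤ l → rim λ' l ℕ.≤ rim λ' k
  rim-antitone k≤l = ≤-by-< λ {r} r<l → box⇐ ds (ℤ.≤-<-trans (ℤ.+-monoˡ-≤ (+ r) k≤l) (box⇒ ds r<l))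

  rim-slope : ∀ k → rim λ' k ℕ.≤ suc (rim λ' (ℤ.suc k))
  rim-slope k = ≤-by-< λ
    { {zero} _ → s≤s z≤n
    ; {suc r} r<k → s≤s (box⇐ ds (ℤ.≤-<-trans (ℤ.≤-reflexive (suc-+-suc k r))
        (ℤ.<-≤-trans (box⇒ ds r<k) (ℤ.+≤+ (part-antitone ds r))))) }

  rim-left : ∀ t → length λ' ℕ.≤ t → rim λ' (- (+ t)) ≡ t
  rim-left t l≤t = ℕ.≤-antisym
    (≤-by-< λ {r} r<rim → ℕ.≰⇒> λ t≤r → ℤ.<⇒≱ (box⇒ ds r<rim)
      (subst₂ ℤ._≤_ (cong +_ (sym (part-end λ' (ℕ.≤-trans l≤t t≤r)))) (sym (ℤ.-m+n≡n⊖m t r))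
        (ℤ.≤-trans (ℤ.≤-reflexive (sym (ℤ.n⊖n≡0 t))) (ℤ.⊖-monoˡ-≤ t t≤r))))
    (≤-by-< λ {r} r<t → box⇐ ds (ℤ.≤-<-trans (ℤ.≤-reflexive (ℤ.-m+n≡n⊖m t r))
      (ℤ.<-≤-trans (ℤ.⊖-monoˡ-< t r<t)
        (ℤ.≤-trans (ℤ.≤-reflexive (ℤ.n⊖n≡0 t)) (ℤ.+≤+ z≤n)))))

  rim-right : ∀ {t} → part λ' 0 ℕ.≤ t → rim λ' (+ t) ≡ 0
  rim-right {t} p≤t = ℕ.n≤0⇒n≡0 (≤-by-< λ {r} r<rim →
    contradiction (box⇒ ds {0} {+ t} (ℕ.≤-<-trans z≤n r<rim))
      (ℤ.≤⇒≯ (ℤ.+≤+ (ℕ.≤-trans p≤t (ℕ.m≤m+n t 0)))))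

part-injective : ∀ {λ' μ} → All (1 ℕ.≤_) λ' → All (1 ℕ.≤_) μ → (∀ r → part λ' r ≡ part μ r) → λ' ≡ μ
part-injective [] [] e = refl
part-injective [] (p ∷ _) e = contradiction (e 0) (ℕ.<⇒≢ p)
part-injective (p ∷ _) [] e = contradiction (sym (e 0)) (ℕ.<⇒≢ p)
part-injective (_ ∷ ps) (_ ∷ qs) e = cong₂ _∷_ (e 0) (part-injective ps qs (e ∘ suc))

m-n+n : ∀ m n → + m ℤ.- + n ℤ.+ + n ≡ + m
m-n+n m n = trans (ℤ.+-assoc (+ m) (- (+ n)) (+ n))
  (trans (cong (ℤ._+_ (+ m)) (ℤ.+-inverseˡ (+ n))) (ℤ.+-identityʳ (+ m)))

rim⊆⇒part≤ : ∀ {λ' μ} → Linked ℕ._≥_ λ' → Linked ℕ._≥_ μ → (∀ k → rim λ' k ℕ.≤ rim μ k) →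
             ∀ r → part λ' r ℕ.≤ part μ r
rim⊆⇒part≤ {λ'} {μ} dλ dμ le r = ≤-by-< λ {c} c<p → ℤ.drop‿+<+
  (subst (ℤ._< + part μ r) (m-n+n c r)
    (box⇒ dμ (ℕ.<-≤-trans (box⇐ dλ {r} {+ c ℤ.- + r}
      (subst (ℤ._< + part λ' r) (sym (m-n+n c r)) (ℤ.+<+ c<p))) (le _))))

rim-injective : ∀ {λ' μ} → IsPartition λ' → IsPartition μ → (∀ k → rim λ' k ≡ rim μ k) → λ' ≡ μ
rim-injective (pλ , dλ) (pμ , dμ) e = part-injective pλ pμ λ r →
  ℕ.≤-antisym (rim⊆⇒part≤ dλ dμ (ℕ.≤-reflexive ∘ e) r)
              (rim⊆⇒part≤ dμ dλ (ℕ.≤-reflexive ∘ sym ∘ e) r)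

-- Every profile is the rim of a partition: its first part is the first zero of
-- the profile on the nonnegative integers, and the remaining parts have the
-- profile k ↦ f (k - 1) - 1.

width : ℕ → (ℤ → ℕ) → ℕ
width zero f = 0
width (suc N) f with f (+ N)
... | zero = width N f
... | suc _ = suc N

dropRow : (ℤ → ℕ) → ℤ → ℕ
dropRow f k = ℕ.pred (f (ℤ.pred k))

build : ℕ → ℕ → (ℤ → ℕ) → Partition
build N zero f = []
build N (suc m) f with f (+ 0)
-- No row is left. Recursing instead of returning `[]` lets `rim-build` lower the bound in `left`
-- one by one down to zero.
... | zero = build N m f
... | suc _ = width N f ∷ build N m (dropRow f)

module _ {f : ℤ → ℕ} (antitone : ∀ {k l} → k ℤ.≤ l → f l ℕ.≤ f k) where

  width-zero : ∀ N → f (+ N) ≡ 0 → f (+ width N f) ≡ 0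
  width-zero zero fN≡0 = fN≡0
  width-zero (suc N) fN≡0 with f (+ N) in eq
  ... | zero = width-zero N eq
  ... | suc _ = fN≡0

  width-positive : ∀ N {k} → k ℤ.< + width N f → 0 ℕ.< f k ⊎ k ℤ.< + 0
  width-positive zero k<0 = inj₂ k<0
  width-positive (suc N) k<w with f (+ N) in eq
  ... | zero = width-positive N k<w
  ... | suc v = inj₁ (ℕ.≤-trans (subst (1 ℕ.≤_) (sym eq) (s≤s z≤n)) (antitone (ℤ.i<j⇒i≤pred[j] k<w)))

  f≢0⇒width>0 : ∀ N → f (+ N) ≡ 0 → ∀ {v} → f (+ 0) ≡ suc v → 0 ℕ.< width N f
  f≢0⇒width>0 N fN≡0 f0 with width N f | width-zero N fN≡0
  ... | zero | f0≡0 = contradiction (trans (sym f0≡0) f0) λ ()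
  ... | suc _ | _ = s≤s z≤n

  width≤ : ∀ N {p} → f (+ p) ≡ 0 → width N f ℕ.≤ p
  width≤ N {p} fp≡0 = ≤-by-< λ {r} r<w → ℕ.≰⇒> λ p≤r →
    [ (λ 0<f → ℕ.<⇒≱ 0<f (subst (f (+ r) ℕ.≤_) fp≡0 (antitone (ℤ.+≤+ p≤r))))
    , (λ { (ℤ.+<+ ()) }) ]′ (width-positive N {+ r} (ℤ.+<+ r<w))

dropRow-antitone : ∀ {f} → (∀ {k l} → k ℤ.≤ l → f l ℕ.≤ f k) →
                   ∀ {k l} → k ℤ.≤ l → dropRow f l ℕ.≤ dropRow f k
dropRow-antitone antitone k≤l = ℕ.pred-mono-≤ (antitone (ℤ.pred-mono k≤l))

dropRow-slope : ∀ {f} → (∀ k → f k ℕ.≤ suc (f (ℤ.suc k))) →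
                ∀ k → dropRow f k ℕ.≤ suc (dropRow f (ℤ.suc k))
dropRow-slope {f} slope k = ℕ.≤-trans (ℕ.pred-mono-≤ step) (ℕ.≤-trans (n≤1+pred[n] (f k)) (ℕ.≤-reflexive eq))
  where
  step : f (ℤ.pred k) ℕ.≤ suc (f k)
  step = subst (λ l → f (ℤ.pred k) ℕ.≤ suc (f l)) (ℤ.suc-pred k) (slope (ℤ.pred k))
  eq : suc (ℕ.pred (f k)) ≡ suc (ℕ.pred (f (ℤ.pred (ℤ.suc k))))
  eq = cong (suc ∘ ℕ.pred ∘ f) (sym (ℤ.pred-suc k))

right⇒dropRow : ∀ {f} → (∀ k → f k ℕ.≤ suc (f (ℤ.suc k))) →
                ∀ {p} → 0 ℕ.< p → f (+ p) ≡ 0 → dropRow f (+ p) ≡ 0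
right⇒dropRow {f} slope {suc p} _ fp≡0 =
  ℕ.n≤0⇒n≡0 (ℕ.pred-mono-≤ (subst (λ v → f (+ p) ℕ.≤ suc v) fp≡0 (slope (+ p))))

-- The preceding part is generalised to any zero p of the profile: the width is the first zero,
-- hence at most p, and `right⇒dropRow` hands it on as a zero for the next row.
build-linked : ∀ m {N f} → (∀ {k l} → k ℤ.≤ l → f l ℕ.≤ f k) → (∀ k → f k ℕ.≤ suc (f (ℤ.suc k))) →
               f (+ N) ≡ 0 → ∀ {p} → f (+ p) ≡ 0 → Linked ℕ._≥_ (p ∷ build N m f)
build-linked zero anti slope fN fp = [-]
build-linked (suc m) {N} {f} anti slope fN fp with f (+ 0) in eq
... | zero = build-linked m anti slope fN fp
... | suc v = width≤ anti N fp ∷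
  build-linked m (dropRow-antitone {f} anti) (dropRow-slope slope)
    (right⇒dropRow slope (ℕ.<-≤-trans w>0 (width≤ anti N fN)) fN) (right⇒dropRow slope w>0 (width-zero anti N fN))
  where w>0 = f≢0⇒width>0 anti N fN eq

build-positive : ∀ m {N f} → (∀ {k l} → k ℤ.≤ l → f l ℕ.≤ f k) → (∀ k → f k ℕ.≤ suc (f (ℤ.suc k))) →
                 f (+ N) ≡ 0 → All (1 ℕ.≤_) (build N m f)
build-positive zero anti slope fN = []
build-positive (suc m) {N} {f} anti slope fN with f (+ 0) in eq
... | zero = build-positive m anti slope fN
... | suc v = w>0 ∷
  build-positive m (dropRow-antitone {f} anti) (dropRow-slope slope)
    (right⇒dropRow slope (ℕ.<-≤-trans w>0 (width≤ anti N fN)) fN)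
  where w>0 = f≢0⇒width>0 anti N fN eq

rim-build : ∀ m {N f} → (∀ {k l} → k ℤ.≤ l → f l ℕ.≤ f k) → (∀ k → f k ℕ.≤ suc (f (ℤ.suc k))) →
            (∀ t → m ℕ.≤ t → f (- (+ t)) ≡ t) → f (+ N) ≡ 0 → ∀ k → rim (build N m f) k ≡ f k
rim-build zero {N} {f} anti slope left fN (+ k) =
  sym (ℕ.n≤0⇒n≡0 (subst (f (+ k) ℕ.≤_) (left 0 z≤n) (anti (ℤ.+≤+ z≤n))))
rim-build zero anti slope left fN -[1+ t ] = sym (left (suc t) z≤n)
rim-build (suc m) {N} {f} anti slope left fN k with f (+ 0) in eq
... | zero = rim-build m anti slope left′ fN k
  where
  bound : ∀ t → f (- (+ t)) ℕ.≤ t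
  bound zero = ℕ.≤-reflexive eq
  bound (suc t) = ℕ.≤-trans (slope (- (+ suc t)))
    (s≤s (subst (λ l → f l ℕ.≤ t) (sym (ℤ.1-[1+n]≡-n t)) (bound t)))
  left′ : ∀ t → m ℕ.≤ t → f (- (+ t)) ≡ t
  left′ t m≤t = ℕ.≤-antisym (bound t) (ℕ.s≤s⁻¹ (subst₂ ℕ._≤_ (left (suc t) (s≤s m≤t))
    (cong (suc ∘ f) (ℤ.1-[1+n]≡-n t)) (slope (- (+ suc t)))))
... | suc v with k ℤ.<? + width N f
...   | yes k<w = trans (cong suc (trans
          (rim-build m {N} (dropRow-antitone {f} anti) (dropRow-slope slope)
            (λ t m≤t → cong ℕ.pred (trans (cong f (sym (ℤ.neg-suc t))) (left (suc t) (s≤s m≤t))))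
            (right⇒dropRow slope (ℕ.<-≤-trans w>0 (width≤ anti N fN)) fN) (ℤ.suc k))
          (cong (ℕ.pred ∘ f) (ℤ.pred-suc k))))
        (ℕ.suc-pred (f k) {{ℕ.>-nonZero fk>0}})
  where
  w>0 = f≢0⇒width>0 anti N fN eq
  fk>0 : 0 ℕ.< f k
  fk>0 = [ id , (λ k<0 → ℕ.≤-trans (subst (1 ℕ.≤_) (sym eq) (s≤s z≤n)) (anti (ℤ.<⇒≤ k<0))) ]′
           (width-positive anti N k<w)
...   | no k≮w = sym (ℕ.n≤0⇒n≡0 (subst (f k ℕ.≤_) (width-zero anti N fN) (anti (ℤ.≮⇒≥ k≮w))))

profile⇒partition : ∀ {f} → Profile f → ∃ λ μ → IsPartition μ × (∀ k → rim μ k ≡ f k)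
profile⇒partition {f} pr = build N m f ,
  (build-positive m antitone slope fN , Linked.tail (build-linked m antitone slope fN fN)) ,
  rim-build m antitone slope (proj₂ left) fN
  where
  open Profile pr
  m N : ℕ
  m = proj₁ left
  N = proj₁ right
  fN = proj₂ right

-- Lists

∧⁺ : ∀ {x y} → T x → T y → T (x ∧ y)
∧⁺ tx ty = Equivalence.from T-∧ (tx , ty)

∧⁻ : ∀ {x y} → T (x ∧ y) → T x × T y
∧⁻ = Equivalence.to T-∧

not⁺ : ∀ {x} → ¬ T x → T (not x)
not⁺ {true} ¬t = ¬t tt
not⁺ {false} _ = tt

not⁻ : ∀ {x} → T (not x) → ¬ T x
not⁻ {false} _ ()

module _ {A : Set} where

  all⁺ : (p : A → Bool) (xs : List A) → (∀ {x} → x ∈ xs → T (p x)) → T (all p xs)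
  all⁺ p xs f = All.all⁻ p (All.tabulate f)

  all⁻ : (p : A → Bool) (xs : List A) → T (all p xs) → ∀ {x} → x ∈ xs → T (p x)
  all⁻ p xs t = All.lookup (All.all⁺ p xs t)

  any⁺ : (p : A → Bool) {xs : List A} {x : A} → x ∈ xs → T (p x) → T (any p xs)
  any⁺ p x∈xs px = Any.any⁺ p (lose x∈xs px)

  any⁻ : (p : A → Bool) (xs : List A) → T (any p xs) → ∃ λ x → x ∈ xs × T (p x)
  any⁻ p xs t = find (Any.any⁻ p xs t)

  unique-⊆⇒length≤ : {xs ys : List A} → Unique xs → (∀ {x} → x ∈ xs → x ∈ ys) → length xs ℕ.≤ length ys
  unique-⊆⇒length≤ {[]} _ _ = z≤n
  unique-⊆⇒length≤ {x ∷ xs} (x∉xs ∷ u) sub with ∈-∃++ (sub (here refl))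
  ... | as , bs , refl = subst (suc (length xs) ℕ.≤_) (sym (length-++-sucʳ as x bs))
    (s≤s (unique-⊆⇒length≤ u λ {y} y∈xs →
      [ ∈-++⁺ˡ , (λ { (here refl) → contradiction refl (All.lookup x∉xs y∈xs) ; (there y∈bs) → ∈-++⁺ʳ as y∈bs }) ]′
        (∈-++⁻ as (sub (there y∈xs)))))

  unique-length : {xs ys : List A} → Unique xs → Unique ys → (∀ {x} → x ∈ xs → x ∈ ys) →
                  (∀ {x} → x ∈ ys → x ∈ xs) → length xs ≡ length ys
  unique-length ux uy xy yx = ℕ.≤-antisym (unique-⊆⇒length≤ ux xy) (unique-⊆⇒length≤ uy yx)

  unique-map : {B : Set} (f : A → B) {xs : List A} → (∀ {x y} → x ∈ xs → y ∈ xs → f x ≡ f y → x ≡ y) →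
               Unique xs → Unique (map f xs)
  unique-map f inj [] = []
  unique-map f {x ∷ xs} inj (x∉xs ∷ u) =
    All.tabulate (λ v∈ fx≡v → case ∈-map⁻ f v∈ of λ
      { (y , y∈xs , refl) → All.lookup x∉xs y∈xs (inj (here refl) (there y∈xs) fx≡v) })
    ∷ unique-map f (λ x∈ y∈ → inj (there x∈) (there y∈)) u

-- Cells of skew shapes

==ᶜ⁺ : ∀ x → T (x ==ᶜ x)
==ᶜ⁺ (r , c) = ∧⁺ (ℕ.≡⇒≡ᵇ r r refl) (ℕ.≡⇒≡ᵇ c c refl)

==ᶜ⁻ : ∀ {x y} → T (x ==ᶜ y) → x ≡ y
==ᶜ⁻ {r , c} {r' , c'} t = let e , e' = ∧⁻ {r ≡ᵇ r'} t in cong₂ _,_ (ℕ.≡ᵇ⇒≡ r r' e) (ℕ.≡ᵇ⇒≡ c c' e')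

∈ᶜ⁺ : ∀ {x xs} → x ∈ xs → T (x ∈ᶜ xs)
∈ᶜ⁺ {x} x∈xs = any⁺ (x ==ᶜ_) x∈xs (==ᶜ⁺ x)

∈ᶜ⁻ : ∀ {x} xs → T (x ∈ᶜ xs) → x ∈ xs
∈ᶜ⁻ {x} xs t = let y , y∈xs , e = any⁻ (x ==ᶜ_) xs t in subst (_∈ xs) (sym (==ᶜ⁻ e)) y∈xs

data Adjacent : Cell → Cell → Set where
  east : ∀ {r c} → Adjacent (r , suc c) (r , c)
  west : ∀ {r c} → Adjacent (r , c) (r , suc c)
  south : ∀ {r c} → Adjacent (suc r , c) (r , c)
  north : ∀ {r c} → Adjacent (r , c) (suc r , c)

adjacent⁺ : ∀ {x y} → Adjacent x y → T (adjacent x y)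
adjacent⁺ {r , suc c} east = Equivalence.from T-∨ (inj₁ (∧⁺ (ℕ.≡⇒≡ᵇ r r refl) (Equivalence.from T-∨ (inj₁ (ℕ.≡⇒≡ᵇ c c refl)))))
adjacent⁺ {r , c} west = Equivalence.from T-∨ (inj₁ (∧⁺ (ℕ.≡⇒≡ᵇ r r refl) (Equivalence.from (T-∨ {c ≡ᵇ suc (suc c)}) (inj₂ (ℕ.≡⇒≡ᵇ c c refl)))))
adjacent⁺ {suc r , c} south = Equivalence.from (T-∨ {(suc r ≡ᵇ r) ∧ _}) (inj₂ (∧⁺ (ℕ.≡⇒≡ᵇ c c refl) (Equivalence.from T-∨ (inj₁ (ℕ.≡⇒≡ᵇ r r refl)))))
adjacent⁺ {r , c} north = Equivalence.from (T-∨ {(r ≡ᵇ suc r) ∧ _}) (inj₂ (∧⁺ (ℕ.≡⇒≡ᵇ c c refl) (Equivalence.from (T-∨ {r ≡ᵇ suc (suc r)}) (inj₂ (ℕ.≡⇒≡ᵇ r r refl)))))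

adjacent⁻ : ∀ {x y} → T (adjacent x y) → Adjacent x y
adjacent⁻ {r , c} {r' , c'} t with Equivalence.to (T-∨ {(r ≡ᵇ r') ∧ _}) t
... | inj₁ h with ∧⁻ {r ≡ᵇ r'} h
...   | e , e' with ℕ.≡ᵇ⇒≡ r r' e | Equivalence.to (T-∨ {c ≡ᵇ suc c'}) e'
...     | refl | inj₁ e″ with refl ← ℕ.≡ᵇ⇒≡ c (suc c') e″ = east
...     | refl | inj₂ e″ with refl ← ℕ.≡ᵇ⇒≡ c' (suc c) e″ = west
adjacent⁻ {r , c} {r' , c'} t | inj₂ h with ∧⁻ {c ≡ᵇ c'} h
...   | e , e' with ℕ.≡ᵇ⇒≡ c c' e | Equivalence.to (T-∨ {r ≡ᵇ suc r'}) e'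
...     | refl | inj₁ e″ with refl ← ℕ.≡ᵇ⇒≡ r (suc r') e″ = south
...     | refl | inj₂ e″ with refl ← ℕ.≡ᵇ⇒≡ r' (suc r) e″ = north

module _ {cells S : List Cell} where

  grow⁺ : ∀ {x s} → x ∈ cells → s ∈ S → x ≡ s ⊎ Adjacent x s → x ∈ grow cells S
  grow⁺ {x} {s} x∈ s∈ h = ∈-filter⁺ _ x∈ (any⁺ _ s∈ (Equivalence.from (T-∨ {x ==ᶜ s})
    ([ (λ { refl → inj₁ (==ᶜ⁺ x) }) , inj₂ ∘ adjacent⁺ ]′ h)))

  grow⁻ : ∀ {x} → x ∈ grow cells S → x ∈ cells × ∃ λ s → s ∈ S × (x ≡ s ⊎ Adjacent x s)
  grow⁻ {x} x∈ with ∈-filter⁻ _ {xs = cells} x∈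
  ... | x∈cells , t with any⁻ (λ s → (x ==ᶜ s) ∨ adjacent x s) S t
  ...   | s , s∈S , h = x∈cells , s , s∈S , [ inj₁ ∘ ==ᶜ⁻ , inj₂ ∘ adjacent⁻ ]′ (Equivalence.to (T-∨ {x ==ᶜ s}) h)

part-positive⇒row : ∀ μ {r c} → c ℕ.< part μ r → r ℕ.< length μ
part-positive⇒row μ {r} c<p = ℕ.≰⇒> λ l≤r → ℕ.<⇒≱ c<p (subst (ℕ._≤ _) (sym (part-end μ l≤r)) z≤n)

row⇒part-positive : ∀ {λ'} → All (1 ℕ.≤_) λ' → ∀ {r} → r ℕ.< length λ' → 1 ℕ.≤ part λ' r
row⇒part-positive (p ∷ ps) {zero} _ = p
row⇒part-positive (p ∷ ps) {suc r} (s≤s r<l) = row⇒part-positive ps r<l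

contained⁺ : ∀ {λ' μ} → All (1 ℕ.≤_) λ' → (∀ r → part λ' r ℕ.≤ part μ r) → T (contained λ' μ)
contained⁺ {λ'} {μ} pos le = ∧⁺
  (ℕ.≤⇒≤ᵇ (≤-by-< λ r<l → part-positive⇒row μ (ℕ.<-≤-trans (row⇒part-positive pos r<l) (le _))))
  (all⁺ _ (upTo (length λ')) λ {r} _ → ℕ.≤⇒≤ᵇ (le r))

contained⁻ : ∀ {λ' μ} → T (contained λ' μ) → ∀ r → part λ' r ℕ.≤ part μ r
contained⁻ {λ'} {μ} t r with r ℕ.<? length λ'
... | yes r<l = ℕ.≤ᵇ⇒≤ _ _ (all⁻ _ (upTo (length λ')) (proj₂ (∧⁻ {length λ' ≤ᵇ length μ} t)) (∈-upTo⁺ r<l))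
... | no r≮l = subst (ℕ._≤ part μ r) (sym (part-end λ' (ℕ.≮⇒≥ r≮l))) z≤n

rowCells : Partition → Partition → ℕ → List Cell
rowCells λ' μ r = map (r ,_) (applyUpTo (part λ' r ℕ.+_) (part μ r ∸ part λ' r))

module _ {λ' μ : Partition} where

  ∈-rowCells⁺ : ∀ {r c} → part λ' r ℕ.≤ c → c ℕ.< part μ r → (r , c) ∈ rowCells λ' μ r
  ∈-rowCells⁺ {r} {c} p≤c c<q = ∈-map⁺ (r ,_) (subst (_∈ applyUpTo (part λ' r ℕ.+_) (part μ r ∸ part λ' r))
    (ℕ.m+[n∸m]≡n p≤c) (∈-applyUpTo⁺ (part λ' r ℕ.+_) (ℕ.∸-monoˡ-< c<q p≤c)))

  ∈-rowCells⁻ : ∀ {r x} → x ∈ rowCells λ' μ r →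
                proj₁ x ≡ r × part λ' r ℕ.≤ proj₂ x × proj₂ x ℕ.< part μ r
  ∈-rowCells⁻ {r} x∈ with ∈-map⁻ (r ,_) x∈
  ... | c , c∈ , refl with ∈-applyUpTo⁻ (part λ' r ℕ.+_) c∈
  ...   | t , t<q∸p , refl = refl , ℕ.m≤m+n (part λ' r) t ,
          subst (part λ' r ℕ.+ t ℕ.<_)
            (ℕ.m+[n∸m]≡n {part λ' r} (ℕ.<⇒≤ (ℕ.≰⇒> λ q≤p → contradiction (subst (t ℕ.<_) (ℕ.m≤n⇒m∸n≡0 q≤p) t<q∸p) λ ())))
            (ℕ.+-monoʳ-< (part λ' r) t<q∸p)

  ∈-skewCells⁺ : ∀ {r c} → part λ' r ℕ.≤ c → c ℕ.< part μ r → (r , c) ∈ skewCells λ' μ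
  ∈-skewCells⁺ p≤c c<q = ∈-concatMap⁺ (rowCells λ' μ)
    (lose (∈-upTo⁺ (part-positive⇒row μ c<q)) (∈-rowCells⁺ p≤c c<q))

  ∈-skewCells⁻ : ∀ {r c} → (r , c) ∈ skewCells λ' μ → part λ' r ℕ.≤ c × c ℕ.< part μ r
  ∈-skewCells⁻ {r} {c} x∈ with find (∈-concatMap⁻ (rowCells λ' μ) {xs = upTo (length μ)} x∈)
  ... | r' , _ , x∈row with ∈-rowCells⁻ x∈row
  ...   | refl , bounds = bounds

  skewCells-unique : Unique (skewCells λ' μ)
  skewCells-unique = Unique.concat⁺
    (All.map⁺ (All.tabulate λ {r} _ → Unique.map⁺ (cong proj₂)
      (Unique.applyUpTo⁺₁ (part λ' r ℕ.+_) (part μ r ∸ part λ' r)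
        (λ i<j _ e → ℕ.<⇒≢ i<j (ℕ.+-cancelˡ-≡ (part λ' r) _ _ e)))))
    (AllPairs.map⁺ (AllPairs.map disjoint (Unique.upTo⁺ (length μ))))
    where
    disjoint : ∀ {r r'} → r ≢ r' → Disjoint (rowCells λ' μ r) (rowCells λ' μ r')
    disjoint r≢r' (x∈ , x∈') = r≢r' (trans (sym (proj₁ (∈-rowCells⁻ x∈))) (proj₁ (∈-rowCells⁻ x∈')))

-- The lower row lengths are added on the left, so that no truncated subtraction of sums occurs; h
-- shifts the row index in the induction.
length-concatMap-rows : ∀ {A : Set} (g : ℕ → List A) (lo hi h : ℕ → ℕ) L →
  (∀ r → length (g (h r)) ℕ.+ lo r ≡ hi r) →
  length (concatMap g (applyUpTo h L)) ℕ.+ size (applyUpTo lo L) ≡ size (applyUpTo hi L)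
length-concatMap-rows g lo hi h zero e = refl
length-concatMap-rows g lo hi h (suc L) e = begin
  length (g (h 0) ++ rest) ℕ.+ (lo 0 ℕ.+ los) ≡⟨ cong (ℕ._+ (lo 0 ℕ.+ los)) (length-++ (g (h 0))) ⟩
  length (g (h 0)) ℕ.+ length rest ℕ.+ (lo 0 ℕ.+ los) ≡⟨ interchange (length (g (h 0))) (length rest) (lo 0) los ⟩
  length (g (h 0)) ℕ.+ lo 0 ℕ.+ (length rest ℕ.+ los)
    ≡⟨ cong₂ ℕ._+_ (e 0) (length-concatMap-rows g (lo ∘ suc) (hi ∘ suc) (h ∘ suc) L (e ∘ suc)) ⟩
  hi 0 ℕ.+ size (applyUpTo (hi ∘ suc) L) ∎
  where
  open ≡-Reasoning
  rest = concatMap g (applyUpTo (h ∘ suc) L)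
  los = size (applyUpTo (lo ∘ suc) L)

size-parts : ∀ λ' L → length λ' ℕ.≤ L → size (applyUpTo (part λ') L) ≡ size λ'
size-parts [] zero _ = refl
size-parts [] (suc L) _ = size-parts [] L z≤n
size-parts (p ∷ ps) (suc L) (s≤s l≤L) = cong (p ℕ.+_) (size-parts ps L l≤L)

length-skewCells : ∀ {λ' μ} → All (1 ℕ.≤_) λ' → (∀ r → part λ' r ℕ.≤ part μ r) →
                   length (skewCells λ' μ) ℕ.+ size λ' ≡ size μ
length-skewCells {λ'} {μ} pos le = begin
  length (skewCells λ' μ) ℕ.+ size λ' ≡⟨ cong (length (skewCells λ' μ) ℕ.+_) (sym (size-parts λ' (length μ) lλ≤lμ)) ⟩
  length (skewCells λ' μ) ℕ.+ size (applyUpTo (part λ') (length μ))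
    ≡⟨ length-concatMap-rows (rowCells λ' μ) (part λ') (part μ) id (length μ) row ⟩
  size (applyUpTo (part μ) (length μ)) ≡⟨ size-parts μ (length μ) ℕ.≤-refl ⟩
  size μ ∎
  where
  open ≡-Reasoning
  lλ≤lμ = ℕ.≤ᵇ⇒≤ _ _ (proj₁ (∧⁻ {length λ' ≤ᵇ length μ} (contained⁺ {λ'} {μ} pos le)))
  row : ∀ r → length (rowCells λ' μ r) ℕ.+ part λ' r ≡ part μ r
  row r = trans (cong (ℕ._+ part λ' r) (trans (length-map (r ,_) (applyUpTo (part λ' r ℕ.+_) (part μ r ∸ part λ' r)))
                (length-applyUpTo (part λ' r ℕ.+_) (part μ r ∸ part λ' r))))
              (ℕ.m∸n+n≡m (le r))

-- Boxes located by diagonal and row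

≤⇒+ : ∀ {k l} → k ℤ.≤ l → ∃ λ t → l ≡ k ℤ.+ + t
≤⇒+ {k} {l} k≤l = ℤ.∣ l ℤ.- k ∣ , sym (trans (cong (ℤ._+_ k) (ℤ.0≤i⇒+∣i∣≡i (ℤ.i≤j⇒0≤j-i k≤l))) (cancel k l))
  where
  cancel : ∀ k l → k ℤ.+ (l ℤ.- k) ≡ l
  cancel = solve-∀

+-cancelˡ-≤ : ∀ k {s t} → k ℤ.+ + s ℤ.≤ k ℤ.+ + t → s ℕ.≤ t
+-cancelˡ-≤ k h = ℕ.≮⇒≥ λ t<s → ℤ.<⇒≱ (ℤ.+-monoʳ-< k (ℤ.+<+ t<s)) h

n-m+m : ∀ k m → k ℤ.- m ℤ.+ m ≡ k
n-m+m = solve-∀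

n+m-m : ∀ k m → k ℤ.+ m ℤ.- m ≡ k
n+m-m = solve-∀

diagonal-col : ∀ x → diagonal x ℤ.+ + proj₁ x ≡ + proj₂ x
diagonal-col (r , c) = n-m+m (+ c) (+ r)

col⇒diagonal : ∀ {k r c} → k ℤ.+ + r ≡ + c → diagonal (r , c) ≡ k
col⇒diagonal {k} {r} e = trans (cong (ℤ._- + r) (sym e)) (n+m-m k (+ r))

cell-≡ : ∀ {x y} → proj₁ x ≡ proj₁ y → diagonal x ≡ diagonal y → x ≡ y
cell-≡ {x@(r , c)} {y@(_ , c')} refl e = cong (r ,_) (ℤ.+-injective
  (trans (sym (diagonal-col x)) (trans (cong (ℤ._+ + r) e) (diagonal-col y))))

sameRow : ∀ {x y} → proj₁ x ≡ proj₁ y → diagonal y ≡ ℤ.suc (diagonal x) → Adjacent x y × Adjacent y x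
sameRow {x@(r , c)} {y@(_ , c')} refl e with ℤ.+-injective (trans (sym (diagonal-col y)) (trans (cong (ℤ._+ + r) e)
        (trans (ℤ.+-assoc (+ 1) (diagonal x) (+ r)) (cong (ℤ._+_ (+ 1)) (diagonal-col x)))))
... | refl = west , east

sameColumn : ∀ {x y} → proj₁ x ≡ suc (proj₁ y) → diagonal y ≡ ℤ.suc (diagonal x) → Adjacent x y × Adjacent y x
sameColumn {x@(_ , c)} {y@(r , c')} refl e with ℤ.+-injective (trans (sym (diagonal-col x))
        (trans (sym (suc-+-suc (diagonal x) r)) (trans (cong (ℤ._+ + r) (sym e)) (diagonal-col y))))
... | refl = south , north

interval : ℤ → ℕ → List ℤ
interval k t = applyUpTo (λ s → k ℤ.+ + s) (suc t)

module _ {k : ℤ} {t : ℕ} where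

  ∈-interval⁺ : ∀ {l} → k ℤ.≤ l → l ℤ.≤ k ℤ.+ + t → l ∈ interval k t
  ∈-interval⁺ k≤l l≤k+t with ≤⇒+ k≤l
  ... | s , refl = ∈-applyUpTo⁺ (λ s → k ℤ.+ + s) (s≤s (+-cancelˡ-≤ k l≤k+t))

  ∈-interval⁻ : ∀ {l} → l ∈ interval k t → k ℤ.≤ l × l ℤ.≤ k ℤ.+ + t
  ∈-interval⁻ l∈ with ∈-applyUpTo⁻ (λ s → k ℤ.+ + s) {n = suc t} l∈
  ... | s , s≤s s≤t , refl = ℤ.i≤i+j k (+ s) , ℤ.+-monoʳ-≤ k (ℤ.+≤+ s≤t)

  interval-unique : Unique (interval k t)
  interval-unique = Unique.applyUpTo⁺₁ (λ s → k ℤ.+ + s) (suc t) λ i<j _ e →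
    ℤ.<⇒≢ (ℤ.+-monoʳ-< k (ℤ.+<+ i<j)) e

-- The head of a shape

_⊵_ : Cell → Cell → Set
(r , c) ⊵ (r' , c') = r ℕ.< r' ⊎ (r ≡ r' × c' ℕ.≤ c)

⊵-refl : ∀ {x} → x ⊵ x
⊵-refl = inj₂ (refl , ℕ.≤-refl)

⊵-trans : ∀ {x y z} → x ⊵ y → y ⊵ z → x ⊵ z
⊵-trans (inj₁ a) (inj₁ b) = inj₁ (ℕ.<-trans a b)
⊵-trans (inj₁ a) (inj₂ (refl , _)) = inj₁ a
⊵-trans (inj₂ (refl , _)) (inj₁ b) = inj₁ b
⊵-trans (inj₂ (refl , a)) (inj₂ (refl , b)) = inj₂ (refl , ℕ.≤-trans b a)

-- `topRight` folds with a local function that has no name here. Only this property of it matters,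
-- and unification supplies the function.
Chooses : (Cell → Cell → Cell) → Set
Chooses f = ∀ x y → (f x y ≡ x × x ⊵ y) ⊎ (f x y ≡ y × y ⊵ x)

foldl-best : ∀ f → Chooses f → ∀ x ys → foldl f x ys ∈ x ∷ ys × (∀ {y} → y ∈ x ∷ ys → foldl f x ys ⊵ y)
foldl-best f ch x [] = here refl , λ { (here refl) → ⊵-refl }
foldl-best f ch x (y ∷ ys) with f x y | ch x y
... | .x | inj₁ (refl , x⊵y) with foldl-best f ch x ys
...   | ∈r , best = (case ∈r of λ { (here e) → here e ; (there p) → there (there p) }) , λ
        { (here refl) → best (here refl)
        ; (there (here refl)) → ⊵-trans (best (here refl)) x⊵y
        ; (there (there p)) → best (there p) }
foldl-best f ch x (y ∷ ys) | .y | inj₂ (refl , y⊵x) with foldl-best f ch y ys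
...   | ∈r , best = there ∈r , λ
        { (here refl) → ⊵-trans (best (here refl)) y⊵x
        ; (there p) → best p }

topRight-best : ∀ {cells h} → h ∈ cells → topRight cells ∈ cells × (∀ {y} → y ∈ cells → topRight cells ⊵ y)
topRight-best {x ∷ xs} _ = foldl-best _ (λ { (r , c) (r' , c') → chooses r c r' c' }) x xs
  where
  chooses : ∀ r c r' c' → let z = if (r' <ᵇ r) ∨ ((r' ≡ᵇ r) ∧ (c <ᵇ c')) then (r' , c') else (r , c) in
            (z ≡ (r , c) × (r , c) ⊵ (r' , c')) ⊎ (z ≡ (r' , c') × (r' , c') ⊵ (r , c))
  chooses r c r' c' with (r' <ᵇ r) ∨ ((r' ≡ᵇ r) ∧ (c <ᵇ c')) in eq
  ... | true = inj₂ (refl , [ inj₁ ∘ ℕ.<ᵇ⇒< r' r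
      , (λ t → inj₂ (ℕ.≡ᵇ⇒≡ r' r (proj₁ (∧⁻ {r' ≡ᵇ r} t)) , ℕ.<⇒≤ (ℕ.<ᵇ⇒< c c' (proj₂ (∧⁻ {r' ≡ᵇ r} t))))) ]′
      (Equivalence.to (T-∨ {r' <ᵇ r}) (Equivalence.from T-≡ eq)))
  ... | false with ℕ.<-cmp r r'
  ...   | tri< r<r' _ _ = inj₁ (refl , inj₁ r<r')
  ...   | tri> _ _ r'<r = ⊥-elim (subst T eq (Equivalence.from T-∨ (inj₁ (ℕ.<⇒<ᵇ r'<r))))
  ...   | tri≈ _ refl _ = inj₁ (refl , inj₂ (refl , ℕ.≮⇒≥ λ c<c' →
            subst T eq (Equivalence.from (T-∨ {r <ᵇ r}) (inj₂ (∧⁺ (ℕ.≡⇒≡ᵇ r r refl) (ℕ.<⇒<ᵇ c<c'))))))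

-- Skew shapes read off from two rims

module Skew {λ' μ : Partition} (λ-partition : IsPartition λ') (μ-partition : IsPartition μ) where

  private
    dλ = proj₂ λ-partition
    dμ = proj₂ μ-partition

  cells : List Cell
  cells = skewCells λ' μ

  cell⇒rim : ∀ {x} → x ∈ cells → rim λ' (diagonal x) ℕ.≤ proj₁ x × proj₁ x ℕ.< rim μ (diagonal x)
  cell⇒rim {x@(r , c)} x∈ with ∈-skewCells⁻ {λ'} {μ} x∈
  ... | p≤c , c<q =
    ℕ.≮⇒≥ (λ r<rim → ℤ.<⇒≱ (box⇒ dλ r<rim) (subst (+ part λ' r ℤ.≤_) (sym (diagonal-col x)) (ℤ.+≤+ p≤c))) ,
    box⇐ dμ (subst (ℤ._< + part μ r) (sym (diagonal-col x)) (ℤ.+<+ c<q))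

  rim⇒cell : ∀ {k r} → rim λ' k ℕ.≤ r → r ℕ.< rim μ k → ∃ λ x → x ∈ cells × proj₁ x ≡ r × diagonal x ≡ k
  rim⇒cell {k} {r} rim≤r r<rim = (r , c) , ∈-skewCells⁺ {λ'} {μ}
      (ℤ.drop‿+≤+ (subst (+ part λ' r ℤ.≤_) (sym c≡) p≤k+r))
      (ℤ.drop‿+<+ (subst (ℤ._< + part μ r) (sym c≡) (box⇒ dμ r<rim))) , refl , col⇒diagonal {k} (sym c≡)
    where
    c : ℕ
    c = ℤ.∣ k ℤ.+ + r ∣
    p≤k+r : + part λ' r ℤ.≤ k ℤ.+ + r
    p≤k+r = ℤ.≮⇒≥ λ b → ℕ.<⇒≱ (box⇐ dλ b) rim≤r
    c≡ : + c ≡ k ℤ.+ + r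
    c≡ = ℤ.0≤i⇒+∣i∣≡i (ℤ.≤-trans (ℤ.+≤+ z≤n) p≤k+r)

  contained⇒rim≤ : (∀ r → part λ' r ℕ.≤ part μ r) → ∀ k → rim λ' k ℕ.≤ rim μ k
  contained⇒rim≤ le k = ≤-by-< λ r<rim → box⇐ dμ (ℤ.<-≤-trans (box⇒ dλ r<rim) (ℤ.+≤+ (le _)))

  -- The rim form of having no 2×2 square: each diagonal carries at most one box, so that a box is
  -- determined by its diagonal.
  module Thin (thin : ∀ k → rim μ k ℕ.≤ suc (rim λ' k)) where

    row : ∀ {x} → x ∈ cells → proj₁ x ≡ rim λ' (diagonal x)
    row {x} x∈ = ℕ.≤-antisym (ℕ.s≤s⁻¹ (ℕ.≤-trans (proj₂ (cell⇒rim x∈)) (thin (diagonal x)))) (proj₁ (cell⇒rim x∈))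

    diagonal-injective : ∀ {x y} → x ∈ cells → y ∈ cells → diagonal x ≡ diagonal y → x ≡ y
    diagonal-injective x∈ y∈ e = cell-≡ (trans (row x∈) (trans (cong (rim λ') e) (sym (row y∈)))) e

    -- Between consecutive diagonals the rim falls by 0 or 1; the first makes the boxes neighbours
    -- in a row, the second in a column.
    neighbours : ∀ {x y} → x ∈ cells → y ∈ cells → diagonal y ≡ ℤ.suc (diagonal x) → Adjacent x y × Adjacent y x
    neighbours {x} {y} x∈ y∈ e with proj₁ x ℕ.≟ proj₁ y
    ... | yes r≡r' = sameRow r≡r' e
    ... | no r≢r' = sameColumn (ℕ.≤-antisym
        (subst₂ (λ a b → a ℕ.≤ suc b) (sym (row x∈)) (sym r'≡) (rim-slope dλ (diagonal x)))
        (ℕ.≤∧≢⇒< (subst₂ ℕ._≤_ (sym r'≡) (sym (row x∈)) (rim-antitone dλ (ℤ.i≤suc[i] _))) (r≢r' ∘ sym))) e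
      where
      r'≡ : proj₁ y ≡ rim λ' (ℤ.suc (diagonal x))
      r'≡ = trans (row y∈) (cong (rim λ') e)

    length-cells : ∀ k t → (∀ {x} → x ∈ cells → k ℤ.≤ diagonal x × diagonal x ℤ.≤ k ℤ.+ + t) →
                   (∀ {l} → k ℤ.≤ l → l ℤ.≤ k ℤ.+ + t → ∃ λ x → x ∈ cells × diagonal x ≡ l) →
                   length cells ≡ suc t
    length-cells k t bounds surj = begin
      length cells ≡⟨ sym (length-map diagonal cells) ⟩
      length (map diagonal cells) ≡⟨ unique-length
        (unique-map diagonal diagonal-injective (skewCells-unique {λ'} {μ})) (interval-unique {k} {t})
        into
        (λ l∈ → case uncurry surj (∈-interval⁻ {k} {t} l∈) of λ { (x , x∈ , e) → subst (_∈ map diagonal cells) e (∈-map⁺ diagonal x∈) }) ⟩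
      length (interval k t) ≡⟨ length-applyUpTo (λ s → k ℤ.+ + s) (suc t) ⟩
      suc t ∎
      where
      open ≡-Reasoning
      into : ∀ {l} → l ∈ map diagonal cells → l ∈ interval k t
      into l∈ with ∈-map⁻ diagonal l∈
      ... | x , x∈ , refl = uncurry (∈-interval⁺ {k} {t}) (bounds x∈)

connected⁺ : ∀ cells → (∀ {b x} → b ∈ cells → x ∈ cells → x ∈ iterate (length cells) (grow cells) [ b ]) →
             T (connected cells)
connected⁺ [] _ = tt
connected⁺ cells@(b ∷ _) reach = all⁺ _ cells λ x∈ → ∈ᶜ⁺ (reach (here refl) x∈)

connected⁻ : ∀ {cells x} → T (connected cells) → x ∈ cells →
             ∃ λ b → b ∈ cells × (∀ {y} → y ∈ cells → y ∈ iterate (length cells) (grow cells) [ b ])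
connected⁻ {cells@(b ∷ _)} t _ = b , here refl , λ y∈ → ∈ᶜ⁻ _ (all⁻ _ cells t y∈)

base∈iterate : ∀ {cells b} → b ∈ cells → ∀ k → b ∈ iterate k (grow cells) [ b ]
base∈iterate b∈ zero = here refl
base∈iterate {cells} b∈ (suc k) = grow⁺ b∈ (base∈iterate {cells} b∈ k) (inj₁ refl)

-- From a raised strip of the rim to a ribbon

module Strip (m : ℕ) where

  -- With n = m + 1 this is i - n + 1, the first diagonal of a ribbon with head on i.
  tail : ℤ → ℤ
  tail i = i ℤ.- + m

  tail+m : ∀ i → tail i ℤ.+ + m ≡ i
  tail+m i = n-m+m i (+ m)

  tail≤ : ∀ i → tail i ℤ.≤ i
  tail≤ i = subst (tail i ℤ.≤_) (tail+m i) (ℤ.i≤i+j (tail i) (+ m))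

  -- μ arises from λ by adding an (m+1)-ribbon with head on diagonal i.
  record Adds (i : ℤ) (λ' μ : Partition) : Set where
    field
      inside : ∀ {k} → tail i ℤ.≤ k → k ℤ.≤ i → rim μ k ≡ suc (rim λ' k)
      before : ∀ {k} → k ℤ.< tail i → rim μ k ≡ rim λ' k
      after : ∀ {k} → i ℤ.< k → rim μ k ≡ rim λ' k

  -- The spin of a ribbon with head on i added to λ, by `spin≡`.
  rimWidth : ℤ → Partition → ℕ
  rimWidth i λ' = rim λ' (tail i) ∸ rim λ' i

  module _ {λ' μ : Partition} (λ-partition : IsPartition λ') (μ-partition : IsPartition μ) where

    open Skew λ-partition μ-partition
    private
      dλ = proj₂ λ-partition
      dμ = proj₂ μ-partition

    module Added {i : ℤ} (A : Adds i λ' μ) where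
      open Adds A

      rim-cases : ∀ k → (tail i ℤ.≤ k × k ℤ.≤ i) ⊎ rim μ k ≡ rim λ' k
      rim-cases k with tail i ℤ.≤? k | k ℤ.≤? i
      ... | no t≰k | _ = inj₂ (before (ℤ.≰⇒> t≰k))
      ... | yes _ | no k≰i = inj₂ (after (ℤ.≰⇒> k≰i))
      ... | yes t≤k | yes k≤i = inj₁ (t≤k , k≤i)

      rim-grows : ∀ k → rim λ' k ℕ.≤ rim μ k
      rim-grows k with rim-cases k
      ... | inj₁ (t≤k , k≤i) = ℕ.<⇒≤ (ℕ.≤-reflexive (sym (inside t≤k k≤i)))
      ... | inj₂ e = ℕ.≤-reflexive (sym e)

      thin : ∀ k → rim μ k ℕ.≤ suc (rim λ' k)
      thin k with rim-cases k
      ... | inj₁ (t≤k , k≤i) = ℕ.≤-reflexive (inside t≤k k≤i)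
      ... | inj₂ e = ℕ.m≤n⇒m≤1+n (ℕ.≤-reflexive e)

      open Thin thin

      part≤ : ∀ r → part λ' r ℕ.≤ part μ r
      part≤ = rim⊆⇒part≤ dλ dμ rim-grows

      bounds : ∀ {x} → x ∈ cells → tail i ℤ.≤ diagonal x × diagonal x ℤ.≤ i
      bounds {x} x∈ with rim-cases (diagonal x)
      ... | inj₁ b = b
      ... | inj₂ e = contradiction (ℕ.≤-<-trans (proj₁ (cell⇒rim x∈)) (proj₂ (cell⇒rim x∈))) (ℕ.<-irrefl (sym e))

      cellOn : ∀ {k} → tail i ℤ.≤ k → k ℤ.≤ i → ∃ λ x → x ∈ cells × proj₁ x ≡ rim λ' k × diagonal x ≡ k
      cellOn t≤k k≤i = rim⇒cell ℕ.≤-refl (ℕ.≤-reflexive (sym (inside t≤k k≤i)))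

      length-ribbon : length cells ≡ suc m
      length-ribbon = length-cells (tail i) m
        (λ x∈ → proj₁ (bounds x∈) , ℤ.≤-trans (proj₂ (bounds x∈)) (ℤ.≤-reflexive (sym (tail+m i))))
        (λ t≤k k≤ → case cellOn t≤k (subst (_ ℤ.≤_) (tail+m i) k≤) of λ { (x , x∈ , _ , e) → x , x∈ , e })

      size-ribbon : size μ ≡ size λ' ℕ.+ suc m
      size-ribbon = trans (sym (length-skewCells {λ'} {μ} (proj₁ λ-partition) part≤))
        (trans (cong (ℕ._+ size λ') length-ribbon) (ℕ.+-comm (suc m) (size λ')))

      -- Induction on the distance t of the two diagonals: every diagonal in between carries a box,
      -- and boxes on consecutive diagonals are adjacent. k counts the rounds of growth available.
      reach-west : ∀ t k {b x} → t ℕ.≤ k → b ∈ cells → x ∈ cells → diagonal b ≡ diagonal x ℤ.+ + t →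
                   x ∈ iterate k (grow cells) [ b ]
      reach-west zero k {b} {x} _ b∈ x∈ e
        with refl ← diagonal-injective b∈ x∈ (trans e (ℤ.+-identityʳ (diagonal x))) = base∈iterate b∈ k
      reach-west (suc t) (suc k) {b} {x} (s≤s t≤k) b∈ x∈ e
        with cellOn (ℤ.i≤j⇒i≤1+j (proj₁ (bounds x∈)))
               (ℤ.≤-trans (ℤ.i≤i+j (ℤ.suc (diagonal x)) (+ t))
                 (ℤ.≤-trans (ℤ.≤-reflexive (trans (suc-+-suc (diagonal x) t) (sym e))) (proj₂ (bounds b∈))))
      ... | y , y∈ , _ , e' = grow⁺ x∈
        (reach-west t k t≤k b∈ y∈ (trans e (trans (sym (suc-+-suc (diagonal x) t)) (cong (ℤ._+ + t) (sym e')))))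
        (inj₂ (proj₁ (neighbours x∈ y∈ e')))

      reach-east : ∀ t k {b x} → t ℕ.≤ k → b ∈ cells → x ∈ cells → diagonal x ≡ diagonal b ℤ.+ + t →
                   x ∈ iterate k (grow cells) [ b ]
      reach-east zero k {b} {x} _ b∈ x∈ e
        with refl ← diagonal-injective b∈ x∈ (sym (trans e (ℤ.+-identityʳ (diagonal b)))) = base∈iterate b∈ k
      reach-east (suc t) (suc k) {b} {x} (s≤s t≤k) b∈ x∈ e
        with cellOn {diagonal b ℤ.+ + t}
               (ℤ.≤-trans (proj₁ (bounds b∈)) (ℤ.i≤i+j (diagonal b) (+ t)))
               (ℤ.≤-trans (ℤ.+-monoʳ-≤ (diagonal b) (ℤ.+≤+ (ℕ.n≤1+n t))) (subst (ℤ._≤ i) e (proj₂ (bounds x∈))))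
      ... | y , y∈ , _ , e' = grow⁺ x∈ (reach-east t k t≤k b∈ y∈ e')
        (inj₂ (proj₂ (neighbours y∈ x∈
          (trans e (trans (sym (suc-+-suc (diagonal b) t))
            (trans (ℤ.+-assoc (+ 1) (diagonal b) (+ t)) (cong ℤ.suc (sym e'))))))))

      steps≤length : ∀ {b x t} → b ∈ cells → x ∈ cells → diagonal b ≡ diagonal x ℤ.+ + t → t ℕ.≤ length cells
      steps≤length {b} {x} {t} b∈ x∈ e = subst (t ℕ.≤_) (sym length-ribbon) (ℕ.m≤n⇒m≤1+n
        (+-cancelˡ-≤ (tail i) (ℤ.≤-trans (ℤ.+-monoˡ-≤ (+ t) (proj₁ (bounds x∈)))
          (subst₂ ℤ._≤_ e (sym (tail+m i)) (proj₂ (bounds b∈))))))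

      ribbon-connected : T (connected cells)
      ribbon-connected = connected⁺ cells reach
        where
        reach : ∀ {b x} → b ∈ cells → x ∈ cells → x ∈ iterate (length cells) (grow cells) [ b ]
        reach {b} {x} b∈ x∈ with ℤ.≤-total (diagonal b) (diagonal x)
        ... | inj₁ b≤x with ≤⇒+ b≤x
        ...   | t , e = reach-east t _ (steps≤length x∈ b∈ e) b∈ x∈ e
        reach {b} {x} b∈ x∈ | inj₂ x≤b with ≤⇒+ x≤b
        ...   | t , e = reach-west t _ (steps≤length b∈ x∈ e) b∈ x∈ e

      no2x2 : ¬ T (has2x2 cells)
      no2x2 t with any⁻ _ cells t
      ... | (r , c) , x∈ , t' with ∈ᶜ⁻ {suc r , suc c} cells (proj₂ (∧⁻ {(suc r , c) ∈ᶜ cells} (proj₂ (∧⁻ {(r , suc c) ∈ᶜ cells} t'))))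
      ...   | y∈ = ℕ.1+n≢n (cong proj₁ (diagonal-injective y∈ x∈ (same-diagonal r c)))
        where
        same-diagonal : ∀ r c → diagonal (suc r , suc c) ≡ diagonal (r , c)
        same-diagonal r c = trans (ℤ.[+m]-[+n]≡m⊖n (suc c) (suc r))
          (trans (ℤ.[1+m]⊖[1+n]≡m⊖n c r) (sym (ℤ.[+m]-[+n]≡m⊖n c r)))

      isRibbon⁺ : T (isRibbon (suc m) λ' μ)
      isRibbon⁺ = ∧⁺ (contained⁺ {λ'} {μ} (proj₁ λ-partition) part≤)
        (∧⁺ (ℕ.≡⇒≡ᵇ (length cells) (suc m) length-ribbon) (∧⁺ ribbon-connected (not⁺ no2x2)))

      -- The rim is antitone, so the box on diagonal i lies in the topmost row. The top-right box is
      -- in that row and no farther left, hence on a diagonal at least i, and i is the last one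
      -- occupied.
      headDiag≡ : headDiag λ' μ ≡ i
      headDiag≡ with cellOn (tail≤ i) ℤ.≤-refl
      ... | h , h∈ , row-h , diag-h with topRight-best h∈
      ...   | top∈ , best with best h∈ | rim-antitone dλ (proj₂ (bounds top∈))
      ...     | inj₁ r<r' | rim≤ = contradiction
                  (subst₂ ℕ._≤_ (sym row-h) (sym (row top∈)) rim≤) (ℕ.<⇒≱ r<r')
      ...     | inj₂ (r≡r' , c'≤c) | _ = ℤ.≤-antisym (proj₂ (bounds top∈))
                  (subst (ℤ._≤ headDiag λ' μ) diag-h (subst (λ r → diagonal h ℤ.≤ + _ ℤ.- + r) (sym r≡r')
                    (ℤ.+-monoˡ-≤ (- (+ proj₁ h)) (ℤ.+≤+ c'≤c))))

      -- A discrete intermediate value theorem: the rim never falls by more than one at a step.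
      rows-between : ∀ t {k r} → rim λ' (k ℤ.+ + t) ℕ.≤ r → r ℕ.≤ rim λ' k →
                     ∃ λ l → k ℤ.≤ l × l ℤ.≤ k ℤ.+ + t × rim λ' l ≡ r
      rows-between zero {k} {r} lo hi = k , ℤ.≤-refl , ℤ.i≤i+j k (+ 0) ,
        ℕ.≤-antisym (subst (λ l → rim λ' l ℕ.≤ r) (ℤ.+-identityʳ k) lo) hi
      rows-between (suc t) {k} {r} lo hi with r ℕ.≟ rim λ' k
      ... | yes e = k , ℤ.≤-refl , ℤ.i≤i+j k (+ suc t) , sym e
      ... | no r≢ with rows-between t {ℤ.suc k} (subst (λ l → rim λ' l ℕ.≤ r) (sym (suc-+-suc k t)) lo)
                         (ℕ.s≤s⁻¹ (ℕ.≤-trans (ℕ.≤∧≢⇒< hi r≢) (rim-slope dλ k)))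
      ...   | l , k<l , l≤ , e = l , ℤ.≤-trans (ℤ.i≤suc[i] k) k<l , subst (l ℤ.≤_) (suc-+-suc k t) l≤ , e

      -- By `rows-between` the ribbon skips no row between those of its two ends, so it meets
      -- `rimWidth i λ'` + 1 rows.
      spin≡ : spin λ' μ ≡ rimWidth i λ'
      spin≡ = cong (_∸ 1) (begin
        length rows ≡⟨ unique-length (DecUnique.deduplicate-! ℕ._≟_ _)
          (Unique.applyUpTo⁺₁ (rim λ' i ℕ.+_) (suc (rimWidth i λ')) (λ i<j _ e → ℕ.<⇒≢ i<j (ℕ.+-cancelˡ-≡ (rim λ' i) _ _ e)))
          into onto ⟩
        length (applyUpTo (rim λ' i ℕ.+_) (suc (rimWidth i λ'))) ≡⟨ length-applyUpTo (rim λ' i ℕ.+_) (suc (rimWidth i λ')) ⟩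
        suc (rimWidth i λ') ∎)
        where
        open ≡-Reasoning
        rows = deduplicate ℕ._≟_ (map proj₁ cells)
        rim≤ : rim λ' i ℕ.≤ rim λ' (tail i)
        rim≤ = rim-antitone dλ (tail≤ i)
        into : ∀ {r} → r ∈ rows → r ∈ applyUpTo (rim λ' i ℕ.+_) (suc (rimWidth i λ'))
        into r∈ with ∈-map⁻ proj₁ (∈-deduplicate⁻ ℕ._≟_ (map proj₁ cells) r∈)
        ... | x , x∈ , refl = subst (_∈ applyUpTo (rim λ' i ℕ.+_) (suc (rimWidth i λ')))
            (trans (ℕ.m+[n∸m]≡n (rim-antitone dλ (proj₂ (bounds x∈)))) (sym (row x∈)))
            (∈-applyUpTo⁺ (rim λ' i ℕ.+_) (s≤s (ℕ.∸-monoˡ-≤ (rim λ' i) (rim-antitone dλ (proj₁ (bounds x∈))))))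
        onto : ∀ {r} → r ∈ applyUpTo (rim λ' i ℕ.+_) (suc (rimWidth i λ')) → r ∈ rows
        onto r∈ with ∈-applyUpTo⁻ (rim λ' i ℕ.+_) {n = suc (rimWidth i λ')} r∈
        ... | s , s≤s s≤w , refl with rows-between m {tail i} {rim λ' i ℕ.+ s}
                (subst (λ l → rim λ' l ℕ.≤ _) (sym (tail+m i)) (ℕ.m≤m+n _ s))
                (ℕ.≤-trans (ℕ.+-monoʳ-≤ (rim λ' i) s≤w) (ℕ.≤-reflexive (ℕ.m+[n∸m]≡n rim≤)))
        ...   | l , t≤l , l≤ , e with cellOn t≤l (subst (l ℤ.≤_) (tail+m i) l≤)
        ...     | x , x∈ , row-x , _ = ∈-deduplicate⁺ ℕ._≟_ (subst (_∈ map proj₁ cells) (trans row-x e) (∈-map⁺ proj₁ x∈))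

-- From a ribbon to a raised strip of the rim

suc-cancel-≤ : ∀ {k l} → ℤ.suc k ℤ.≤ ℤ.suc l → k ℤ.≤ l
suc-cancel-≤ {k} {l} h = subst₂ ℤ._≤_ (ℤ.pred-suc k) (ℤ.pred-suc l) (ℤ.pred-mono h)

extremal : {A : Set} (f : A → ℤ) (x : A) (xs : List A) →
           ∃ λ y → y ∈ x ∷ xs × (∀ {z} → z ∈ x ∷ xs → f z ℤ.≤ f y)
extremal f x [] = x , here refl , λ { (here refl) → ℤ.≤-refl }
extremal f x (x' ∷ xs) with extremal f x' xs
... | y , y∈ , best with ℤ.≤-total (f x) (f y)
...   | inj₁ x≤y = y , there y∈ , λ { (here refl) → x≤y ; (there z∈) → best z∈ }
...   | inj₂ y≤x = x , here refl , λ { (here refl) → ℤ.≤-refl ; (there z∈) → ℤ.≤-trans (best z∈) y≤x }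

diagonal-east : ∀ r c → diagonal (r , suc c) ≡ ℤ.suc (diagonal (r , c))
diagonal-east r c = ℤ.+-assoc (+ 1) (+ c) (- (+ r))

diagonal-south : ∀ r c → ℤ.suc (diagonal (suc r , c)) ≡ diagonal (r , c)
diagonal-south r c = trans (cong ℤ.suc (ℤ.minus-suc (+ c) r)) (ℤ.suc-pred (diagonal (r , c)))

step-up : ∀ {k l} → k ≡ ℤ.suc l → k ℤ.≤ ℤ.suc l × l ℤ.≤ ℤ.suc k
step-up {k} {l} e = ℤ.≤-reflexive e ,
  ℤ.≤-trans (ℤ.i≤suc[i] l) (ℤ.≤-trans (ℤ.≤-reflexive (sym e)) (ℤ.i≤suc[i] k))

adjacent-diagonal : ∀ {x y} → Adjacent x y → diagonal x ℤ.≤ ℤ.suc (diagonal y) × diagonal y ℤ.≤ ℤ.suc (diagonal x)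
adjacent-diagonal {r , suc c} east = step-up (diagonal-east r c)
adjacent-diagonal {r , c} west = let a , b = step-up (diagonal-east r c) in b , a
adjacent-diagonal {suc r , c} south = let a , b = step-up (sym (diagonal-south r c)) in b , a
adjacent-diagonal {r , c} north = step-up (sym (diagonal-south r c))

module _ (cells : List Cell) where

  Occupied : ℤ → Set
  Occupied l = ∃ λ x → x ∈ cells × diagonal x ≡ l

  -- Adjacent boxes lie on diagonals differing by at most one, so a path from b to x meets every
  -- diagonal in between. The two halves cover x on either side of b.
  reached : ∀ {b} → b ∈ cells → ∀ k {x} → x ∈ iterate k (grow cells) [ b ] →
            (∀ {l} → diagonal b ℤ.≤ l → l ℤ.≤ diagonal x → Occupied l) ×
            (∀ {l} → diagonal x ℤ.≤ l → l ℤ.≤ diagonal b → Occupied l)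
  reached {b} b∈ zero (here refl) = (λ b≤l l≤b → b , b∈ , ℤ.≤-antisym b≤l l≤b) , λ b≤l l≤b → b , b∈ , ℤ.≤-antisym b≤l l≤b
  reached {b} b∈ (suc k) {x} x∈ with grow⁻ {cells} {iterate k (grow cells) _} x∈
  ... | x∈cells , s , s∈ , inj₁ refl = reached b∈ k s∈
  ... | x∈cells , s , s∈ , inj₂ adj with reached b∈ k s∈ | adjacent-diagonal adj
  ...   | up , down | x≤1+s , s≤1+x = up′ , down′
    where
    up′ : ∀ {l} → diagonal b ℤ.≤ l → l ℤ.≤ diagonal x → Occupied l
    up′ {l} b≤l l≤x with l ℤ.≟ diagonal x
    ... | yes refl = x , x∈cells , refl
    ... | no l≢x = up b≤l (suc-cancel-≤ (ℤ.≤-trans (ℤ.i<j⇒suc[i]≤j (ℤ.≤∧≢⇒< l≤x l≢x)) x≤1+s))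
    down′ : ∀ {l} → diagonal x ℤ.≤ l → l ℤ.≤ diagonal b → Occupied l
    down′ {l} x≤l l≤b with diagonal x ℤ.≟ l
    ... | yes refl = x , x∈cells , refl
    ... | no x≢l = down (ℤ.≤-trans s≤1+x (ℤ.i<j⇒suc[i]≤j (ℤ.≤∧≢⇒< x≤l x≢l))) l≤b

  connected⇒interval : T (connected cells) → ∀ {x} → x ∈ cells →
    ∃ λ k → ∃ λ t → (∀ {x} → x ∈ cells → k ℤ.≤ diagonal x × diagonal x ℤ.≤ k ℤ.+ + t) ×
                    (∀ {l} → k ℤ.≤ l → l ℤ.≤ k ℤ.+ + t → Occupied l)
  connected⇒interval conn {x} x∈ with connected⁻ {cells} conn x∈ | nonempty x∈
    where
    nonempty : ∀ {x} {cells : List Cell} → x ∈ cells → ∃₂ λ z zs → cells ≡ z ∷ zs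
    nonempty {cells = z ∷ zs} _ = z , zs , refl
  ... | b , b∈ , reach | z , zs , refl with extremal diagonal z zs | extremal (-_ ∘ diagonal) z zs
  ...   | hi , hi∈ , best | lo , lo∈ , worst with ≤⇒+ (ℤ.neg-cancel-≤ (worst hi∈))
  ...     | t , e = diagonal lo , t ,
    (λ y∈ → ℤ.neg-cancel-≤ (worst y∈) , ℤ.≤-trans (best y∈) (ℤ.≤-reflexive e)) ,
    -- The starting box b of the search splits the interval: a path from b to one of the extremal
    -- boxes passes through diagonal l.
    λ {l} lo≤l l≤ → [ (λ l≤b → proj₂ (reached b∈ (length (z ∷ zs)) (reach lo∈)) lo≤l l≤b)
                    , (λ b≤l → proj₁ (reached b∈ (length (z ∷ zs)) (reach hi∈)) b≤l (ℤ.≤-trans l≤ (ℤ.≤-reflexive (sym e)))) ]′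
                    (ℤ.≤-total l (diagonal b))

length-positive : {A : Set} {xs : List A} {m : ℕ} → length xs ≡ suc m → ∃ (_∈ xs)
length-positive {xs = x ∷ xs} _ = x , here refl

module Classify (m : ℕ) {λ' μ : Partition} (λ-partition : IsPartition λ') (μ-partition : IsPartition μ) where

  open Strip m
  open Skew λ-partition μ-partition

  -- Without 2×2 squares there is one box per diagonal, connectedness makes the occupied diagonals
  -- an interval, and the number of boxes fixes its length.
  isRibbon⇒adds : T (isRibbon (suc m) λ' μ) → ∃ λ i → Adds i λ' μ
  isRibbon⇒adds rib with ∧⁻ {contained λ' μ} rib
  ... | cont , rib₁ with ∧⁻ {length cells ≡ᵇ suc m} rib₁
  ...   | len , rib₂ with ∧⁻ {connected cells} rib₂
  ...     | conn , square = i , adds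
    where
    grows : ∀ k → rim λ' k ℕ.≤ rim μ k
    grows = contained⇒rim≤ (contained⁻ {λ'} {μ} cont)

    -- Two boxes of a skew shape which are consecutive on a diagonal span a 2×2 square.
    square-free : ∀ {r c} → (r , c) ∈ cells → (suc r , suc c) ∈ cells → ⊥
    square-free {r} {c} x∈ y∈ with ∈-skewCells⁻ {λ'} {μ} x∈ | ∈-skewCells⁻ {λ'} {μ} y∈
    ... | p≤c , c<q | p'≤1+c , 1+c<q' = not⁻ square (any⁺ _ x∈
      (∧⁺ (∈ᶜ⁺ {r , suc c} (∈-skewCells⁺ {λ'} {μ} (ℕ.m≤n⇒m≤1+n p≤c) (ℕ.<-≤-trans 1+c<q' (part-antitone (proj₂ μ-partition) r))))
      (∧⁺ (∈ᶜ⁺ {suc r , c} (∈-skewCells⁺ {λ'} {μ} (ℕ.≤-trans (part-antitone (proj₂ λ-partition) r) p≤c) (ℕ.<⇒≤ 1+c<q')))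
          (∈ᶜ⁺ y∈))))

    thin : ∀ k → rim μ k ℕ.≤ suc (rim λ' k)
    thin k = ℕ.≮⇒≥ thick
      where
      thick : ¬ (suc (rim λ' k) ℕ.< rim μ k)
      thick lt with rim⇒cell {k} ℕ.≤-refl (ℕ.<-trans (ℕ.n<1+n _) lt) | rim⇒cell {k} (ℕ.n≤1+n _) lt
      ... | (r , c) , x∈ , refl , ex | (_ , c') , y∈ , refl , ey =
        square-free x∈ (subst (λ c → (suc r , c) ∈ cells) (ℤ.+-injective
          (trans (sym (diagonal-col (suc r , c'))) (trans (cong (ℤ._+ + suc r) (trans ey (sym ex)))
            (trans (sym (suc-+-suc (diagonal (r , c)) r))
              (trans (ℤ.+-assoc (+ 1) (diagonal (r , c)) (+ r)) (cong ℤ.suc (diagonal-col (r , c)))))))) y∈)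

    open Thin thin

    length≡ : length cells ≡ suc m
    length≡ = ℕ.≡ᵇ⇒≡ (length cells) (suc m) len

    extent = connected⇒interval cells conn (proj₂ (length-positive length≡))
    k = proj₁ extent
    t = proj₁ (proj₂ extent)
    bounds = proj₁ (proj₂ (proj₂ extent))
    onto = proj₂ (proj₂ (proj₂ extent))

    t≡m : t ≡ m
    t≡m = ℕ.suc-injective (trans (sym (length-cells k t bounds onto)) length≡)

    i : ℤ
    i = k ℤ.+ + t

    tail-i : tail i ≡ k
    tail-i = trans (cong (λ s → k ℤ.+ + t ℤ.- + s) (sym t≡m)) (n+m-m k (+ t))

    unoccupied : ∀ {l} → ¬ Occupied cells l → rim μ l ≡ rim λ' l
    unoccupied {l} free = ℕ.≤-antisym (ℕ.≮⇒≥ λ lt → case rim⇒cell {l} ℕ.≤-refl lt of λ { (x , x∈ , _ , e) → free (x , x∈ , e) }) (grows l)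

    adds : Adds i λ' μ
    adds = record
      { inside = λ {l} t≤l l≤i → case onto (subst (ℤ._≤ l) tail-i t≤l) l≤i of λ
          { (x , x∈ , refl) → ℕ.≤-antisym (thin l) (ℕ.≤-<-trans (proj₁ (cell⇒rim x∈)) (proj₂ (cell⇒rim x∈))) }
      ; before = λ l<t → unoccupied λ { (x , x∈ , refl) → ℤ.<⇒≱ l<t (subst (ℤ._≤ _) (sym tail-i) (proj₁ (bounds x∈))) }
      ; after = λ i<l → unoccupied λ { (x , x∈ , refl) → ℤ.<⇒≱ i<l (proj₂ (bounds x∈)) }
      }

  isRibbon⇒adds-head : T (isRibbon (suc m) λ' μ) → Adds (headDiag λ' μ) λ' μ
  isRibbon⇒adds-head rib with isRibbon⇒adds rib
  ... | i , A = subst (λ i → Adds i λ' μ) (sym (Added.headDiag≡ λ-partition μ-partition A)) A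

-- Enumeration of partitions

∈-partsBounded⁻ : ∀ f m k {μ} → μ ∈ partsBounded f m k →
                  All (1 ℕ.≤_) μ × Linked ℕ._≥_ (k ∷ μ) × size μ ≡ m
∈-partsBounded⁻ f zero k (here refl) = [] , [-] , refl
∈-partsBounded⁻ (suc f) m@(suc _) k μ∈
  with find (∈-concatMap⁻ (λ p → map (p ∷_) (partsBounded f (m ∸ p) p)) {xs = applyUpTo suc (k ℕ.⊓ m)} μ∈)
... | p , p∈ , μ∈′ with ∈-applyUpTo⁻ suc {n = k ℕ.⊓ m} p∈ | ∈-map⁻ (p ∷_) μ∈′
...   | p′ , p′<k⊓m , refl | ν , ν∈ , refl with ∈-partsBounded⁻ f (m ∸ p) p ν∈
...     | pos , ds , sz = s≤s z≤n ∷ pos , ℕ.≤-trans p′<k⊓m (ℕ.m⊓n≤m k m) ∷ ds ,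
          trans (cong (p ℕ.+_) sz) (ℕ.m+[n∸m]≡n (ℕ.≤-trans p′<k⊓m (ℕ.m⊓n≤n k m)))

∈-partsBounded⁺ : ∀ f m k {μ} → m ℕ.≤ f → All (1 ℕ.≤_) μ → Linked ℕ._≥_ (k ∷ μ) → size μ ≡ m →
                  μ ∈ partsBounded f m k
∈-partsBounded⁺ f zero k {[]} _ _ _ _ = here refl
∈-partsBounded⁺ f zero k {suc p ∷ μ} _ _ _ ()
∈-partsBounded⁺ f zero k {zero ∷ μ} _ (() ∷ _) _ _
∈-partsBounded⁺ (suc f) m@(suc _) k {suc p ∷ μ} (s≤s m≤f) (_ ∷ pos) (p≤k ∷ ds) sz =
  ∈-concatMap⁺ (λ p → map (p ∷_) (partsBounded f (m ∸ p) p)) (lose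
    (∈-applyUpTo⁺ suc (ℕ.⊓-glb p≤k p<m))
    (∈-map⁺ (suc p ∷_) (∈-partsBounded⁺ f (m ∸ suc p) (suc p)
      (ℕ.≤-trans (ℕ.∸-monoˡ-≤ (suc p) (s≤s m≤f)) (ℕ.m∸n≤m f p)) pos ds
      (trans (sym (ℕ.m+n∸m≡n (suc p) (size μ))) (cong (_∸ suc p) sz)))))
  where
  p<m : suc p ℕ.≤ m
  p<m = ℕ.≤-trans (ℕ.m≤m+n (suc p) (size μ)) (ℕ.≤-reflexive sz)
∈-partsBounded⁺ (suc f) m@(suc _) k {zero ∷ μ} _ (() ∷ _) _ _

partsBounded-unique : ∀ f m k → Unique (partsBounded f m k)
partsBounded-unique f zero k = [] ∷ []
partsBounded-unique zero (suc m) k = []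
partsBounded-unique (suc f) m@(suc _) k = Unique.concat⁺
  (All.map⁺ (All.tabulate λ {p} _ → Unique.map⁺ ∷-injectiveʳ (partsBounded-unique f (m ∸ p) p)))
  (AllPairs.map⁺ (AllPairs.map disjoint (Unique.applyUpTo⁺₁ suc (k ℕ.⊓ m) λ i<j _ e → ℕ.<⇒≢ i<j (ℕ.suc-injective e))))
  where
  disjoint : ∀ {p p'} → p ≢ p' → Disjoint (map (p ∷_) (partsBounded f (m ∸ p) p)) (map (p' ∷_) (partsBounded f (m ∸ p') p'))
  disjoint {p} {p'} p≢p' (μ∈ , μ∈') with ∈-map⁻ (p ∷_) μ∈ | ∈-map⁻ (p' ∷_) μ∈'
  ... | _ , _ , refl | _ , _ , refl = p≢p' refl

∈-partitions⁻ : ∀ m {μ} → μ ∈ partitions m → IsPartition μ × size μ ≡ m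
∈-partitions⁻ m μ∈ with ∈-partsBounded⁻ m m m μ∈
... | pos , ds , sz = (pos , Linked.tail ds) , sz

∈-partitions⁺ : ∀ {μ} → IsPartition μ → μ ∈ partitions (size μ)
∈-partitions⁺ {μ} (pos , ds) = ∈-partsBounded⁺ (size μ) (size μ) (size μ) ℕ.≤-refl pos (linked μ ds) refl
  where
  linked : ∀ μ → Linked ℕ._≥_ μ → Linked ℕ._≥_ (size μ ∷ μ)
  linked [] _ = [-]
  linked (p ∷ μ) ds = ℕ.m≤m+n p (size μ) ∷ ds

unique-singleton : {A : Set} {xs : List A} {x : A} → Unique xs → x ∈ xs → (∀ {y} → y ∈ xs → y ≡ x) → xs ≡ [ x ]
unique-singleton {xs = y ∷ []} _ _ eq = cong [_] (eq (here refl))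
unique-singleton {xs = y ∷ z ∷ xs} ((y≢z ∷ _) ∷ _) _ eq =
  contradiction (trans (eq (here refl)) (sym (eq (there (here refl))))) y≢z

empty : {A : Set} {xs : List A} → (∀ {y} → ¬ y ∈ xs) → xs ≡ []
empty {xs = []} _ = refl
empty {xs = y ∷ xs} none = contradiction (here refl) none

-- The common pattern of `addable` and `removable`, with `at` the filter applied by `u` and `d`;
-- both operators are evaluated by the same two lemmas.
module Tagged (P : Partition → Bool) (h : Partition → ℤ) (μs : List Partition) where

  tagged : List (ℤ × Partition)
  tagged = map (λ μ → (h μ , μ)) (filterᵇ P μs)

  ∈-tagged⁻ : ∀ {e} → e ∈ tagged → proj₂ e ∈ μs × T (P (proj₂ e)) × proj₁ e ≡ h (proj₂ e)
  ∈-tagged⁻ e∈ with ∈-map⁻ (λ μ → (h μ , μ)) e∈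
  ... | μ , μ∈ , refl with ∈-filter⁻ _ {xs = μs} μ∈
  ...   | μ∈′ , Pμ = μ∈′ , Pμ , refl

  ∈-tagged⁺ : ∀ {μ} → μ ∈ μs → T (P μ) → (h μ , μ) ∈ tagged
  ∈-tagged⁺ μ∈ Pμ = ∈-map⁺ (λ μ → (h μ , μ)) (∈-filter⁺ _ μ∈ Pμ)

  at : ℤ → List (ℤ × Partition)
  at i = filterᵇ (λ e → proj₁ e ==ℤ i) tagged

  ∈-at⁻ : ∀ {i e} → e ∈ at i → proj₁ e ≡ i × proj₂ e ∈ μs × T (P (proj₂ e)) × proj₁ e ≡ h (proj₂ e)
  ∈-at⁻ e∈ with ∈-filter⁻ _ {xs = tagged} e∈
  ... | e∈′ , t = toWitness t , ∈-tagged⁻ e∈′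

  at-some : ∀ {i μ} → Unique μs → μ ∈ μs → T (P μ) → h μ ≡ i →
            (∀ {ν} → ν ∈ μs → T (P ν) → h ν ≡ i → ν ≡ μ) → at i ≡ [ (i , μ) ]
  at-some {i} {μ} u μ∈ Pμ refl uniq = unique-singleton
    (Unique.filter⁺ _ (Unique.map⁺ (cong proj₂) (Unique.filter⁺ _ u)))
    (∈-filter⁺ _ (∈-tagged⁺ μ∈ Pμ) (fromWitness refl))
    λ e∈ → case ∈-at⁻ e∈ of λ { (refl , ν∈ , Pν , eq) → cong (_ ,_) (uniq ν∈ Pν (sym eq)) }

  at-none : ∀ {i} → (∀ {ν} → ν ∈ μs → T (P ν) → h ν ≢ i) → at i ≡ []
  at-none none = empty λ e∈ → case ∈-at⁻ e∈ of λ { (refl , ν∈ , Pν , eq) → none ν∈ Pν (sym eq) }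

-- Adding and removing ribbons in terms of steps of the rim

Flat Drop : Partition → ℤ → Set
Flat λ' k = rim λ' k ≡ rim λ' (ℤ.suc k)
Drop λ' k = rim λ' k ≡ suc (rim λ' (ℤ.suc k))

flat⊎drop : ∀ {λ'} → IsPartition λ' → ∀ k → Flat λ' k ⊎ Drop λ' k
flat⊎drop {λ'} (_ , ds) k with rim λ' k ℕ.≟ rim λ' (ℤ.suc k)
... | yes e = inj₁ e
... | no e = inj₂ (ℕ.≤-antisym (rim-slope ds k) (ℕ.≤∧≢⇒< (rim-antitone ds (ℤ.i≤suc[i] k)) (e ∘ sym)))

flat∧drop : ∀ λ' k → Flat λ' k → Drop λ' k → ⊥
flat∧drop _ _ f d = ℕ.1+n≢n (trans (sym d) f)

suc-injective : ∀ {k l} → ℤ.suc k ≡ ℤ.suc l → k ≡ l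
suc-injective {k} {l} e = trans (sym (ℤ.pred-suc k)) (trans (cong ℤ.pred e) (ℤ.pred-suc l))

module Moves (m : ℕ) where

  open Strip m public

  -- The diagonal i - n just before the strip. The steps after `base i` and after i are the only
  -- ones that a ribbon with head on i changes.
  base : ℤ → ℤ
  base i = ℤ.pred (tail i)

  suc-base : ∀ i → ℤ.suc (base i) ≡ tail i
  suc-base i = ℤ.suc-pred (tail i)

  base-suc : ∀ i → base (ℤ.suc i) ≡ tail i
  base-suc i = trans (cong ℤ.pred (ℤ.+-assoc (+ 1) i (- (+ m)))) (ℤ.pred-suc (tail i))

  tail-cancel-≤ : ∀ {i j} → tail i ℤ.≤ tail j → i ℤ.≤ j
  tail-cancel-≤ {i} {j} h = subst₂ ℤ._≤_ (tail+m i) (tail+m j) (ℤ.+-monoˡ-≤ (+ m) h)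

  tail-mono-≤ : ∀ {i j} → i ℤ.≤ j → tail i ℤ.≤ tail j
  tail-mono-≤ = ℤ.+-monoˡ-≤ (- (+ m))

  base-injective : ∀ {i j} → base i ≡ base j → i ≡ j
  base-injective {i} {j} e = ℤ.≤-antisym (tail-cancel-≤ (ℤ.≤-reflexive t)) (tail-cancel-≤ (ℤ.≤-reflexive (sym t)))
    where t = trans (sym (suc-base i)) (trans (cong ℤ.suc e) (suc-base j))

  InStrip : ℤ → ℤ → Set
  InStrip i k = tail i ℤ.≤ k × k ℤ.≤ i

  -- Opaque, so that a case split on `inStrip? i k` still finds it inside `bump i k`.
  abstract
    inStrip? : ∀ i k → Dec (InStrip i k)
    inStrip? i k = tail i ℤ.≤? k ×-dec k ℤ.≤? i

  -- The indicator of the strip. A ribbon adds it to the rim, which reduces questions about the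
  -- order of two ribbons to commutativity of addition.
  bump : ℤ → ℤ → ℕ
  bump i k = if does (inStrip? i k) then 1 else 0

  bump-in : ∀ {i k} → InStrip i k → bump i k ≡ 1
  bump-in {i} {k} p with inStrip? i k
  ... | yes _ = refl
  ... | no ¬p = contradiction p ¬p

  bump-out : ∀ {i k} → ¬ InStrip i k → bump i k ≡ 0
  bump-out {i} {k} ¬p with inStrip? i k
  ... | yes p = contradiction p ¬p
  ... | no _ = refl

  bump-cong : ∀ {i k j l} → (InStrip i k → InStrip j l) → (InStrip j l → InStrip i k) → bump i k ≡ bump j l
  bump-cong {i} {k} {j} {l} to from with inStrip? j l
  ... | yes p = bump-in (from p)
  ... | no ¬p = bump-out (¬p ∘ to)

  adds⇒bump : ∀ {i λ' μ} → Adds i λ' μ → ∀ k → rim μ k ≡ bump i k ℕ.+ rim λ' k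
  adds⇒bump {i} A k with inStrip? i k | tail i ℤ.≤? k
  ... | yes (t≤k , k≤i) | _ = Adds.inside A t≤k k≤i
  ... | no _ | no t≰k = Adds.before A (ℤ.≰⇒> t≰k)
  ... | no ¬p | yes t≤k = Adds.after A (ℤ.≰⇒> λ k≤i → ¬p (t≤k , k≤i))

  bump⇒adds : ∀ {i λ' μ} → (∀ k → rim μ k ≡ bump i k ℕ.+ rim λ' k) → Adds i λ' μ
  bump⇒adds {λ' = λ'} e = record
    { inside = λ {k} t≤k k≤i → trans (e k) (cong (ℕ._+ rim λ' k) (bump-in (t≤k , k≤i)))
    ; before = λ {k} k<t → trans (e k) (cong (ℕ._+ rim λ' k) (bump-out λ (t≤k , _) → ℤ.<⇒≱ k<t t≤k))
    ; after = λ {k} i<k → trans (e k) (cong (ℕ._+ rim λ' k) (bump-out λ (_ , k≤i) → ℤ.<⇒≱ i<k k≤i)) }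

  bump-suc : ∀ {i k} → k ≢ i → k ≢ base i → bump i k ≡ bump i (ℤ.suc k)
  bump-suc {i} {k} k≢i k≢base = bump-cong
    (λ (t≤k , k≤i) → ℤ.≤-trans t≤k (ℤ.i≤suc[i] k) , ℤ.i<j⇒suc[i]≤j (ℤ.≤∧≢⇒< k≤i k≢i))
    (λ (t≤1+k , 1+k≤i) → suc-cancel-≤ (ℤ.i<j⇒suc[i]≤j (ℤ.≤∧≢⇒< t≤1+k
        λ e → k≢base (suc-injective (trans (sym e) (sym (suc-base i))))))
      , ℤ.≤-trans (ℤ.i≤suc[i] k) 1+k≤i)

  bump-head : ∀ i → bump i i ≡ 1
  bump-head i = bump-in (tail≤ i , ℤ.≤-refl)

  bump-suc-head : ∀ i → bump i (ℤ.suc i) ≡ 0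
  bump-suc-head i = bump-out λ (_ , h) → ℤ.<⇒≱ (i<1+i i) h

  bump-tail : ∀ i → bump i (tail i) ≡ 1
  bump-tail i = bump-in (ℤ.≤-refl , tail≤ i)

  base<tail : ∀ i → base i ℤ.< tail i
  base<tail i = subst (base i ℤ.<_) (suc-base i) (i<1+i (base i))

  bump-base : ∀ i → bump i (base i) ≡ 0
  bump-base i = bump-out λ (h , _) → ℤ.<⇒≱ (base<tail i) h

  record CanAdd (i : ℤ) (λ' : Partition) : Set where
    constructor canAdd
    field
      head-flat : Flat λ' i
      base-drop : Drop λ' (base i)

  record CanRemove (i : ℤ) (μ : Partition) : Set where
    constructor canRemove
    field
      head-drop : Drop μ i
      base-flat : Flat μ (base i)

  module _ {i : ℤ} {λ' μ : Partition} (λ-partition : IsPartition λ') (μ-partition : IsPartition μ) (A : Adds i λ' μ) where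

    private
      e : ∀ k → rim μ k ≡ bump i k ℕ.+ rim λ' k
      e = adds⇒bump A
      at-head : rim μ i ≡ suc (rim λ' i)
      at-head = trans (e i) (cong (ℕ._+ rim λ' i) (bump-head i))
      at-suc : rim μ (ℤ.suc i) ≡ rim λ' (ℤ.suc i)
      at-suc = trans (e _) (cong (ℕ._+ rim λ' (ℤ.suc i)) (bump-suc-head i))
      at-base : rim μ (base i) ≡ rim λ' (base i)
      at-base = trans (e _) (cong (ℕ._+ rim λ' (base i)) (bump-base i))
      at-tail : rim μ (ℤ.suc (base i)) ≡ suc (rim λ' (ℤ.suc (base i)))
      at-tail = trans (e _) (cong (ℕ._+ rim λ' (ℤ.suc (base i))) (trans (cong (bump i) (suc-base i)) (bump-tail i)))

    -- A drop of λ after i would become a fall by 2 in μ, and a flat step after `base i` would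
    -- become a rise; neither occurs in the rim of a partition.
    adds⇒canAdd : CanAdd i λ'
    adds⇒canAdd = canAdd
      (ℕ.≤-antisym (ℕ.s≤s⁻¹ (subst₂ (λ a b → a ℕ.≤ suc b) at-head at-suc (rim-slope (proj₂ μ-partition) i)))
                   (rim-antitone (proj₂ λ-partition) (ℤ.i≤suc[i] i)))
      (ℕ.≤-antisym (rim-slope (proj₂ λ-partition) (base i))
                   (subst₂ ℕ._≤_ at-tail at-base (rim-antitone (proj₂ μ-partition) (ℤ.i≤suc[i] (base i)))))

    adds⇒canRemove : CanRemove i μ
    adds⇒canRemove with adds⇒canAdd
    ... | canAdd f d = canRemove (trans at-head (cong suc (trans f (sym at-suc)))) (trans at-base (trans d (sym at-tail)))

  -- Away from both ends of the strip the two values at a step are raised equally, so flat steps and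
  -- drops carry over in either direction.
  bits-same : ∀ {i λ' μ k} → Adds i λ' μ → k ≢ i → k ≢ base i →
    ∃ λ c → rim μ k ≡ c ℕ.+ rim λ' k × rim μ (ℤ.suc k) ≡ c ℕ.+ rim λ' (ℤ.suc k)
  bits-same {i} {λ'} {μ} {k} A k≢i k≢base = bump i k , adds⇒bump A k ,
    trans (adds⇒bump A (ℤ.suc k)) (cong (ℕ._+ rim λ' (ℤ.suc k)) (sym (bump-suc k≢i k≢base)))

  module _ {i k : ℤ} {λ' μ : Partition} (A : Adds i λ' μ) (k≢i : k ≢ i) (k≢base : k ≢ base i) where

    flat-up : Flat λ' k → Flat μ k
    flat-up f with bits-same A k≢i k≢base
    ... | c , e , e' = trans e (trans (cong (c ℕ.+_) f) (sym e'))

    drop-up : Drop λ' k → Drop μ k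
    drop-up d with bits-same A k≢i k≢base
    ... | c , e , e' = trans e (trans (cong (c ℕ.+_) d) (trans (ℕ.+-suc c _) (cong suc (sym e'))))

    flat-down : Flat μ k → Flat λ' k
    flat-down f with bits-same A k≢i k≢base
    ... | c , e , e' = ℕ.+-cancelˡ-≡ c _ _ (trans (sym e) (trans f e'))

    drop-down : Drop μ k → Drop λ' k
    drop-down d with bits-same A k≢i k≢base
    ... | c , e , e' = ℕ.+-cancelˡ-≡ c _ _ (trans (sym e) (trans d (trans (cong suc e') (sym (ℕ.+-suc c _)))))

  -- A distance from the origin beyond which the strip has ended, so that the changed rim keeps the
  -- tails that `Profile` demands.
  far : ℤ → ℕ
  far i = suc (ℤ.∣ i ∣ ℕ.+ m)

  i≤∣i∣ : ∀ i → i ℤ.≤ + ℤ.∣ i ∣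
  i≤∣i∣ (+ _) = ℤ.≤-refl
  i≤∣i∣ -[1+ _ ] = ℤ.-≤+

  -∣i∣≤i : ∀ i → - (+ ℤ.∣ i ∣) ℤ.≤ i
  -∣i∣≤i (+ zero) = ℤ.≤-refl
  -∣i∣≤i (+ suc _) = ℤ.-≤+
  -∣i∣≤i -[1+ _ ] = ℤ.≤-refl

  out-right : ∀ i {t} → far i ℕ.≤ t → ¬ InStrip i (+ t)
  out-right i {t} far≤t (_ , t≤i) = ℕ.<⇒≱ (ℕ.≤-trans (s≤s (ℕ.m≤m+n ℤ.∣ i ∣ m)) far≤t)
    (ℤ.drop‿+≤+ (ℤ.≤-trans t≤i (i≤∣i∣ i)))

  out-left : ∀ i {t} → far i ℕ.≤ t → ¬ InStrip i (- (+ t))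
  out-left i {t} far≤t (tail≤t , _) = ℕ.<⇒≱ far≤t (ℤ.drop‿+≤+ (ℤ.neg-cancel-≤
    (ℤ.≤-trans (ℤ.≤-reflexive (ℤ.neg-distrib-+ (+ ℤ.∣ i ∣) (+ m)))
      (ℤ.≤-trans (ℤ.+-monoˡ-≤ (- (+ m)) (-∣i∣≤i i)) tail≤t))))

  add : ∀ {i λ'} → IsPartition λ' → CanAdd i λ' → ∃ λ μ → IsPartition μ × Adds i λ' μ
  add {i} {λ'} (_ , ds) (canAdd hf bd) with profile⇒partition profile
    where
    f : ℤ → ℕ
    f k = bump i k ℕ.+ rim λ' k
    anti : ∀ {k l} → k ℤ.≤ l → f l ℕ.≤ f k
    anti {k} {l} k≤l with inStrip? i k | inStrip? i l
    ... | yes _ | yes _ = s≤s (rim-antitone ds k≤l)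
    ... | yes _ | no _ = ℕ.m≤n⇒m≤1+n (rim-antitone ds k≤l)
    ... | no _ | no _ = rim-antitone ds k≤l
    -- Entering the strip raises the value by 1; the drop after `base i` makes room for it.
    ... | no ¬p | yes (t≤l , l≤i) = ℕ.≤-trans (s≤s (rim-antitone ds t≤l))
      (ℕ.≤-trans (ℕ.≤-reflexive (trans (cong (suc ∘ rim λ') (sym (suc-base i))) (sym bd)))
        (rim-antitone ds (ℤ.i<j⇒i≤pred[j] (ℤ.≰⇒> λ t≤k → ¬p (t≤k , ℤ.≤-trans k≤l l≤i)))))
    slope : ∀ k → f k ℕ.≤ suc (f (ℤ.suc k))
    slope k with k ℤ.≟ i | k ℤ.≟ base i
    -- Leaving the strip lowers the value by 1, a legal step because the rim was flat here.
    ... | yes refl | _ = ℕ.≤-reflexive (trans (cong (ℕ._+ rim λ' k) (bump-head k))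
      (cong suc (trans hf (cong (ℕ._+ rim λ' (ℤ.suc k)) (sym (bump-suc-head k))))))
    ... | no _ | yes refl = ℕ.≤-trans (ℕ.≤-reflexive (cong (ℕ._+ rim λ' k) (bump-base i)))
      (ℕ.≤-trans (rim-slope ds k) (s≤s (ℕ.m≤n+m _ (bump i (ℤ.suc k)))))
    ... | no k≢i | no k≢b = ℕ.≤-trans (ℕ.+-monoʳ-≤ (bump i k) (rim-slope ds k))
      (ℕ.≤-reflexive (trans (ℕ.+-suc (bump i k) _) (cong (λ b → suc (b ℕ.+ rim λ' (ℤ.suc k))) (bump-suc k≢i k≢b))))
    profile : Profile f
    profile = record
      { antitone = anti
      ; slope = slope
      ; left = far i ℕ.+ length λ' , λ t h → trans (cong (ℕ._+ rim λ' (- (+ t))) (bump-out (out-left i (ℕ.m+n≤o⇒m≤o _ h))))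
          (rim-left ds t (ℕ.m+n≤o⇒n≤o (far i) h))
      ; right = far i ℕ.+ part λ' 0 , trans (cong (ℕ._+ rim λ' (+ (far i ℕ.+ part λ' 0))) (bump-out (out-right i (ℕ.m≤m+n _ _))))
          (rim-right ds (ℕ.m≤n+m _ (far i))) }
  ... | μ , μ-partition , e = μ , μ-partition , bump⇒adds e

  remove : ∀ {i μ} → IsPartition μ → CanRemove i μ → ∃ λ λ' → IsPartition λ' × Adds i λ' μ
  remove {i} {μ} (_ , ds) (canRemove hd bf) with profile⇒partition profile
    where
    f : ℤ → ℕ
    f k = rim μ k ∸ bump i k
    anti : ∀ {k l} → k ℤ.≤ l → f l ℕ.≤ f k
    anti {k} {l} k≤l with inStrip? i k | inStrip? i l
    ... | yes _ | yes _ = ℕ.∸-monoˡ-≤ 1 (rim-antitone ds k≤l)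
    ... | no _ | yes _ = ℕ.≤-trans (ℕ.m∸n≤m (rim μ l) 1) (rim-antitone ds k≤l)
    ... | no _ | no _ = rim-antitone ds k≤l
    -- Inside the strip 1 has been subtracted and beyond it nothing; the drop after i absorbs the
    -- difference.
    ... | yes (t≤k , k≤i) | no ¬p = ℕ.≤-trans (rim-antitone ds (ℤ.i<j⇒suc[i]≤j (ℤ.≰⇒> λ l≤i → ¬p (ℤ.≤-trans t≤k k≤l , l≤i))))
      (ℕ.≤-trans (ℕ.≤-reflexive (cong ℕ.pred (sym hd))) (ℕ.pred-mono-≤ (rim-antitone ds k≤i)))
    slope : ∀ k → f k ℕ.≤ suc (f (ℤ.suc k))
    slope k with k ℤ.≟ i | k ℤ.≟ base i
    ... | yes refl | _ = ℕ.≤-trans (ℕ.m∸n≤m _ (bump k k))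
      (ℕ.≤-trans (ℕ.≤-reflexive hd) (s≤s (ℕ.≤-reflexive (cong (rim μ (ℤ.suc k) ∸_) (sym (bump-suc-head k))))))
    ... | no _ | yes refl = ℕ.≤-trans (ℕ.m∸n≤m _ (bump i k)) (ℕ.≤-trans (ℕ.≤-reflexive bf)
      (ℕ.≤-trans (n≤1+pred[n] _) (s≤s (ℕ.≤-reflexive
        (cong (rim μ (ℤ.suc k) ∸_) (sym (trans (cong (bump i) (suc-base i)) (bump-tail i))))))))
    ... | no k≢i | no k≢b = ℕ.≤-trans (ℕ.∸-monoˡ-≤ (bump i k) (rim-slope ds k))
      (ℕ.≤-trans (ℕ.≤-reflexive (cong (suc (rim μ (ℤ.suc k)) ∸_) (bump-suc k≢i k≢b))) (suc-∸ (rim μ (ℤ.suc k)) (bump i (ℤ.suc k))))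
      where
      suc-∸ : ∀ a b → suc a ∸ b ℕ.≤ suc (a ∸ b)
      suc-∸ a zero = ℕ.≤-refl
      suc-∸ zero (suc b) = ℕ.≤-trans (ℕ.≤-reflexive (ℕ.0∸n≡0 b)) z≤n
      suc-∸ (suc a) (suc b) = suc-∸ a b
    profile : Profile f
    profile = record
      { antitone = anti
      ; slope = slope
      ; left = far i ℕ.+ length μ , λ t h → trans (cong (rim μ (- (+ t)) ∸_) (bump-out (out-left i (ℕ.m+n≤o⇒m≤o _ h))))
          (rim-left ds t (ℕ.m+n≤o⇒n≤o (far i) h))
      ; right = far i ℕ.+ part μ 0 , ℕ.n≤0⇒n≡0 (ℕ.≤-trans (ℕ.m∸n≤m (rim μ (+ (far i ℕ.+ part μ 0))) (bump i (+ (far i ℕ.+ part μ 0))))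
          (ℕ.≤-reflexive (rim-right ds (ℕ.m≤n+m _ (far i))))) }
  ... | λ' , λ-partition , e = λ' , λ-partition , bump⇒adds back
    where
    back : ∀ k → rim μ k ≡ bump i k ℕ.+ rim λ' k
    back k = trans (sym (ℕ.m+[n∸m]≡n (le k))) (cong (bump i k ℕ.+_) (sym (e k)))
      where
      le : ∀ k → bump i k ℕ.≤ rim μ k
      le k with inStrip? i k
      ... | no _ = z≤n
      -- The drop after i keeps the rim positive on the strip, so the subtraction in f was not
      -- truncated.
      ... | yes (_ , k≤i) = ℕ.≤-trans (ℕ.≤-trans (s≤s z≤n) (ℕ.≤-reflexive (sym hd))) (rim-antitone ds k≤i)

length≤size : ∀ {λ'} → All (1 ℕ.≤_) λ' → length λ' ℕ.≤ size λ'
length≤size [] = z≤n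
length≤size (p ∷ ps) = ℕ.+-mono-≤ p (length≤size ps)

part≤size : ∀ λ' → part λ' 0 ℕ.≤ size λ'
part≤size [] = z≤n
part≤size (p ∷ ps) = ℕ.m≤m+n p (size ps)

-- From the first part on the rim is 0 and cannot drop; in `flat-bound`, left of minus the number of
-- rows it always drops. Both bounds are weakened to the size, which is easy to follow when ribbons
-- are added or removed.
drop-bound : ∀ {λ' k} → IsPartition λ' → Drop λ' k → k ℤ.< + size λ'
drop-bound {λ'} {k} (_ , ds) d = ℤ.≰⇒> λ s≤k → ℕ.1+n≢0 (trans (sym d) (ℕ.n≤0⇒n≡0
  (subst (rim λ' k ℕ.≤_) (rim-right ds (part≤size λ')) (rim-antitone ds s≤k))))

flat-bound : ∀ {λ' k} → IsPartition λ' → Flat λ' k → - (+ size λ') ℤ.≤ k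
flat-bound {λ'} {k} (pos , ds) f = ℤ.≮⇒≥ λ k<-s → below k k<-s f
  where
  below : ∀ k → k ℤ.< - (+ size λ') → ¬ Flat λ' k
  below (+ k) h _ = ℤ.<⇒≱ h (ℤ.≤-trans (ℤ.neg-mono-≤ (ℤ.+≤+ z≤n)) (ℤ.+≤+ z≤n))
  below -[1+ t ] h f = ℕ.1+n≢n (trans (sym (rim-left ds (suc t) (ℕ.≤-trans l≤t (ℕ.n≤1+n t))))
    (trans f (trans (cong (rim λ') (ℤ.1-[1+n]≡-n t)) (rim-left ds t l≤t))))
    where
    l≤t : length λ' ℕ.≤ t
    l≤t = ℕ.≤-trans (length≤size pos) (ℕ.s≤s⁻¹ (ℤ.drop‿+<+ (ℤ.neg-cancel-< h)))

-- Interactions of strips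

module Interaction (m : ℕ) where

  open Moves m public

  module _ {i : ℤ} {λ' μ ν : Partition} (λ-partition : IsPartition λ') where

    adds-unique : IsPartition μ → IsPartition ν → Adds i λ' μ → Adds i λ' ν → μ ≡ ν
    adds-unique pμ pν A B = rim-injective pμ pν λ k → trans (adds⇒bump A k) (sym (adds⇒bump B k))

    removes-unique : IsPartition μ → IsPartition ν → Adds i μ λ' → Adds i ν λ' → μ ≡ ν
    removes-unique pμ pν A B = rim-injective pμ pν λ k →
      ℕ.+-cancelˡ-≡ (bump i k) _ _ (trans (sym (adds⇒bump A k)) (adds⇒bump B k))

  module _ {i j : ℤ} (i≢j : i ≢ j) where

    -- The two steps that decide about i keep their kind unless they are end steps of the strip of
    -- j. Equal heads or equal bases are excluded by i ≠ j, and a head meeting a base would be a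
    -- step that is both flat and a drop.
    canAdd-after : ∀ {λ' μ κ} → IsPartition λ' → IsPartition μ → IsPartition κ →
                   Adds j λ' μ → Adds i λ' κ → CanAdd i μ
    canAdd-after {λ'} pλ pμ pκ J I with adds⇒canAdd pλ pμ J | adds⇒canAdd pλ pκ I
    ... | canAdd fj dj | canAdd fi di = canAdd
      (flat-up J i≢j (λ { refl → flat∧drop λ' _ fi dj }) fi)
      (drop-up J (λ { refl → flat∧drop λ' _ fj di }) (i≢j ∘ base-injective) di)

    canRemove-after : ∀ {κ μ π} → IsPartition κ → IsPartition μ → IsPartition π →
                      Adds i μ π → Adds j κ π → CanRemove j μ
    canRemove-after {π = π} pκ pμ pπ I J with adds⇒canRemove pμ pπ I | adds⇒canRemove pκ pπ J
    ... | canRemove di fi | canRemove dj fj = canRemove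
      (drop-down I (i≢j ∘ sym) (λ { refl → flat∧drop π _ fi dj }) dj)
      (flat-down I (λ { refl → flat∧drop π _ fj di }) (i≢j ∘ sym ∘ base-injective) fj)

  module _ {i j : ℤ} {λ' μ κ π : Partition} (J : Adds j λ' μ) (I′ : Adds i μ π) where

    -- Strips add up in the rim, so the fourth side of a square of moves follows from the other
    -- three.
    top-right : Adds i λ' κ → Adds j κ π
    top-right I = bump⇒adds λ k → begin
      rim π k ≡⟨ adds⇒bump I′ k ⟩
      bump i k ℕ.+ rim μ k ≡⟨ cong (bump i k ℕ.+_) (adds⇒bump J k) ⟩
      bump i k ℕ.+ (bump j k ℕ.+ rim λ' k) ≡⟨ x∙yz≈y∙xz (bump i k) (bump j k) (rim λ' k) ⟩
      bump j k ℕ.+ (bump i k ℕ.+ rim λ' k) ≡⟨ cong (bump j k ℕ.+_) (sym (adds⇒bump I k)) ⟩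
      bump j k ℕ.+ rim κ k ∎
      where open ≡-Reasoning

    bottom-right : Adds j κ π → Adds i λ' κ
    bottom-right J′ = bump⇒adds λ k → ℕ.+-cancelˡ-≡ (bump j k) _ _ (begin
      bump j k ℕ.+ rim κ k ≡⟨ sym (adds⇒bump J′ k) ⟩
      rim π k ≡⟨ adds⇒bump I′ k ⟩
      bump i k ℕ.+ rim μ k ≡⟨ cong (bump i k ℕ.+_) (adds⇒bump J k) ⟩
      bump i k ℕ.+ (bump j k ℕ.+ rim λ' k) ≡⟨ x∙yz≈y∙xz (bump i k) (bump j k) (rim λ' k) ⟩
      bump j k ℕ.+ (bump i k ℕ.+ rim λ' k) ∎)
      where open ≡-Reasoning

  -- Both sides ask for tail i ≤ j ≤ i. This symmetry makes the total spin independent of the order: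
  -- what one ribbon gains from the presence of the other, the other loses.
  bump-tail-symmetric : ∀ i j → bump j (tail i) ≡ bump i j
  bump-tail-symmetric i j = bump-cong (λ (tj≤ti , ti≤j) → ti≤j , tail-cancel-≤ tj≤ti) (λ (ti≤j , j≤i) → tail-mono-≤ j≤i , ti≤j)

  ∸-square : ∀ {a b c d x y} → b ℕ.≤ a → d ℕ.≤ c → y ℕ.+ b ℕ.≤ x ℕ.+ a → x ℕ.+ d ℕ.≤ y ℕ.+ c →
             (x ℕ.+ a ∸ (y ℕ.+ b)) ℕ.+ (y ℕ.+ c ∸ (x ℕ.+ d)) ≡ (a ∸ b) ℕ.+ (c ∸ d)
  ∸-square {a} {b} {c} {d} {x} {y} b≤a d≤c yb≤xa xd≤yc = ℕ.+-cancelʳ-≡ (y ℕ.+ b ℕ.+ (x ℕ.+ d)) _ _ (begin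
    (x ℕ.+ a ∸ (y ℕ.+ b)) ℕ.+ (y ℕ.+ c ∸ (x ℕ.+ d)) ℕ.+ (y ℕ.+ b ℕ.+ (x ℕ.+ d))
      ≡⟨ interchange (x ℕ.+ a ∸ (y ℕ.+ b)) _ (y ℕ.+ b) _ ⟩
    (x ℕ.+ a ∸ (y ℕ.+ b) ℕ.+ (y ℕ.+ b)) ℕ.+ (y ℕ.+ c ∸ (x ℕ.+ d) ℕ.+ (x ℕ.+ d))
      ≡⟨ cong₂ ℕ._+_ (ℕ.m∸n+n≡m yb≤xa) (ℕ.m∸n+n≡m xd≤yc) ⟩
    x ℕ.+ a ℕ.+ (y ℕ.+ c) ≡⟨ cong₂ (λ a c → x ℕ.+ a ℕ.+ (y ℕ.+ c)) (sym (ℕ.m∸n+n≡m b≤a)) (sym (ℕ.m∸n+n≡m d≤c)) ⟩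
    x ℕ.+ (a ∸ b ℕ.+ b) ℕ.+ (y ℕ.+ (c ∸ d ℕ.+ d)) ≡⟨ rearrange x y b d (a ∸ b) (c ∸ d) ⟩
    (a ∸ b) ℕ.+ (c ∸ d) ℕ.+ (y ℕ.+ b ℕ.+ (x ℕ.+ d)) ∎)
    where
    open ≡-Reasoning
    rearrange : ∀ x y b d s t → x ℕ.+ (s ℕ.+ b) ℕ.+ (y ℕ.+ (t ℕ.+ d)) ≡ s ℕ.+ t ℕ.+ (y ℕ.+ b ℕ.+ (x ℕ.+ d))
    rearrange = ℕ-solve-∀

  width-square : ∀ {i j λ' μ κ} → IsPartition λ' → IsPartition μ → IsPartition κ →
                 Adds j λ' μ → Adds i λ' κ →
                 rimWidth i μ ℕ.+ rimWidth j κ ≡ rimWidth i λ' ℕ.+ rimWidth j λ'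
  width-square {i} {j} {λ'} {μ} {κ} (_ , dλ) (_ , dμ) (_ , dκ) J I = begin
    (rim μ (tail i) ∸ rim μ i) ℕ.+ (rim κ (tail j) ∸ rim κ j) ≡⟨ cong₂ ℕ._+_ (cong₂ _∸_ e₁ e₂) (cong₂ _∸_ e₃ e₄) ⟩
    (x ℕ.+ rim λ' (tail i) ∸ (y ℕ.+ rim λ' i)) ℕ.+ (y ℕ.+ rim λ' (tail j) ∸ (x ℕ.+ rim λ' j))
      ≡⟨ ∸-square (rim-antitone dλ (tail≤ i)) (rim-antitone dλ (tail≤ j))
           (subst₂ ℕ._≤_ e₂ e₁ (rim-antitone dμ (tail≤ i))) (subst₂ ℕ._≤_ e₄ e₃ (rim-antitone dκ (tail≤ j))) ⟩
    (rim λ' (tail i) ∸ rim λ' i) ℕ.+ (rim λ' (tail j) ∸ rim λ' j) ∎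
    where
    open ≡-Reasoning
    x y : ℕ
    x = bump i j
    y = bump j i
    e₁ : rim μ (tail i) ≡ x ℕ.+ rim λ' (tail i)
    e₁ = trans (adds⇒bump J (tail i)) (cong (ℕ._+ rim λ' (tail i)) (bump-tail-symmetric i j))
    e₂ = adds⇒bump J i
    e₃ : rim κ (tail j) ≡ y ℕ.+ rim λ' (tail j)
    e₃ = trans (adds⇒bump I (tail j)) (cong (ℕ._+ rim λ' (tail j)) (bump-tail-symmetric j i))
    e₄ = adds⇒bump I j

  -- The number of descending steps of the boundary on the n diagonals tail i, …, i;
  -- it is 0 far to the right and n far to the left.
  weight : ℤ → Partition → ℕ
  weight i λ' = rim λ' (tail i) ∸ rim λ' (ℤ.suc i)

  drop-tail : ∀ k λ' → Drop λ' (base k) → rim λ' (base k) ≡ suc (rim λ' (tail k))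
  drop-tail k λ' d = trans d (cong (suc ∘ rim λ') (suc-base k))

  flat-tail : ∀ k λ' → Flat λ' (base k) → rim λ' (base k) ≡ rim λ' (tail k)
  flat-tail k λ' f = trans f (cong (rim λ') (suc-base k))

  rim-tail-lower : ∀ k λ' → rim λ' (tail k) ≡ rim λ' (base (ℤ.suc k))
  rim-tail-lower k λ' = cong (rim λ') (sym (base-suc k))

  module _ {k : ℤ} {λ' : Partition} (λ-partition : IsPartition λ') where

    private i = ℤ.suc k

    -- Here and in the next three lemmas: with w = `rimWidth i λ'`, the pair λ, λ plus ribbon has
    -- weights w and w + 1 at i, and w + 1 and w at i - 1. The exchange of a single diagonal rests
    -- on this swap.
    weight-head-canAdd : CanAdd i λ' → weight i λ' ≡ rimWidth i λ'
    weight-head-canAdd (canAdd f d) = cong (rim λ' (tail i) ∸_) (sym f)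

    weight-base-canAdd : CanAdd i λ' → weight k λ' ≡ suc (rimWidth i λ')
    weight-base-canAdd (canAdd f d) =
      trans (cong (_∸ rim λ' i) (trans (rim-tail-lower k λ') (drop-tail i λ' d)))
        (ℕ.+-∸-assoc 1 (rim-antitone (proj₂ λ-partition) (tail≤ i)))

    weight-head-added : ∀ {μ} → IsPartition μ → Adds i λ' μ → weight i μ ≡ suc (rimWidth i λ')
    weight-head-added {μ} μ-partition A =
      trans (cong₂ _∸_ (trans (adds⇒bump A (tail i)) (cong (ℕ._+ rim λ' (tail i)) (bump-tail i)))
                       (trans (adds⇒bump A (ℤ.suc i)) (cong (ℕ._+ rim λ' (ℤ.suc i)) (bump-suc-head i))))
        (trans (cong (suc (rim λ' (tail i)) ∸_) (sym (CanAdd.head-flat (adds⇒canAdd λ-partition μ-partition A))))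
          (ℕ.+-∸-assoc 1 (rim-antitone (proj₂ λ-partition) (tail≤ i))))

    weight-base-added : ∀ {μ} → IsPartition μ → Adds i λ' μ → weight k μ ≡ rimWidth i λ'
    weight-base-added {μ} μ-partition A =
      cong₂ _∸_ (trans (rim-tail-lower k μ) (trans (adds⇒bump A (base i))
                  (trans (cong (ℕ._+ rim λ' (base i)) (bump-base i))
                    (drop-tail i λ' (CanAdd.base-drop (adds⇒canAdd λ-partition μ-partition A))))))
                (trans (adds⇒bump A i) (cong (ℕ._+ rim λ' i) (bump-head i)))

    -- Moving the window from i - 1 to i loses the step after `base i` and gains the step after i.
    -- If no ribbon can be added or removed, these are of the same kind.
    weight-constant : ¬ CanAdd i λ' → ¬ CanRemove i λ' → weight i λ' ≡ weight k λ'
    weight-constant ¬add ¬remove with flat⊎drop λ-partition i | flat⊎drop λ-partition (base i)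
    ... | inj₁ f | inj₂ d = contradiction (canAdd f d) ¬add
    ... | inj₂ d | inj₁ f = contradiction (canRemove d f) ¬remove
    ... | inj₁ f | inj₁ f′ = cong₂ _∸_ (sym (trans (rim-tail-lower k λ') (flat-tail i λ' f′))) (sym f)
    ... | inj₂ d | inj₂ d′ = sym (cong₂ _∸_ (trans (rim-tail-lower k λ') (drop-tail i λ' d′)) d)

  weight-right : ∀ {λ'} i → IsPartition λ' → + size λ' ℤ.≤ tail i → weight i λ' ≡ 0
  weight-right {λ'} i (_ , ds) s≤t = trans (cong (_∸ rim λ' (ℤ.suc i)) (ℕ.n≤0⇒n≡0
    (subst (rim λ' (tail i) ℕ.≤_) (rim-right ds (part≤size λ')) (rim-antitone ds s≤t)))) (ℕ.0∸n≡0 (rim λ' (ℤ.suc i)))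

  weight-left : ∀ {λ'} t → IsPartition λ' → size λ' ℕ.≤ t → weight -[1+ t ] λ' ≡ suc m
  weight-left {λ'} t (pos , ds) s≤t = trans (cong₂ _∸_
    (trans (cong (rim λ') (sym (ℤ.neg-distrib-+ (+ suc t) (+ m))))
      (rim-left ds (suc t ℕ.+ m) (ℕ.≤-trans l≤t (ℕ.≤-trans (ℕ.n≤1+n t) (ℕ.m≤m+n (suc t) m)))))
    (trans (cong (rim λ') (ℤ.1-[1+n]≡-n t)) (rim-left ds t l≤t)))
    (trans (cong (_∸ t) (sym (ℕ.+-suc t m))) (ℕ.m+n∸m≡n t (suc m)))
    where
    l≤t : length λ' ℕ.≤ t
    l≤t = ℕ.≤-trans (length≤size pos) s≤t

  data State (i : ℤ) (λ' : Partition) : Set where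
    grows : ∀ {μ} → IsPartition μ → Adds i λ' μ → State i λ'
    shrinks : ∀ {μ} → IsPartition μ → Adds i μ λ' → State i λ'
    neither : ¬ CanAdd i λ' → ¬ CanRemove i λ' → State i λ'

  -- The steps after i and after `base i` decide: of their four combinations one allows adding, one
  -- removing, and two neither.
  state : ∀ {λ'} → IsPartition λ' → ∀ i → State i λ'
  state {λ'} pλ i with flat⊎drop pλ i | flat⊎drop pλ (base i)
  ... | inj₁ f | inj₂ d = let _ , pμ , A = add pλ (canAdd f d) in grows pμ A
  ... | inj₂ d | inj₁ f = let _ , pμ , A = remove pλ (canRemove d f) in shrinks pμ A
  ... | inj₁ f | inj₁ f′ = neither (λ { (canAdd _ d) → flat∧drop λ' _ f′ d }) λ { (canRemove d _) → flat∧drop λ' _ f d }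
  ... | inj₂ d | inj₂ d′ = neither (λ { (canAdd f _) → flat∧drop λ' _ f d }) λ { (canRemove _ f) → flat∧drop λ' _ f d′ }

-- The values of the operators on partitions

module Operators {c ℓ : Level} (R : CommutativeRing c ℓ) (q : CommutativeRing.Carrier R) (m : ℕ) where

  open CommutativeRing R
    using (Carrier; _≈_; _+_; _*_; +-cong; +-congˡ; +-congʳ; *-congˡ; commutativeSemiring)
    renaming (refl to ≈-refl; sym to ≈-sym; trans to ≈-trans; setoid to ≈-setoid)
  open Interaction m public
  open Fock R q (suc m) public
  open SemiringSolver commutativeSemiring using (solve; _:=_; _:+_; _:*_)
  module ≈-Reasoning = SetoidReasoning ≈-setoid

  module Additions (λ' : Partition) = Tagged (isRibbon (suc m) λ') (headDiag λ') (partitions (size λ' ℕ.+ suc m))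
  module Removals (λ' : Partition) =
    Tagged (λ ν → isRibbon (suc m) ν λ') (λ ν → headDiag ν λ') (partitions (size λ' ∸ suc m))

  module _ {i : ℤ} {λ' μ : Partition} (λ-partition : IsPartition λ') (μ-partition : IsPartition μ) (A : Adds i λ' μ) where

    open Added λ-partition μ-partition A

    -- The enumeration filtered by `u` has no repetitions, and a ribbon with head on i determines
    -- the rim of its outer partition, so exactly one entry survives.
    u-some : u i λ' ≡ [ (pow q (rimWidth i λ') , μ) ]
    u-some = trans (cong (map _) (Additions.at-some λ' (partsBounded-unique k k k)
        (subst (λ s → μ ∈ partitions s) size-ribbon (∈-partitions⁺ μ-partition)) isRibbon⁺ headDiag≡
        λ { ν∈ rib refl → let pν = proj₁ (∈-partitions⁻ k ν∈) in
              adds-unique λ-partition pν μ-partition (Classify.isRibbon⇒adds-head m λ-partition pν rib) A }))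
      (cong (λ s → [ (pow q s , μ) ]) spin≡)
      where k = size λ' ℕ.+ suc m

    d-some : d i μ ≡ [ (pow q (rimWidth i λ') , λ') ]
    d-some = trans (cong (map _) (Removals.at-some μ (partsBounded-unique k k k)
        (subst (λ s → λ' ∈ partitions s) (sym (trans (cong (_∸ suc m) size-ribbon) (ℕ.m+n∸n≡m (size λ') (suc m))))
          (∈-partitions⁺ λ-partition)) isRibbon⁺ headDiag≡
        λ { ν∈ rib refl → let pν = proj₁ (∈-partitions⁻ k ν∈) in
              removes-unique μ-partition pν λ-partition (Classify.isRibbon⇒adds-head m pν μ-partition rib) A }))
      (cong (λ s → [ (pow q s , λ') ]) spin≡)
      where k = size μ ∸ suc m

  module _ {i : ℤ} {λ' : Partition} (λ-partition : IsPartition λ') where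

    u-none : ¬ CanAdd i λ' → u i λ' ≡ []
    u-none ¬add = cong (map _) (Additions.at-none λ' λ
      { ν∈ rib refl → let pν = proj₁ (∈-partitions⁻ (size λ' ℕ.+ suc m) ν∈) in
          ¬add (adds⇒canAdd λ-partition pν (Classify.isRibbon⇒adds-head m λ-partition pν rib)) })

    d-none : ¬ CanRemove i λ' → d i λ' ≡ []
    d-none ¬remove = cong (map _) (Removals.at-none λ' λ
      { ν∈ rib refl → let pν = proj₁ (∈-partitions⁻ (size λ' ∸ suc m) ν∈) in
          ¬remove (adds⇒canRemove pν λ-partition (Classify.isRibbon⇒adds-head m pν λ-partition rib)) })

    addable⇒canAdd : i ∈ map proj₁ (addable λ') → CanAdd i λ'
    addable⇒canAdd i∈ with ∈-map⁻ proj₁ i∈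
    ... | (_ , ν) , e∈ , refl with Additions.∈-tagged⁻ λ' e∈
    ...   | ν∈ , rib , refl = let pν = proj₁ (∈-partitions⁻ (size λ' ℕ.+ suc m) ν∈) in
              adds⇒canAdd λ-partition pν (Classify.isRibbon⇒adds-head m λ-partition pν rib)

    removable⇒canRemove : i ∈ map proj₁ (removable λ') → CanRemove i λ'
    removable⇒canRemove i∈ with ∈-map⁻ proj₁ i∈
    ... | (_ , ν) , e∈ , refl with Removals.∈-tagged⁻ λ' e∈
    ...   | ν∈ , rib , refl = let pν = proj₁ (∈-partitions⁻ (size λ' ∸ suc m) ν∈) in
              adds⇒canRemove pν λ-partition (Classify.isRibbon⇒adds-head m pν λ-partition rib)

  -- `Ucoef` sums over heads of addable ribbons only, whereas the factors of U(x) run over all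
  -- integers; this bridges the two.
  u-support : ∀ {i λ'} → i ∉ map proj₁ (addable λ') → u i λ' ≡ []
  u-support {i} {λ'} i∉ = cong (map _) (empty λ {e} e∈ → case ∈-filter⁻ _ {xs = addable λ'} e∈ of λ
    { (e∈′ , t) → i∉ (subst (_∈ map proj₁ (addable λ')) (toWitness {a? = proj₁ e ℤ.≟ i} t) (∈-map⁺ proj₁ e∈′)) })

  d-support : ∀ {i λ'} → i ∉ map proj₁ (removable λ') → d i λ' ≡ []
  d-support {i} {λ'} i∉ = cong (map _) (empty λ {e} e∈ → case ∈-filter⁻ _ {xs = removable λ'} e∈ of λ
    { (e∈′ , t) → i∉ (subst (_∈ map proj₁ (removable λ')) (toWitness {a? = proj₁ e ℤ.≟ i} t) (∈-map⁺ proj₁ e∈′)) })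

  -- Power series in x and y

  -- f a b is the coefficient of x^a y^b.
  Series : Set c
  Series = ℕ → ℕ → Carrier

  infix 4 _≋_
  _≋_ : Series → Series → Set ℓ
  f ≋ g = ∀ a b → f a b ≈ g a b

  ≋-refl : ∀ {f} → f ≋ f
  ≋-refl a b = ≈-refl

  ≋-sym : ∀ {f g} → f ≋ g → g ≋ f
  ≋-sym e a b = ≈-sym (e a b)

  ≋-trans : ∀ {f g h} → f ≋ g → g ≋ h → f ≋ h
  ≋-trans e e' a b = ≈-trans (e a b) (e' a b)

  -- f + t x g and f + t y g.
  xadd yadd : Carrier → Series → Series → Series
  xadd t g f zero b = f zero b
  xadd t g f (suc a) b = f (suc a) b + t * g a b
  yadd t g f a zero = f a zero
  yadd t g f a (suc b) = f a (suc b) + t * g a b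

  xadd-cong : ∀ t {f f' g g'} → g ≋ g' → f ≋ f' → xadd t g f ≋ xadd t g' f'
  xadd-cong t eg ef zero b = ef zero b
  xadd-cong t eg ef (suc a) b = +-cong (ef (suc a) b) (*-congˡ (eg a b))

  yadd-cong : ∀ t {f f' g g'} → g ≋ g' → f ≋ f' → yadd t g f ≋ yadd t g' f'
  yadd-cong t eg ef a zero = ef a zero
  yadd-cong t eg ef a (suc b) = +-cong (ef a (suc b)) (*-congˡ (eg a b))

  -- f / (1 - w x y), computed from h = f + w x y h.
  geo : Carrier → Series → Series
  geo w f zero b = f zero b
  geo w f (suc a) zero = f (suc a) zero
  geo w f (suc a) (suc b) = f (suc a) (suc b) + w * geo w f a b

  geo-cong : ∀ w {f g} → f ≋ g → geo w f ≋ geo w g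
  geo-cong w e zero b = e zero b
  geo-cong w e (suc a) zero = e (suc a) zero
  geo-cong w e (suc a) (suc b) = +-cong (e (suc a) (suc b)) (*-congˡ (geo-cong w e a b))

  module _ (w t : Carrier) where

    private
      rearrange : ∀ x y z v → x + t * y + w * (z + t * v) ≈ x + w * z + t * (y + w * v)
      rearrange x y z v = solve 6 (λ x y z v w t →
        x :+ t :* y :+ w :* (z :+ t :* v) := x :+ w :* z :+ t :* (y :+ w :* v)) ≈-refl x y z v w t

      rearrange₀ : ∀ x y z → x + t * y + w * z ≈ x + w * z + t * y
      rearrange₀ x y z = solve 5 (λ x y z w t → x :+ t :* y :+ w :* z := x :+ w :* z :+ t :* y) ≈-refl x y z w t

    geo-xadd : ∀ g f → geo w (xadd t g f) ≋ xadd t (geo w g) (geo w f)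
    geo-xadd g f zero b = ≈-refl
    geo-xadd g f (suc zero) zero = ≈-refl
    geo-xadd g f (suc (suc a)) zero = ≈-refl
    geo-xadd g f (suc zero) (suc b) = rearrange₀ _ _ _
    geo-xadd g f (suc (suc a)) (suc b) = ≈-trans (+-congˡ (*-congˡ (geo-xadd g f (suc a) b))) (rearrange _ _ _ _)

    geo-yadd : ∀ g f → geo w (yadd t g f) ≋ yadd t (geo w g) (geo w f)
    geo-yadd g f zero zero = ≈-refl
    geo-yadd g f zero (suc b) = ≈-refl
    geo-yadd g f (suc a) zero = ≈-refl
    geo-yadd g f (suc a) (suc zero) = ≈-trans (+-congˡ (*-congˡ (geo-yadd g f a zero))) (rearrange₁ a)
      where
      rearrange₁ : ∀ a → f (suc a) 1 + t * g (suc a) 0 + w * geo w f a 0 ≈ f (suc a) 1 + w * geo w f a 0 + t * g (suc a) 0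
      rearrange₁ a = rearrange₀ _ _ _
    geo-yadd g f (suc a) (suc (suc b)) = ≈-trans (+-congˡ (*-congˡ (geo-yadd g f a (suc b)))) (rearrange _ _ _ _)

  -- f times ∏_{j<k} 1 / (1 - q^{2j} x y). The square is written as a product to match the `t * t`
  -- that arises when a ribbon is added and removed again.
  geos : ℕ → Series → Series
  geos zero f = f
  geos (suc k) f = geo (pow q k * pow q k) (geos k f)

  geos-cong : ∀ k {f g} → f ≋ g → geos k f ≋ geos k g
  geos-cong zero e = e
  geos-cong (suc k) e = geo-cong _ (geos-cong k e)

  geos-xadd : ∀ k t g f → geos k (xadd t g f) ≋ xadd t (geos k g) (geos k f)
  geos-xadd zero t g f = ≋-refl
  geos-xadd (suc k) t g f = ≋-trans (geo-cong _ (geos-xadd k t g f)) (geo-xadd _ t (geos k g) (geos k f))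

  geos-yadd : ∀ k t g f → geos k (yadd t g f) ≋ yadd t (geos k g) (geos k f)
  geos-yadd zero t g f = ≋-refl
  geos-yadd (suc k) t g f = ≋-trans (geo-cong _ (geos-yadd k t g f)) (geo-yadd _ t (geos k g) (geos k f))

  -- Both sides agree because f + t² x y h = h; the series g is only carried along.
  geo-step-x : ∀ t g f {h} → h ≋ geo (t * t) f → xadd t (yadd t h g) f ≋ xadd t g h
  geo-step-x t g f e zero b = ≈-sym (e zero b)
  geo-step-x t g f e (suc a) zero = +-congʳ (≈-sym (e (suc a) zero))
  geo-step-x t g f {h} e (suc a) (suc b) = begin
    f (suc a) (suc b) + t * (g a (suc b) + t * h a b)
      ≈⟨ solve 4 (λ x t y z → x :+ t :* (y :+ t :* z) := x :+ t :* t :* z :+ t :* y) ≈-refl _ _ _ _ ⟩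
    f (suc a) (suc b) + t * t * h a b + t * g a (suc b) ≈⟨ +-congʳ (+-congˡ (*-congˡ (e a b))) ⟩
    f (suc a) (suc b) + t * t * geo (t * t) f a b + t * g a (suc b) ≈⟨ +-congʳ (≈-sym (e (suc a) (suc b))) ⟩
    h (suc a) (suc b) + t * g a (suc b) ∎
    where open ≈-Reasoning

  geo-step-y : ∀ t g f {h} → h ≋ geo (t * t) f → yadd t (xadd t h g) f ≋ yadd t g h
  geo-step-y t g f e zero zero = ≈-sym (e zero zero)
  geo-step-y t g f e zero (suc b) = +-congʳ (≈-sym (e zero (suc b)))
  geo-step-y t g f e (suc a) zero = ≈-sym (e (suc a) zero)
  geo-step-y t g f {h} e (suc a) (suc b) = begin
    f (suc a) (suc b) + t * (g (suc a) b + t * h a b)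
      ≈⟨ solve 4 (λ x t y z → x :+ t :* (y :+ t :* z) := x :+ t :* t :* z :+ t :* y) ≈-refl _ _ _ _ ⟩
    f (suc a) (suc b) + t * t * h a b + t * g (suc a) b ≈⟨ +-congʳ (+-congˡ (*-congˡ (e a b))) ⟩
    f (suc a) (suc b) + t * t * geo (t * t) f a b + t * g (suc a) b ≈⟨ +-congʳ (≈-sym (e (suc a) (suc b))) ⟩
    h (suc a) (suc b) + t * g (suc a) b ∎
    where open ≈-Reasoning

-- Exchanging two single factors

module Commutation {c ℓ : Level} (R : CommutativeRing c ℓ) (q : CommutativeRing.Carrier R) (m : ℕ) where

  open CommutativeRing R
    using (Carrier; _≈_; _+_; _*_; 0#; +-congˡ; *-congˡ; *-congʳ; +-comm; +-identityʳ; *-assoc;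
           *-identityˡ; commutativeSemiring)
    renaming (refl to ≈-refl; sym to ≈-sym; trans to ≈-trans; reflexive to ≈-reflexive)
  open Operators R q m public
  open SemiringSolver commutativeSemiring using (solve; _:=_; _:+_; _:*_)

  -- The linear extension of g to formal combinations; it replaces a normal form for vectors.
  pair : (Partition → Carrier) → Vect → Carrier
  pair g [] = 0#
  pair g ((w , ν) ∷ v) = w * g ν + pair g v

  pair-≡singleton : ∀ g {v w ν} → v ≡ [ (w , ν) ] → pair g v ≈ w * g ν
  pair-≡singleton g refl = +-identityʳ _

  pair-≡[] : ∀ g {v} → v ≡ [] → pair g v ≈ 0#
  pair-≡[] g refl = ≈-refl

  Functional : Set c
  Functional = Partition → Series

  -- Precomposition with 1 + x u_i and 1 + y d_i.
  Eu Ed : ℤ → Functional → Functional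
  Eu i φ ν zero b = φ ν zero b
  Eu i φ ν (suc a) b = φ ν (suc a) b + pair (λ κ → φ κ a b) (u i ν)
  Ed i φ ν a zero = φ ν a zero
  Ed i φ ν a (suc b) = φ ν a (suc b) + pair (λ κ → φ κ a b) (d i ν)

  -- The diagonal operator multiplying the coefficient at ν by ∏_{j < weight i ν} 1 / (1 - q^{2j} x y).
  X : ℤ → Functional → Functional
  X i φ ν = geos (weight i ν) (φ ν)

  spinPow : ℤ → Partition → Carrier
  spinPow i λ' = pow q (rimWidth i λ')

  module _ {i : ℤ} {λ' μ : Partition} (φ : Functional) (pλ : IsPartition λ') (pμ : IsPartition μ) (A : Adds i λ' μ) where

    Eu-some : Eu i φ λ' ≋ xadd (spinPow i λ') (φ μ) (φ λ')
    Eu-some zero b = ≈-refl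
    Eu-some (suc a) b = +-congˡ (pair-≡singleton (λ κ → φ κ a b) (u-some pλ pμ A))

    Ed-some : Ed i φ μ ≋ yadd (spinPow i λ') (φ λ') (φ μ)
    Ed-some a zero = ≈-refl
    Ed-some a (suc b) = +-congˡ (pair-≡singleton (λ κ → φ κ a b) (d-some pλ pμ A))

  module _ {i : ℤ} {λ' : Partition} (φ : Functional) (pλ : IsPartition λ') where

    Eu-none : ¬ CanAdd i λ' → Eu i φ λ' ≋ φ λ'
    Eu-none ¬add zero b = ≈-refl
    Eu-none ¬add (suc a) b = ≈-trans (+-congˡ (pair-≡[] (λ κ → φ κ a b) (u-none pλ ¬add))) (+-identityʳ _)

    Ed-none : ¬ CanRemove i λ' → Ed i φ λ' ≋ φ λ'
    Ed-none ¬remove a zero = ≈-refl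
    Ed-none ¬remove a (suc b) = ≈-trans (+-congˡ (pair-≡[] (λ κ → φ κ a b) (d-none pλ ¬remove))) (+-identityʳ _)

  canAdd∧canRemove : ∀ {i} λ' → CanAdd i λ' → CanRemove i λ' → ⊥
  canAdd∧canRemove {i} λ' (canAdd f _) (canRemove d _) = flat∧drop λ' i f d

  geos-≡ : ∀ {k l} f → k ≡ l → geos k f ≋ geos l f
  geos-≡ f refl = ≋-refl

  -- ν either admits no move at i, or is the smaller or the larger member of a pair differing by a
  -- ribbon. The weights of the pair bring the last two cases into the form of `geo-step-x` and
  -- `geo-step-y`.
  local : ∀ k φ {ν} → IsPartition ν → let i = ℤ.suc k in
          Eu i (X i (Ed i φ)) ν ≋ Ed i (X k (Eu i φ)) ν
  local k φ {ν} pν with state pν (ℤ.suc k)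
  ... | neither ¬add ¬remove =
    ≋-trans (Eu-none _ pν ¬add) (≋-trans (geos-cong (weight i ν) (Ed-none φ pν ¬remove))
      (≋-trans (geos-≡ (φ ν) (weight-constant {k} pν ¬add ¬remove))
        (≋-sym (≋-trans (Ed-none _ pν ¬remove) (geos-cong (weight k ν) (Eu-none φ pν ¬add))))))
    where i = ℤ.suc k
  ... | grows {μ} pμ A =
    ≋-trans (Eu-some (X i (Ed i φ)) pν pμ A)
    (≋-trans (xadd-cong t
      (≋-trans (geos-≡ _ (weight-head-added {k} pν pμ A))
        (≋-trans (geos-cong (suc w) (Ed-some φ pν pμ A)) (geos-yadd (suc w) t (φ ν) (φ μ))))
      (≋-trans (geos-≡ _ (weight-head-canAdd {k} pν can)) (geos-cong w (Ed-none φ pν ¬remove))))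
    (≋-trans (geo-step-x t (geos (suc w) (φ μ)) (geos w (φ ν)) ≋-refl)
    (≋-sym (≋-trans (Ed-none _ pν ¬remove) (≋-trans (geos-≡ _ (weight-base-canAdd {k} pν can))
      (≋-trans (geos-cong (suc w) (Eu-some φ pν pμ A)) (geos-xadd (suc w) t (φ μ) (φ ν))))))))
    where
    i = ℤ.suc k
    w = rimWidth i ν
    t = pow q w
    can = adds⇒canAdd pν pμ A
    ¬remove = canAdd∧canRemove ν can
  ... | shrinks {κ} pκ A =
    ≋-trans (Eu-none _ pν ¬add) (≋-trans (geos-≡ _ (weight-head-added {k} pκ pν A))
    (≋-trans (geos-cong (suc w) (Ed-some φ pκ pν A)) (≋-trans (geos-yadd (suc w) t (φ κ) (φ ν))
    (≋-trans (≋-sym (geo-step-y t (geos (suc w) (φ κ)) (geos w (φ ν)) ≋-refl))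
    (≋-sym (≋-trans (Ed-some (X k (Eu i φ)) pκ pν A)
      (yadd-cong t
        (≋-trans (geos-≡ _ (weight-base-canAdd {k} pκ can))
          (≋-trans (geos-cong (suc w) (Eu-some φ pκ pν A)) (geos-xadd (suc w) t (φ ν) (φ κ))))
        (≋-trans (geos-≡ _ (weight-base-added {k} pκ pν A)) (geos-cong w (Eu-none φ pν ¬add))))))))))
    where
    i = ℤ.suc k
    w = rimWidth i κ
    t = pow q w
    can = adds⇒canAdd pκ pν A
    ¬add = λ can′ → canAdd∧canRemove ν can′ (adds⇒canRemove pκ pν A)

  pow-+ : ∀ a b → pow q (a ℕ.+ b) ≈ pow q a * pow q b
  pow-+ zero b = ≈-sym (*-identityˡ _)
  pow-+ (suc a) b = ≈-trans (*-congˡ (pow-+ a b)) (≈-sym (*-assoc q _ _))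

  -- The four series sit at the corners of a square of moves. Only the x y term depends on the
  -- order, and the hypothesis equates the total spins of the two orders.
  xadd-yadd : ∀ {s t s' t'} f g h k → t * s' ≈ s * t' →
              xadd t (yadd s' k g) (yadd s h f) ≋ yadd s (xadd t' k h) (xadd t g f)
  xadd-yadd f g h k e zero zero = ≈-refl
  xadd-yadd f g h k e zero (suc b) = ≈-refl
  xadd-yadd f g h k e (suc a) zero = ≈-refl
  xadd-yadd {s} {t} {s'} {t'} f g h k e (suc a) (suc b) = begin
    F + s * H + t * (G + s' * K)
      ≈⟨ solve 7 (λ F H G K s t s' → F :+ s :* H :+ t :* (G :+ s' :* K) := F :+ t :* G :+ (s :* H :+ t :* s' :* K)) ≈-refl F H G K s t s' ⟩
    F + t * G + (s * H + t * s' * K) ≈⟨ +-congˡ (+-congˡ (*-congʳ e)) ⟩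
    F + t * G + (s * H + s * t' * K)
      ≈⟨ solve 7 (λ F H G K s t t' → F :+ t :* G :+ (s :* H :+ s :* t' :* K) := F :+ t :* G :+ s :* (H :+ t' :* K)) ≈-refl F H G K s t t' ⟩
    F + t * G + s * (H + t' * K) ∎
    where
    open ≈-Reasoning
    F = f (suc a) (suc b)
    H = h (suc a) b
    G = g a (suc b)
    K = k a b

  xadd-yadd₀ : ∀ {s t} f g h → xadd t g (yadd s h f) ≋ yadd s h (xadd t g f)
  xadd-yadd₀ f g h zero zero = ≈-refl
  xadd-yadd₀ f g h zero (suc b) = ≈-refl
  xadd-yadd₀ f g h (suc a) zero = ≈-refl
  xadd-yadd₀ {s} {t} f g h (suc a) (suc b) =
    solve 5 (λ F G H s t → F :+ s :* H :+ t :* G := F :+ t :* G :+ s :* H) ≈-refl _ _ _ s t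

  canAdd? : ∀ {λ'} → IsPartition λ' → ∀ i → (∃ λ μ → IsPartition μ × Adds i λ' μ) ⊎ ¬ CanAdd i λ'
  canAdd? {λ'} pλ i with state pλ i
  ... | grows pμ A = inj₁ (_ , pμ , A)
  ... | shrinks pκ A = inj₂ λ can → canAdd∧canRemove λ' can (adds⇒canRemove pκ pλ A)
  ... | neither ¬add _ = inj₂ ¬add

  canRemove? : ∀ {λ'} → IsPartition λ' → ∀ i → (∃ λ κ → IsPartition κ × Adds i κ λ') ⊎ ¬ CanRemove i λ'
  canRemove? {λ'} pλ i with state pλ i
  ... | grows pμ A = inj₂ (canAdd∧canRemove λ' (adds⇒canAdd pλ pμ A))
  ... | shrinks pκ A = inj₁ (_ , pκ , A)
  ... | neither _ ¬remove = inj₂ ¬remove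

  -- A move that is impossible at ν remains so after the other one. If both are possible, the fourth
  -- corner of the square is reached in both orders or in neither.
  Eu-Ed : ∀ {i j} → i ≢ j → ∀ φ {ν} → IsPartition ν → Eu i (Ed j φ) ν ≋ Ed j (Eu i φ) ν
  Eu-Ed {i} {j} i≢j φ {ν} pν with canAdd? pν i | canRemove? pν j
  ... | inj₂ ¬add | inj₂ ¬remove =
    ≋-trans (Eu-none _ pν ¬add) (≋-trans (Ed-none φ pν ¬remove)
      (≋-sym (≋-trans (Ed-none _ pν ¬remove) (Eu-none φ pν ¬add))))
  ... | inj₁ (π , pπ , I) | inj₂ ¬remove =
    ≋-trans (Eu-some (Ed j φ) pν pπ I) (≋-trans
      (xadd-cong _ (Ed-none φ pπ λ can → let κ , pκ , J = remove pπ can in ¬remove (canRemove-after i≢j pκ pν pπ I J))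
                   (Ed-none φ pν ¬remove))
      (≋-sym (≋-trans (Ed-none _ pν ¬remove) (Eu-some φ pν pπ I))))
  ... | inj₂ ¬add | inj₁ (λ' , pλ , J) =
    ≋-trans (Eu-none _ pν ¬add) (≋-trans (Ed-some φ pλ pν J)
      (≋-sym (≋-trans (Ed-some (Eu i φ) pλ pν J) (yadd-cong _
        (Eu-none φ pλ λ can → let κ , pκ , I = add pλ can in ¬add (canAdd-after i≢j pλ pν pκ J I))
        (Eu-none φ pν ¬add)))))
  ... | inj₁ (π , pπ , I) | inj₁ (λ' , pλ , J) with canAdd? pλ i
  ...   | inj₁ (κ , pκ , I′) =
    ≋-trans (Eu-some (Ed j φ) pν pπ I)
    (≋-trans (xadd-cong _ (Ed-some φ pκ pπ (top-right J I I′)) (Ed-some φ pλ pν J))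
    (≋-trans (xadd-yadd (φ ν) (φ π) (φ λ') (φ κ) spins)
    (≋-sym (≋-trans (Ed-some (Eu i φ) pλ pν J) (yadd-cong _ (Eu-some φ pλ pκ I′) (Eu-some φ pν pπ I))))))
    where
    spins : spinPow i ν * spinPow j κ ≈ spinPow j λ' * spinPow i λ'
    spins = ≈-trans (≈-sym (pow-+ (rimWidth i ν) _)) (≈-trans
      (≈-reflexive (cong (pow q) (trans (width-square pλ pν pκ J I′) (ℕ.+-comm (rimWidth i λ') (rimWidth j λ')))))
      (pow-+ (rimWidth j λ') _))
  ...   | inj₂ ¬add =
    ≋-trans (Eu-some (Ed j φ) pν pπ I)
    (≋-trans (xadd-cong _ (Ed-none φ pπ (λ can → let κ , pκ , J′ = remove pπ can in
                              ¬add (adds⇒canAdd pλ pκ (bottom-right J I J′))))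
                          (Ed-some φ pλ pν J))
    (≋-trans (xadd-yadd₀ (φ ν) (φ π) (φ λ'))
    (≋-sym (≋-trans (Ed-some (Eu i φ) pλ pν J) (yadd-cong _ (Eu-none φ pλ ¬add) (Eu-some φ pν pπ I))))))

-- W bounds the size of the partitions reached from ν when the coefficient of x^a is
-- expanded, so that only finitely many of the factors matter.

module Chain {c ℓ : Level} (R : CommutativeRing c ℓ) (q : CommutativeRing.Carrier R) (m W : ℕ) where

  open CommutativeRing R
    using (_≈_; _+_; _*_; +-cong; *-congˡ; +-assoc; +-identityʳ)
    renaming (refl to ≈-refl; sym to ≈-sym; trans to ≈-trans)
  open Commutation R q m public

  infix 4 _∼_
  -- The bound is stable under both moves: an added ribbon spends one power of x for its n boxes,
  -- and a removal only lowers the size.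
  _∼_ : Functional → Functional → Set ℓ
  φ ∼ ψ = ∀ ν a b → IsPartition ν → size ν ℕ.+ suc m ℕ.* a ℕ.≤ W → φ ν a b ≈ ψ ν a b

  ∼-refl : ∀ {φ} → φ ∼ φ
  ∼-refl ν a b _ _ = ≈-refl

  ∼-sym : ∀ {φ ψ} → φ ∼ ψ → ψ ∼ φ
  ∼-sym e ν a b p le = ≈-sym (e ν a b p le)

  ∼-trans : ∀ {φ ψ χ} → φ ∼ ψ → ψ ∼ χ → φ ∼ χ
  ∼-trans e e' ν a b p le = ≈-trans (e ν a b p le) (e' ν a b p le)

  exact : ∀ {φ ψ} → (∀ {ν} → IsPartition ν → φ ν ≋ ψ ν) → φ ∼ ψ
  exact e ν a b p _ = e p a b

  Eu-cong : ∀ i {φ ψ} → φ ∼ ψ → Eu i φ ∼ Eu i ψ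
  Eu-cong i e ν zero b p le = e ν zero b p le
  Eu-cong i {φ} {ψ} e ν (suc a) b p le with canAdd? p i
  ... | inj₂ ¬add = ≈-trans (Eu-none φ p ¬add (suc a) b) (≈-trans (e ν (suc a) b p le) (≈-sym (Eu-none ψ p ¬add (suc a) b)))
  ... | inj₁ (μ , pμ , A) = ≈-trans (Eu-some φ p pμ A (suc a) b)
    (≈-trans (+-cong (e ν (suc a) b p le) (*-congˡ (e μ a b pμ (subst (ℕ._≤ W) size-eq le))))
      (≈-sym (Eu-some ψ p pμ A (suc a) b)))
    where
    size-eq : size ν ℕ.+ suc m ℕ.* suc a ≡ size μ ℕ.+ suc m ℕ.* a
    size-eq = trans (cong (size ν ℕ.+_) (ℕ.*-suc (suc m) a)) (trans (sym (ℕ.+-assoc (size ν) (suc m) _))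
      (cong (ℕ._+ suc m ℕ.* a) (sym (Added.size-ribbon p pμ A))))

  Ed-cong : ∀ i {φ ψ} → φ ∼ ψ → Ed i φ ∼ Ed i ψ
  Ed-cong i e ν a zero p le = e ν a zero p le
  Ed-cong i {φ} {ψ} e ν a (suc b) p le with canRemove? p i
  ... | inj₂ ¬remove = ≈-trans (Ed-none φ p ¬remove a (suc b)) (≈-trans (e ν a (suc b) p le) (≈-sym (Ed-none ψ p ¬remove a (suc b))))
  ... | inj₁ (κ , pκ , A) = ≈-trans (Ed-some φ pκ p A a (suc b))
    (≈-trans (+-cong (e ν a (suc b) p le) (*-congˡ (e κ a b pκ (ℕ.≤-trans (ℕ.+-monoˡ-≤ (suc m ℕ.* a) κ≤ν) le))))
      (≈-sym (Ed-some ψ pκ p A a (suc b))))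
    where
    κ≤ν : size κ ℕ.≤ size ν
    κ≤ν = subst (size κ ℕ.≤_) (sym (Added.size-ribbon pκ p A)) (ℕ.m≤m+n (size κ) (suc m))

  module _ {f g : Series} {A : ℕ} where

    -- Multiplication by a series in x y consults only lower powers of x, for which the size bound
    -- holds all the more.
    geo-cong-below : ∀ w → (∀ a b → a ℕ.≤ A → f a b ≈ g a b) → ∀ a b → a ℕ.≤ A → geo w f a b ≈ geo w g a b
    geo-cong-below w e zero b le = e zero b le
    geo-cong-below w e (suc a) zero le = e (suc a) zero le
    geo-cong-below w e (suc a) (suc b) le =
      +-cong (e (suc a) (suc b) le) (*-congˡ (geo-cong-below w e a b (ℕ.≤-trans (ℕ.n≤1+n a) le)))

  geos-cong-below : ∀ k {f g A} → (∀ a b → a ℕ.≤ A → f a b ≈ g a b) → ∀ a b → a ℕ.≤ A → geos k f a b ≈ geos k g a b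
  geos-cong-below zero e = e
  geos-cong-below (suc k) e = geo-cong-below _ (geos-cong-below k e)

  scaled : (Partition → ℕ) → Functional → Functional
  scaled k φ ν = geos (k ν) (φ ν)

  scaled-cong : ∀ k {φ ψ} → φ ∼ ψ → scaled k φ ∼ scaled k ψ
  scaled-cong k e ν a b p le = geos-cong-below (k ν)
    (λ a' b' a'≤a → e ν a' b' p (ℕ.≤-trans (ℕ.+-monoʳ-≤ (size ν) (ℕ.*-monoʳ-≤ (suc m) a'≤a)) le)) a b ℕ.≤-refl

  -- The factors with indices lo + 1, ..., lo + K. The outermost one acts first: the smallest index
  -- for U, the largest for D.
  Eus Eds : ℕ → ℤ → Functional → Functional
  Eus zero lo φ = φ
  Eus (suc K) lo φ = Eu (ℤ.suc lo) (Eus K (ℤ.suc lo) φ)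
  Eds zero lo φ = φ
  Eds (suc K) lo φ = Eds K (ℤ.suc lo) (Ed (ℤ.suc lo) φ)

  high : ℕ → ℤ → ℤ
  high zero lo = lo
  high (suc K) lo = high K (ℤ.suc lo)

  high≡ : ∀ K lo → high K lo ≡ lo ℤ.+ + K
  high≡ zero lo = sym (ℤ.+-identityʳ lo)
  high≡ (suc K) lo = trans (high≡ K (ℤ.suc lo)) (suc-+-suc lo K)

  Eus-cong : ∀ K lo {φ ψ} → φ ∼ ψ → Eus K lo φ ∼ Eus K lo ψ
  Eus-cong zero lo e = e
  Eus-cong (suc K) lo e = Eu-cong _ (Eus-cong K _ e)

  Eds-cong : ∀ K lo {φ ψ} → φ ∼ ψ → Eds K lo φ ∼ Eds K lo ψ
  Eds-cong zero lo e = e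
  Eds-cong (suc K) lo e = Eds-cong K _ (Ed-cong _ e)

  ≤⇒≢suc : ∀ {i lo} → i ℤ.≤ lo → i ≢ ℤ.suc lo
  ≤⇒≢suc i≤lo refl = ℤ.<⇒≱ (i<1+i _) i≤lo

  Eu-Eds : ∀ K {lo i} → i ℤ.≤ lo → ∀ φ → Eu i (Eds K lo φ) ∼ Eds K lo (Eu i φ)
  Eu-Eds zero i≤lo φ = ∼-refl
  Eu-Eds (suc K) {lo} {i} i≤lo φ = ∼-trans (Eu-Eds K (ℤ.≤-trans i≤lo (ℤ.i≤suc[i] lo)) (Ed (ℤ.suc lo) φ))
    (Eds-cong K _ (exact (Eu-Ed (≤⇒≢suc i≤lo) φ)))

  Ed-Eus : ∀ K {lo i} → i ℤ.≤ lo → ∀ φ → Ed i (Eus K lo φ) ∼ Eus K lo (Ed i φ)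
  Ed-Eus zero i≤lo φ = ∼-refl
  Ed-Eus (suc K) {lo} {i} i≤lo φ = ∼-trans
    (exact (λ p → ≋-sym (Eu-Ed (≤⇒≢suc i≤lo ∘ sym) (Eus K (ℤ.suc lo) φ) p)))
    (Eu-cong _ (Ed-Eus K (ℤ.≤-trans i≤lo (ℤ.i≤suc[i] lo)) φ))

  -- Peel off the lowest index i = lo + 1. By induction the factors above i are exchanged and leave
  -- X_i; the u-factor and the d-factor of index i pass the remaining ones, whose indices differ
  -- from i, and `local` turns X_i into X_{i-1}.
  exchange : ∀ K lo φ → Eus K lo (X (high K lo) (Eds K lo φ)) ∼ Eds K lo (X lo (Eus K lo φ))
  exchange zero lo φ = ∼-refl
  exchange (suc K) lo φ =
    ∼-trans (Eu-cong i (exchange K i (Ed i φ)))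
    (∼-trans (Eu-Eds K ℤ.≤-refl (X i (Eus K i (Ed i φ))))
    (Eds-cong K i
      (∼-trans (Eu-cong i (scaled-cong (weight i) (∼-sym (Ed-Eus K ℤ.≤-refl φ))))
        (exact (local lo (Eus K i φ))))))
    where i = ℤ.suc lo

  -- With k independent of the partition, the multiplier is a scalar series.
  Ed-geos : ∀ i k φ → Ed i (scaled (λ _ → k) φ) ∼ scaled (λ _ → k) (Ed i φ)
  Ed-geos i k φ = exact λ p → case canRemove? p i of λ
    { (inj₂ ¬remove) → ≋-trans (Ed-none _ p ¬remove) (geos-cong k (≋-sym (Ed-none φ p ¬remove)))
    ; (inj₁ (κ , pκ , A)) → ≋-trans (Ed-some _ pκ p A)
        (≋-trans (≋-sym (geos-yadd k _ _ _)) (geos-cong k (≋-sym (Ed-some φ pκ p A)))) }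

  Eds-geos : ∀ K lo k φ → Eds K lo (scaled (λ _ → k) φ) ∼ scaled (λ _ → k) (Eds K lo φ)
  Eds-geos zero lo k φ = ∼-refl
  Eds-geos (suc K) lo k φ = ∼-trans (Eds-cong K _ (Ed-geos (ℤ.suc lo) k φ)) (Eds-geos K (ℤ.suc lo) k (Ed (ℤ.suc lo) φ))

-- Boolean filters and comparisons

filterᵇ-cong : {A : Set} {p q : A → Bool} (xs : List A) → (∀ {x} → x ∈ xs → p x ≡ q x) → filterᵇ p xs ≡ filterᵇ q xs
filterᵇ-cong [] e = refl
filterᵇ-cong {p = p} {q} (x ∷ xs) e with p x | q x | e (here refl)
... | true | .true | refl = cong (x ∷_) (filterᵇ-cong xs (e ∘ there))
... | false | .false | refl = filterᵇ-cong xs (e ∘ there)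

filterᵇ-none : {A : Set} (xs : List A) → filterᵇ (λ _ → false) xs ≡ []
filterᵇ-none [] = refl
filterᵇ-none (x ∷ xs) = filterᵇ-none xs

T-ext : ∀ {x y} → (T x → T y) → (T y → T x) → x ≡ y
T-ext {false} {false} _ _ = refl
T-ext {true} {true} _ _ = refl
T-ext {false} {true} _ g = ⊥-elim (g tt)
T-ext {true} {false} f _ = ⊥-elim (f tt)

T⇒≡true : ∀ {x} → T x → x ≡ true
T⇒≡true = Equivalence.to T-≡

¬T⇒≡false : ∀ {x} → ¬ T x → x ≡ false
¬T⇒≡false {true} ¬t = ⊥-elim (¬t tt)
¬T⇒≡false {false} _ = refl

<ℤ⁺ : ∀ {i j} → i ℤ.< j → T (i <ℤ j)
<ℤ⁺ i<j = not⁺ (λ t → ℤ.<⇒≱ i<j (ℤ.≤ᵇ⇒≤ t))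

<ℤ⁻ : ∀ {i j} → T (i <ℤ j) → i ℤ.< j
<ℤ⁻ t = ℤ.≰⇒> (λ j≤i → not⁻ t (ℤ.≤⇒≤ᵇ j≤i))

above-suc : ∀ {lo i} → i ≢ ℤ.suc lo → (lo <ℤ i) ≡ (ℤ.suc lo <ℤ i)
above-suc {lo} {i} i≢ = T-ext
  (λ t → <ℤ⁺ (ℤ.≤∧≢⇒< (ℤ.i<j⇒suc[i]≤j (<ℤ⁻ {lo} {i} t)) (i≢ ∘ sym)))
  (λ t → <ℤ⁺ (ℤ.<-trans (i<1+i lo) (<ℤ⁻ {ℤ.suc lo} {i} t)))

below-suc : ∀ {hi i} → i ≢ hi → (i <ℤ ℤ.suc hi) ≡ (i <ℤ hi)
below-suc {hi} {i} i≢ = T-ext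
  (λ t → <ℤ⁺ (ℤ.≤∧≢⇒< (suc-cancel-≤ (ℤ.i<j⇒suc[i]≤j (<ℤ⁻ {i} {ℤ.suc hi} t))) i≢))
  (λ t → <ℤ⁺ (ℤ.<-trans (<ℤ⁻ {i} {hi} t) (i<1+i hi)))

-- The coefficient sums as products of factors

module Coefficients {c ℓ : Level} (R : CommutativeRing c ℓ) (q : CommutativeRing.Carrier R) (m W : ℕ) where

  open CommutativeRing R
    using (Carrier; _≈_; _+_; _*_; 0#; 1#; +-cong; +-congˡ; +-congʳ; +-assoc; +-comm;
           +-identityˡ; +-identityʳ; *-assoc; *-identityʳ; zeroʳ; distribˡ; commutativeSemiring)
    renaming (refl to ≈-refl; sym to ≈-sym; trans to ≈-trans; reflexive to ≈-reflexive)
  open Chain R q m W public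
  open SemiringSolver commutativeSemiring using (solve; _:=_; _:+_; _:*_)

  sumOver : {A : Set} → (A → Carrier) → List A → Carrier
  sumOver T [] = 0#
  sumOver T (x ∷ xs) = T x + sumOver T xs

  -- p and r differ at j alone. If j is missing from the list, its term vanishes, so it may be split
  -- off in any case.
  sumOver-split : (T : ℤ → Carrier) (p r : ℤ → Bool) (j : ℤ) → (∀ {i} → i ≢ j → p i ≡ r i) →
                  p j ≡ true → r j ≡ false → ∀ xs → Unique xs → (j ∉ xs → T j ≈ 0#) →
                  sumOver T (filterᵇ p xs) ≈ T j + sumOver T (filterᵇ r xs)
  sumOver-split T p r j agree pj rj [] _ support = ≈-sym (≈-trans (+-congʳ (support λ ())) (+-identityʳ 0#))
  sumOver-split T p r j agree pj rj (x ∷ xs) (x∉xs ∷ uniq) support with x ℤ.≟ j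
  ... | yes refl rewrite pj | rj =
    +-congˡ (≈-reflexive (cong (sumOver T) (filterᵇ-cong xs λ {i} i∈ → agree (λ i≡x → All.lookup x∉xs i∈ (sym i≡x)))))
  ... | no x≢j with p x | r x | agree x≢j | sumOver-split T p r j agree pj rj xs uniq
                    (λ j∉xs → support λ { (here j≡x) → x≢j (sym j≡x) ; (there j∈xs) → j∉xs j∈xs })
  ...   | false | .false | refl | ih = ih
  ...   | true | .true | refl | ih = begin
    T x + sumOver T (filterᵇ p xs) ≈⟨ +-congˡ ih ⟩
    T x + (T j + sumOver T (filterᵇ r xs)) ≈⟨ solve 3 (λ a b c → a :+ (b :+ c) := b :+ (a :+ c)) ≈-refl _ _ _ ⟩
    T j + (T x + sumOver T (filterᵇ r xs)) ∎
    where open ≈-Reasoning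

  pair-zero : ∀ v → pair (λ _ → 0#) v ≈ 0#
  pair-zero [] = ≈-refl
  pair-zero ((w , ν) ∷ v) = ≈-trans (+-cong (zeroʳ w) (pair-zero v)) (+-identityʳ 0#)

  pair-++ : ∀ g v w → pair g (v ++ w) ≈ pair g v + pair g w
  pair-++ g [] w = ≈-sym (+-identityˡ _)
  pair-++ g ((t , ν) ∷ v) w = ≈-trans (+-congˡ (pair-++ g v w)) (≈-sym (+-assoc _ _ _))

  pair-concatMap : {A : Set} (g : Partition → Carrier) (f : A → Vect) (xs : List A) →
                   pair g (concatMap f xs) ≈ sumOver (pair g ∘ f) xs
  pair-concatMap g f [] = ≈-refl
  pair-concatMap g f (x ∷ xs) = ≈-trans (pair-++ g (f x) (concatMap f xs)) (+-congˡ (pair-concatMap g f xs))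

  pair-scale : ∀ g t v → pair g (scale t v) ≈ t * pair g v
  pair-scale g t [] = ≈-sym (zeroʳ t)
  pair-scale g t ((w , ν) ∷ v) = ≈-trans (+-cong (*-assoc t w (g ν)) (pair-scale g t v)) (≈-sym (distribˡ t _ _))

  pair-apply : ∀ g f v → pair g (apply f v) ≈ pair (λ ν → pair g (f ν)) v
  pair-apply g f [] = ≈-refl
  pair-apply g f ((w , ν) ∷ v) = ≈-trans (pair-++ g (scale w (f ν)) (apply f v)) (+-cong (pair-scale g w (f ν)) (pair-apply g f v))

  δ : Partition → Partition → Carrier
  δ μ ν = if ⌊ ≡-dec ℕ._≟_ ν μ ⌋ then 1# else 0#

  coeffAt-pair : ∀ μ v → coeffAt μ v ≈ pair (δ μ) v
  coeffAt-pair μ [] = ≈-refl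
  coeffAt-pair μ ((w , ν) ∷ v) with ⌊ ≡-dec ℕ._≟_ ν μ ⌋
  ... | true = +-cong (≈-sym (*-identityʳ w)) (coeffAt-pair μ v)
  ... | false = ≈-trans (coeffAt-pair μ v) (≈-trans (≈-sym (+-identityˡ _)) (+-congʳ (≈-sym (zeroʳ w))))

  uHeads dHeads : Partition → List ℤ
  uHeads ν = deduplicate ℤ._≟_ (map proj₁ (addable ν))
  dHeads ν = deduplicate ℤ._≟_ (map proj₁ (removable ν))

  uHead⇒canAdd : ∀ {ν i} → IsPartition ν → i ∈ uHeads ν → CanAdd i ν
  uHead⇒canAdd {ν} p i∈ = addable⇒canAdd p (∈-deduplicate⁻ ℤ._≟_ (map proj₁ (addable ν)) i∈)

  dHead⇒canRemove : ∀ {ν i} → IsPartition ν → i ∈ dHeads ν → CanRemove i ν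
  dHead⇒canRemove {ν} p i∈ = removable⇒canRemove p (∈-deduplicate⁻ ℤ._≟_ (map proj₁ (removable ν)) i∈)

  -- The pullback of ψ along the part of U(x) with indices above `lo`; the exponent of y is passed
  -- on to ψ. For `𝒟` the roles of x and y are exchanged.
  𝒰 : Maybe ℤ → (Partition → ℕ → Carrier) → Functional
  𝒰 lo ψ ν a b = pair (λ κ → ψ κ b) (Ucoef a lo ν)

  𝒟 : Maybe ℤ → (Partition → ℕ → Carrier) → Functional
  𝒟 hi χ ν a b = pair (λ κ → χ κ a) (Dcoef b hi ν)

  -- The same for an empty product, which contributes no power of its variable.
  constU constD : (Partition → ℕ → Carrier) → Functional
  constU ψ ν zero b = ψ ν b
  constU ψ ν (suc a) b = 0#
  constD χ ν a zero = χ ν a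
  constD χ ν a (suc b) = 0#

  -- `Ucoef` chooses first the index that acts first, the smallest. The terms where it is lo + 1
  -- form the x-part of `Eu`, the others the product above lo + 1.
  𝒰-step : ∀ lo ψ ν → 𝒰 (just lo) ψ ν ≋ Eu (ℤ.suc lo) (𝒰 (just (ℤ.suc lo)) ψ) ν
  𝒰-step lo ψ ν zero b = ≈-refl
  𝒰-step lo ψ ν (suc a) b = begin
    pair g (concatMap f (filterᵇ (above (just lo)) (uHeads ν))) ≈⟨ pair-concatMap g f (filterᵇ (above (just lo)) (uHeads ν)) ⟩
    sumOver (pair g ∘ f) (filterᵇ (above (just lo)) (uHeads ν))
      ≈⟨ sumOver-split (pair g ∘ f) (above (just lo)) (above (just i)) i above-suc
           (T⇒≡true (<ℤ⁺ (i<1+i lo))) (¬T⇒≡false λ t → ℤ.<-irrefl refl (<ℤ⁻ {i} {i} t)) (uHeads ν) (DecUnique.deduplicate-! ℤ._≟_ _)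
           (λ i∉ → pair-≡[] g (cong (apply (Ucoef a (just i))) (u-support {i} {ν} (i∉ ∘ ∈-deduplicate⁺ ℤ._≟_)))) ⟩
    pair g (f i) + sumOver (pair g ∘ f) (filterᵇ (above (just i)) (uHeads ν))
      ≈⟨ +-cong (pair-apply g (Ucoef a (just i)) (u i ν)) (≈-sym (pair-concatMap g f (filterᵇ (above (just i)) (uHeads ν)))) ⟩
    pair (λ κ → pair g (Ucoef a (just i) κ)) (u i ν) + pair g (Ucoef (suc a) (just i) ν) ≈⟨ +-comm _ _ ⟩
    pair g (Ucoef (suc a) (just i) ν) + pair (λ κ → pair g (Ucoef a (just i) κ)) (u i ν) ∎
    where
    open ≈-Reasoning
    i = ℤ.suc lo
    g : Partition → Carrier
    g κ = ψ κ b
    f : ℤ → Vect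
    f j = apply (Ucoef a (just j)) (u j ν)

  𝒟-step : ∀ i χ ν → 𝒟 (just (ℤ.suc i)) χ ν ≋ Ed i (𝒟 (just i) χ) ν
  𝒟-step i χ ν a zero = ≈-refl
  𝒟-step i χ ν a (suc b) = begin
    pair g (concatMap f (filterᵇ (below (just (ℤ.suc i))) (dHeads ν))) ≈⟨ pair-concatMap g f (filterᵇ (below (just (ℤ.suc i))) (dHeads ν)) ⟩
    sumOver (pair g ∘ f) (filterᵇ (below (just (ℤ.suc i))) (dHeads ν))
      ≈⟨ sumOver-split (pair g ∘ f) (below (just (ℤ.suc i))) (below (just i)) i below-suc
           (T⇒≡true (<ℤ⁺ (i<1+i i))) (¬T⇒≡false λ t → ℤ.<-irrefl refl (<ℤ⁻ {i} {i} t)) (dHeads ν) (DecUnique.deduplicate-! ℤ._≟_ _)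
           (λ i∉ → pair-≡[] g (cong (apply (Dcoef b (just i))) (d-support {i} {ν} (i∉ ∘ ∈-deduplicate⁺ ℤ._≟_)))) ⟩
    pair g (f i) + sumOver (pair g ∘ f) (filterᵇ (below (just i)) (dHeads ν))
      ≈⟨ +-cong (pair-apply g (Dcoef b (just i)) (d i ν)) (≈-sym (pair-concatMap g f (filterᵇ (below (just i)) (dHeads ν)))) ⟩
    pair (λ κ → pair g (Dcoef b (just i) κ)) (d i ν) + pair g (Dcoef (suc b) (just i) ν) ≈⟨ +-comm _ _ ⟩
    pair g (Dcoef (suc b) (just i) ν) + pair (λ κ → pair g (Dcoef b (just i) κ)) (d i ν) ∎
    where
    open ≈-Reasoning
    g : Partition → Carrier
    g κ = χ κ a
    f : ℤ → Vect
    f j = apply (Dcoef b (just j)) (d j ν)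

  𝒰-chain : ∀ K lo ψ → 𝒰 (just lo) ψ ∼ Eus K lo (𝒰 (just (high K lo)) ψ)
  𝒰-chain zero lo ψ = ∼-refl
  𝒰-chain (suc K) lo ψ = ∼-trans (exact (λ {ν} _ → 𝒰-step lo ψ ν)) (Eu-cong _ (𝒰-chain K (ℤ.suc lo) ψ))

  𝒟-chain : ∀ K lo χ → 𝒟 (just (ℤ.suc (high K lo))) χ ∼ Eds K lo (𝒟 (just (ℤ.suc lo)) χ)
  𝒟-chain zero lo χ = ∼-refl
  𝒟-chain (suc K) lo χ = ∼-trans (𝒟-chain K (ℤ.suc lo) χ) (Eds-cong K _ (exact (λ {ν} _ → 𝒟-step (ℤ.suc lo) χ ν)))

-- Cutting off and exchanging the full products

module Exchange {c ℓ : Level} (R : CommutativeRing c ℓ) (q : CommutativeRing.Carrier R) (m W : ℕ) where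

  open CommutativeRing R
    using (Carrier; _≈_; _+_; _*_; 0#; 1#; +-cong; +-congˡ; +-congʳ; *-cong; *-congˡ; *-congʳ;
           +-assoc; +-identityʳ; *-assoc; *-identityˡ; zeroˡ; zeroʳ; distribˡ; distribʳ;
           commutativeSemiring)
    renaming (refl to ≈-refl; sym to ≈-sym; trans to ≈-trans; reflexive to ≈-reflexive)
  open Coefficients R q m W public
  open SemiringSolver commutativeSemiring using (solve; _:=_; _:+_; _:*_)

  -- For sizes up to W, flat steps start at -W or later and drops before W. As `base i` = i - m - 1,
  -- every possible head satisfies lo < i ≤ hi; moreover the weight is n at `lo` and 0 at `hi`.
  lo hi : ℤ
  lo = -[1+ W ]
  hi = + (W ℕ.+ m)

  K : ℕ
  K = suc W ℕ.+ (W ℕ.+ m)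

  high-lo : high K lo ≡ hi
  high-lo = trans (high≡ K lo) (cancel (+ suc W) hi)
    where
    cancel : ∀ x y → - x ℤ.+ (x ℤ.+ y) ≡ y
    cancel = solve-∀

  tail-hi : tail hi ≡ + W
  tail-hi = n+m-m (+ W) (+ m)

  module _ {ν : Partition} (p : IsPartition ν) (bound : size ν ℕ.≤ W) where

    -W≤flat : ∀ {k} → Flat ν k → ℤ.suc lo ℤ.≤ k
    -W≤flat f = ℤ.≤-trans (ℤ.≤-reflexive (ℤ.1-[1+n]≡-n W)) (ℤ.≤-trans (ℤ.neg-mono-≤ (ℤ.+≤+ bound)) (flat-bound p f))

    drop<W : ∀ {k} → Drop ν k → k ℤ.< + W
    drop<W d = ℤ.<-≤-trans (drop-bound p d) (ℤ.+≤+ bound)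

    canAdd-range : ∀ {i} → CanAdd i ν → lo ℤ.< i × i ℤ.≤ hi
    canAdd-range {i} (canAdd f d) = ℤ.suc[i]≤j⇒i<j (-W≤flat f) , tail-cancel-≤
      (subst₂ ℤ._≤_ (suc-base i) (sym tail-hi) (ℤ.i<j⇒suc[i]≤j (drop<W d)))

    canRemove-range : ∀ {i} → CanRemove i ν → ℤ.suc lo ℤ.≤ i × i ℤ.≤ hi
    canRemove-range {i} (canRemove d f) =
      ℤ.≤-trans (-W≤flat f) (ℤ.≤-trans (ℤ.<⇒≤ (base<tail i)) (tail≤ i)) ,
      ℤ.≤-trans (ℤ.<⇒≤ (drop<W d)) (ℤ.+≤+ (ℕ.m≤m+n W m))

  bounded : ∀ {ν a} → size ν ℕ.+ suc m ℕ.* a ℕ.≤ W → size ν ℕ.≤ W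
  bounded {ν} le = ℕ.m+n≤o⇒m≤o (size ν) le

  𝒰-bottom : ∀ ψ → 𝒰 nothing ψ ∼ 𝒰 (just lo) ψ
  𝒰-bottom ψ ν zero b p le = ≈-refl
  𝒰-bottom ψ ν (suc a) b p le = ≈-reflexive (cong (pair (λ κ → ψ κ b) ∘ concatMap (λ i → apply (Ucoef a (just i)) (u i ν)))
    (filterᵇ-cong {p = above nothing} {above (just lo)} (uHeads ν)
      λ i∈ → sym (T⇒≡true (<ℤ⁺ (proj₁ (canAdd-range p (bounded {ν} {suc a} le) (uHead⇒canAdd p i∈)))))))

  𝒰-top : ∀ ψ → 𝒰 (just hi) ψ ∼ constU ψ
  𝒰-top ψ ν zero b p le = ≈-trans (+-identityʳ _) (*-identityˡ _)
  𝒰-top ψ ν (suc a) b p le = ≈-reflexive (cong (pair (λ κ → ψ κ b) ∘ concatMap (λ i → apply (Ucoef a (just i)) (u i ν)))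
    (trans (filterᵇ-cong {p = above (just hi)} {λ _ → false} (uHeads ν)
      (λ {i} i∈ → ¬T⇒≡false λ t → ℤ.<⇒≱ (<ℤ⁻ {hi} {i} t) (proj₂ (canAdd-range p (bounded {ν} {suc a} le) (uHead⇒canAdd p i∈)))))
      (filterᵇ-none (uHeads ν))))

  𝒟-top : ∀ χ → 𝒟 nothing χ ∼ 𝒟 (just (ℤ.suc hi)) χ
  𝒟-top χ ν a zero p le = ≈-refl
  𝒟-top χ ν a (suc b) p le = ≈-reflexive (cong (pair (λ κ → χ κ a) ∘ concatMap (λ j → apply (Dcoef b (just j)) (d j ν)))
    (filterᵇ-cong {p = below nothing} {below (just (ℤ.suc hi))} (dHeads ν)
      λ {j} j∈ → sym (T⇒≡true (<ℤ⁺ {j} (ℤ.≤-<-trans (proj₂ (canRemove-range p (bounded {ν} {a} le) (dHead⇒canRemove p j∈))) (i<1+i hi))))))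

  𝒟-bottom : ∀ χ → 𝒟 (just (ℤ.suc lo)) χ ∼ constD χ
  𝒟-bottom χ ν a zero p le = ≈-trans (+-identityʳ _) (*-identityˡ _)
  𝒟-bottom χ ν a (suc b) p le = ≈-reflexive (cong (pair (λ κ → χ κ a) ∘ concatMap (λ j → apply (Dcoef b (just j)) (d j ν)))
    (trans (filterᵇ-cong {p = below (just (ℤ.suc lo))} {λ _ → false} (dHeads ν)
      (λ {j} j∈ → ¬T⇒≡false λ t → ℤ.<⇒≱ (<ℤ⁻ {j} {ℤ.suc lo} t) (proj₁ (canRemove-range p (bounded {ν} {a} le) (dHead⇒canRemove p j∈)))))
      (filterᵇ-none (dHeads ν))))

  𝒰-product : ∀ ψ → 𝒰 nothing ψ ∼ Eus K lo (constU ψ)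
  𝒰-product ψ = ∼-trans (𝒰-bottom ψ) (∼-trans (𝒰-chain K lo ψ)
    (Eus-cong K lo (subst (λ h → 𝒰 (just h) ψ ∼ constU ψ) (sym high-lo) (𝒰-top ψ))))

  𝒟-product : ∀ χ → 𝒟 nothing χ ∼ Eds K lo (constD χ)
  𝒟-product χ = ∼-trans (subst (λ h → 𝒟 nothing χ ∼ 𝒟 (just (ℤ.suc h)) χ) (sym high-lo) (𝒟-top χ))
    (∼-trans (𝒟-chain K lo χ) (Eds-cong K lo (𝒟-bottom χ)))

  X-high : ∀ φ → φ ∼ X (high K lo) φ
  X-high φ ν a b p le = geos-≡ (φ ν) (sym (weight-right (high K lo) p
    (subst (λ h → + size ν ℤ.≤ tail h) (sym high-lo) (subst (+ size ν ℤ.≤_) (sym tail-hi) (ℤ.+≤+ (bounded {ν} {a} le)))))) a b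

  X-low : ∀ φ → X lo φ ∼ scaled (λ _ → suc m) φ
  X-low φ ν a b p le = geos-≡ (φ ν) (weight-left W p (bounded {ν} {a} le)) a b

  origin : (Partition → Carrier) → Partition → ℕ → Carrier
  origin g ν zero = g ν
  origin g ν (suc _) = 0#

  afterD afterU : (Partition → Carrier) → Partition → ℕ → Carrier
  afterD g κ b = pair g (Dcoef b nothing κ)
  afterU g κ a = pair g (Ucoef a nothing κ)

  -- The junction of the two products: what follows all factors of U(x) is itself a D-product,
  -- started from a constant functional.
  constU-afterD : ∀ g → constU (afterD g) ∼ 𝒟 nothing (origin g)
  constU-afterD g ν zero b p le = ≈-refl
  constU-afterD g ν (suc a) b p le = ≈-sym (pair-zero (Dcoef b nothing ν))

  constD-afterU : ∀ g → 𝒰 nothing (origin g) ∼ constD (afterU g)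
  constD-afterU g ν a zero p le = ≈-refl
  constD-afterU g ν a (suc b) p le = pair-zero (Ucoef a nothing ν)

  constD-origin : ∀ g → constD (origin g) ∼ constU (origin g)
  constD-origin g ν zero zero p le = ≈-refl
  constD-origin g ν (suc a) zero p le = ≈-refl
  constD-origin g ν zero (suc b) p le = ≈-refl
  constD-origin g ν (suc a) (suc b) p le = ≈-refl

  -- Pulling back reverses the order: the left side is g after D(y) U(x), the right side g after
  -- U(x) D(y), multiplied by the n geometric series.
  UD-exchange : ∀ g → 𝒰 nothing (afterD g) ∼ scaled (λ _ → suc m) (𝒟 nothing (afterU g))
  UD-exchange g =
    ∼-trans (𝒰-product (afterD g))
    (∼-trans (Eus-cong K lo (∼-trans (constU-afterD g) (∼-trans (𝒟-product (origin g)) (X-high _))))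
    (∼-trans (exchange K lo (constD (origin g)))
    (∼-trans (Eds-cong K lo (∼-trans (X-low _) (scaled-cong (λ _ → suc m)
      (∼-trans (Eus-cong K lo (constD-origin g)) (∼-trans (∼-sym (𝒰-product (origin g))) (constD-afterU g))))))
    (∼-trans (Eds-geos K lo (suc m) (constD (afterU g)))
    (scaled-cong (λ _ → suc m) (∼-sym (𝒟-product (afterU g))))))))

  -- The coefficients of the product of geometric series

  sumTo : ℕ → (ℕ → Carrier) → Carrier
  sumTo zero T = 0#
  sumTo (suc N) T = T 0 + sumTo N (T ∘ suc)

  sumTo-cong : ∀ N {S T} → (∀ j → S j ≈ T j) → sumTo N S ≈ sumTo N T
  sumTo-cong zero e = ≈-refl
  sumTo-cong (suc N) e = +-cong (e 0) (sumTo-cong N (e ∘ suc))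

  sumTo-zero : ∀ N {T} → (∀ j → T j ≈ 0#) → sumTo N T ≈ 0#
  sumTo-zero zero e = ≈-refl
  sumTo-zero (suc N) e = ≈-trans (+-cong (e 0) (sumTo-zero N (e ∘ suc))) (+-identityʳ 0#)

  sumTo-+ : ∀ N S T → sumTo N (λ j → S j + T j) ≈ sumTo N S + sumTo N T
  sumTo-+ zero S T = ≈-sym (+-identityʳ 0#)
  sumTo-+ (suc N) S T = ≈-trans (+-congˡ (sumTo-+ N (S ∘ suc) (T ∘ suc)))
    (solve 4 (λ a b c d → a :+ b :+ (c :+ d) := a :+ c :+ (b :+ d)) ≈-refl _ _ _ _)

  sumTo-* : ∀ w N T → sumTo N (λ j → w * T j) ≈ w * sumTo N T
  sumTo-* w zero T = ≈-sym (zeroʳ w)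
  sumTo-* w (suc N) T = ≈-trans (+-congˡ (sumTo-* w N (T ∘ suc))) (≈-sym (distribˡ w _ _))

  sumOver-applyUpTo : {A : Set} (T : A → Carrier) (h : ℕ → A) → ∀ N → sumOver T (applyUpTo h N) ≈ sumTo N (T ∘ h)
  sumOver-applyUpTo T h zero = ≈-refl
  sumOver-applyUpTo T h (suc N) = +-congˡ (sumOver-applyUpTo T (h ∘ suc) N)

  foldr-applyUpTo : {A : Set} (T : A → Carrier) (h : ℕ → A) → ∀ N → foldr _+_ 0# (map T (applyUpTo h N)) ≈ sumTo N (T ∘ h)
  foldr-applyUpTo T h zero = ≈-refl
  foldr-applyUpTo T h (suc N) = +-congˡ (foldr-applyUpTo T (h ∘ suc) N)

  pow-2* : ∀ k → pow q (2 ℕ.* k) ≈ pow q k * pow q k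
  pow-2* k = ≈-trans (≈-reflexive (cong (λ j → pow q (k ℕ.+ j)) (ℕ.+-identityʳ k))) (pow-+ k k)

  hcoef-zero : ∀ k → hcoef (suc k) 0 ≈ hcoef k 0
  hcoef-zero k = ≈-trans (+-identityʳ _) (*-identityˡ _)

  -- The coefficients of h = h' + q^{2k} t h, where h and h' are the products of k + 1 and of k
  -- geometric series; the term i = 0 of the defining sum gives h'.
  hcoef-suc : ∀ k j → hcoef (suc k) (suc j) ≈ hcoef k (suc j) + pow q k * pow q k * hcoef (suc k) j
  hcoef-suc k j = begin
    hcoef (suc k) (suc j) ≈⟨ foldr-applyUpTo (λ i → pow w i * hcoef k (suc j ∸ i)) (id {A = ℕ}) (2 ℕ.+ j) ⟩
    1# * hcoef k (suc j) + sumTo (suc j) (λ i → w * pow w i * hcoef k (j ∸ i))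
      ≈⟨ +-cong (*-identityˡ _) (≈-trans (sumTo-cong (suc j) (λ i → *-assoc w (pow w i) (hcoef k (j ∸ i)))) (sumTo-* w (suc j) (λ i → pow w i * hcoef k (j ∸ i)))) ⟩
    hcoef k (suc j) + w * sumTo (suc j) (λ i → pow w i * hcoef k (j ∸ i))
      ≈⟨ +-congˡ (*-cong (pow-2* k) (≈-sym (foldr-applyUpTo (λ i → pow w i * hcoef k (j ∸ i)) (id {A = ℕ}) (suc j)))) ⟩
    hcoef k (suc j) + pow q k * pow q k * hcoef (suc k) j ∎
    where
    open ≈-Reasoning
    w = pow q (2 ℕ.* k)

  -- Multiplication by k geometric series in the expanded form used by `lhs`; `convolve≋geos`
  -- matches it with the recursive form.
  convolve : ℕ → Series → Series
  convolve k f a b = sumTo (suc (a ℕ.⊓ b)) (λ j → hcoef k j * f (a ∸ j) (b ∸ j))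

  convolve-zero : ∀ f → convolve 0 f ≋ f
  convolve-zero f a b = ≈-trans (+-cong (*-identityˡ _) (sumTo-zero (a ℕ.⊓ b) (λ j → zeroˡ (f (a ∸ suc j) (b ∸ suc j))))) (+-identityʳ _)

  convolve-suc : ∀ k f → convolve (suc k) f ≋ geo (pow q k * pow q k) (convolve k f)
  convolve-suc k f zero b = +-congʳ (*-congʳ (hcoef-zero k))
  convolve-suc k f (suc a) zero = +-congʳ (*-congʳ (hcoef-zero k))
  convolve-suc k f (suc a) (suc b) = begin
    hcoef (suc k) 0 * f (suc a) (suc b) + sumTo N (λ j → hcoef (suc k) (suc j) * f (a ∸ j) (b ∸ j))
      ≈⟨ +-cong (*-congʳ (hcoef-zero k)) (sumTo-cong N λ j → ≈-trans (*-congʳ {f (a ∸ j) (b ∸ j)} (hcoef-suc k j))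
           (≈-trans (distribʳ (f (a ∸ j) (b ∸ j)) _ _) (+-congˡ (*-assoc w _ _)))) ⟩
    hcoef k 0 * f (suc a) (suc b) +
      sumTo N (λ j → hcoef k (suc j) * f (a ∸ j) (b ∸ j) + w * (hcoef (suc k) j * f (a ∸ j) (b ∸ j)))
      ≈⟨ +-congˡ (≈-trans (sumTo-+ N (λ j → hcoef k (suc j) * f (a ∸ j) (b ∸ j)) (λ j → w * (hcoef (suc k) j * f (a ∸ j) (b ∸ j))))
             (+-congˡ (sumTo-* w N (λ j → hcoef (suc k) j * f (a ∸ j) (b ∸ j))))) ⟩
    hcoef k 0 * f (suc a) (suc b) +
      (sumTo N (λ j → hcoef k (suc j) * f (a ∸ j) (b ∸ j)) + w * convolve (suc k) f a b)
      ≈⟨ ≈-sym (+-assoc _ _ _) ⟩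
    convolve k f (suc a) (suc b) + w * convolve (suc k) f a b ≈⟨ +-congˡ (*-congˡ (convolve-suc k f a b)) ⟩
    convolve k f (suc a) (suc b) + w * geo w (convolve k f) a b ∎
    where
    open ≈-Reasoning
    N = suc (a ℕ.⊓ b)
    w = pow q k * pow q k

  convolve≋geos : ∀ k f → convolve k f ≋ geos k f
  convolve≋geos zero f = convolve-zero f
  convolve≋geos (suc k) f = ≋-trans (convolve-suc k f) (geo-cong _ (convolve≋geos k f))

  rhs≈ : ∀ a b λ' μ → coeffAt μ (rhs a b λ') ≈ 𝒰 nothing (afterD (δ μ)) λ' a b
  rhs≈ a b λ' μ = ≈-trans (coeffAt-pair μ (rhs a b λ')) (pair-apply (δ μ) (Dcoef b nothing) (Ucoef a nothing λ'))

  lhs≈ : ∀ a b λ' μ → coeffAt μ (lhs a b λ') ≈ geos (suc m) (𝒟 nothing (afterU (δ μ)) λ') a b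
  lhs≈ a b λ' μ = begin
    coeffAt μ (lhs a b λ') ≈⟨ coeffAt-pair μ (lhs a b λ') ⟩
    pair (δ μ) (lhs a b λ') ≈⟨ pair-concatMap (δ μ) summand (upTo N) ⟩
    sumOver (pair (δ μ) ∘ summand) (upTo N) ≈⟨ sumOver-applyUpTo (pair (δ μ) ∘ summand) (id {A = ℕ}) N ⟩
    sumTo N (pair (δ μ) ∘ summand)
      ≈⟨ sumTo-cong N (λ k → ≈-trans (pair-scale (δ μ) (hcoef (suc m) k) (apply (Ucoef (a ∸ k) nothing) (Dcoef (b ∸ k) nothing λ')))
           (*-congˡ (pair-apply (δ μ) (Ucoef (a ∸ k) nothing) (Dcoef (b ∸ k) nothing λ')))) ⟩
    convolve (suc m) (𝒟 nothing (afterU (δ μ)) λ') a b ≈⟨ convolve≋geos (suc m) (𝒟 nothing (afterU (δ μ)) λ') a b ⟩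
    geos (suc m) (𝒟 nothing (afterU (δ μ)) λ') a b ∎
    where
    open ≈-Reasoning
    N = suc (a ℕ.⊓ b)
    summand : ℕ → Vect
    summand k = scale (hcoef (suc m) k) (apply (Ucoef (a ∸ k) nothing) (Dcoef (b ∸ k) nothing λ'))

theorem5p2 : {c ℓ : Level} (R : CommutativeRing c ℓ) (q : CommutativeRing.Carrier R)
    (n : ℕ) → 1 ≤ n → (a b : ℕ) (λ' μ : Partition) → IsPartition λ' → IsPartition μ →
    CommutativeRing._≈_ R (Fock.coeffAt R q n μ (Fock.lhs R q n a b λ'))
    (Fock.coeffAt R q n μ (Fock.rhs R q n a b λ'))
theorem5p2 R q (suc m) _ a b λ' μ λ-partition _ = begin
  coeffAt μ (lhs a b λ') ≈⟨ lhs≈ a b λ' μ ⟩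
  geos (suc m) (𝒟 nothing (afterU (δ μ)) λ') a b ≈⟨ UD-exchange (δ μ) λ' a b λ-partition ℕ.≤-refl ⟨
  𝒰 nothing (afterD (δ μ)) λ' a b ≈⟨ rhs≈ a b λ' μ ⟨
  coeffAt μ (rhs a b λ') ∎
  where
  -- At most a ribbons of n boxes can be added to `λ'`, so this W satisfies the size bound with
  -- equality.
  open Exchange R q m (size λ' ℕ.+ suc m ℕ.* a)
  open ≈-Reasoning
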